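{- Define integers $c(n)$ by $$\sum_{n=0}^{\infty}c(n)q^{n}=\frac{(q^{2};q^{2})_{\infty}}{(q;q)_{\infty}^{3}}.$$ Then for every integer $n\geq 0$, $$c(125n+99)\equiv 0 \pmod{25}.$$
   Context: Throughout, $|q|<1$ and $(a;q)_{\infty}=\prod_{n=0}^{\infty}(1-aq^{n})$. -}

module Defs where

open import Data.Nat using (ℕ; zero; suc; _*_; _∸_; _≟_)
open import Data.Integer using (ℤ; +_; -_) renaming (_+_ to _+ℤ_; _*_ to _*ℤ_)
open import Relation.Nullary using (yes; no)

-- Formal power series in q with integer coefficients: n ↦ coefficient of qⁿ.
PS : Set
PS = ℕ → ℤ

sumTo : (ℕ → ℤ) → ℕ → ℤ
sumTo h zero    = h zero
sumTo h (suc n) = sumTo h n +ℤ h (suc n)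

_⊛_ : PS → PS → PS
(f ⊛ g) n = sumTo (λ i → f i *ℤ g (n ∸ i)) n

infixl 7 _⊛_

one : PS
one zero    = + 1
one (suc _) = + 0

-- the polynomial 1 - q^j  (used with j ≥ 1)
oneMinus : ℕ → PS
oneMinus j zero = + 1
oneMinus j (suc n) with suc n ≟ j
... | yes _ = - (+ 1)
... | no  _ = + 0

finProd : ℕ → ℕ → PS
finProd a zero    = one
finProd a (suc m) = finProd a m ⊛ oneMinus (a * suc m)

-- (q^a ; q^a)_∞ = ∏_{k≥1} (1 - q^{a k}) for a ≥ 1: the coefficient of qⁿ
-- only depends on the factors with k ≤ n.
qPoch : ℕ → PS
qPoch a n = finProd a n n

{-# OPTIONS --safe #-}
-- Write E1 = (q;q), E2 = (q²;q²), e = (q⁵;q⁵), e′ = (q¹⁰;q¹⁰) and work modulo 25 throughout. Euler's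
-- pentagonal series and Gauss's φ(-q) = E1²/E2 = Σ (-1)ⁿ q^(n²) split E1 and E2 into their parts by
-- exponent modulo 5: E1 = a(q⁵) (1 - q x(q⁵) - q² x(q⁵)²) with a x = e, the same at q² with y instead
-- of x, and one algebraic relation between x and y. Moreover E1⁵ = e (1 - 5L), where L is a Lambert
-- series whose exponents divisible by 5 reproduce L itself; this takes the place of the norm identity
-- for x. Since the generating function is E1² E2 / E1⁵, extracting the exponents 4 modulo 5 becomes
-- algebra on the genus-0 curve of x and y. It gives
--   Σ c(5n+4) qⁿ = e′³/(e E1² E2²) - 10 e e′ E1⁴,   Σ c(25n+24) qⁿ = 10 e e′ E2⁴,
-- and in E2⁴ the coefficients of q^(5n+3) are divisible by 5.
module Submission where

open import Algebra.Bundles using (CommutativeRing; RawRing)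
open import Algebra.Solver.Ring.AlmostCommutativeRing using (fromCommutativeRing; _-Raw-AlmostCommutative⟶_)
open import Algebra.Structures using (IsCommutativeRing)
open import Data.Empty using (⊥-elim)
open import Data.Fin using (zero; #_)
open import Data.Integer as ℤ using (ℤ; +_)
open import Data.Integer.Divisibility using (_∣_)
import Data.Integer.Divisibility.Signed as ℤ∣
import Data.Integer.Properties as ℤ
open import Data.Integer.Tactic.RingSolver using (solve-∀)
open import Data.Maybe.Base using (Maybe; just; nothing)
open import Data.Nat as ℕ using (ℕ; zero; suc; _+_; _*_; _∸_; _%_; _≤_; _<_; z≤n; s≤s)
import Data.Nat.Divisibility as ℕ∣
import Data.Nat.DivMod as ℕ
open import Data.Nat.Primality using (prime?; euclidsLemma)
import Data.Nat.Properties as ℕ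
import Data.Nat.Tactic.RingSolver as ℕ-solver
open import Data.Product using (∃; _×_; _,_)
open import Data.Sum using (_⊎_; inj₁; inj₂)
open import Data.Vec using (Vec; []; _∷_)
open import Function using (_∘_)
open import Level using (0ℓ)
open import Relation.Binary using (Setoid)
open import Relation.Binary.PropositionalEquality as ≡ using (_≡_; _≢_; refl; cong; cong₂)
open import Relation.Nullary using (¬_; yes; no)
open import Relation.Nullary.Decidable using (True; toWitness; from-yes)
open import Defs

-- Power series modulo 25

-- `U i` is compatible only with factors in q⁵ and with series whose five parts are explicit
-- polynomials, so every denominator is an obstacle. Modulo 25 it can be removed: E1⁵ = e λ₁ with λ₁
-- = 1 - 5L gives 1/E1⁵ = (2 - λ₁)/e. Of λ₁ only class 0 is ever known; where other classes would be
-- needed, it is multiplied by e and becomes E1⁵ again. For the second extraction 1/(E1² E2²) is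
-- read as E1³ E2³/(E1⁵ E2⁵), and both fifth powers are treated in this way. Identities are
-- therefore proved multiplied up, and series with constant term 1 are cancelled afterwards. A
-- second obstacle is that class 4 of E1² E2 is not visibly an eta quotient: the curve expresses
-- only the cube of its factor `G` through eta quotients. This costs the extraction of a cube root,
-- possible because 3 is a unit modulo 25. Neither fifth roots of unity nor product formulas for x
-- are required, since the two theta series already determine the parts of E1 and E2.

infix 4 _≋_
record _≋_ (x y : ℤ) : Set where
  constructor mod
  field 25∣ : + 25 ℤ∣.∣ x ℤ.- y

≋-reflexive : ∀ {x y} → x ≡ y → x ≋ y
≋-reflexive {x} refl = mod (ℤ∣.divides (+ 0) (ℤ.+-inverseʳ x))

≋-refl : ∀ {x} → x ≋ x
≋-refl = ≋-reflexive refl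

≋-sym : ∀ {x y} → x ≋ y → y ≋ x
≋-sym {x} {y} (mod p) = mod (≡.subst (_ ℤ∣.∣_) (flip x y) (ℤ∣.∣m⇒∣-m p))
  where
  flip : ∀ x y → ℤ.- (x ℤ.- y) ≡ y ℤ.- x
  flip = solve-∀

≋-trans : ∀ {x y z} → x ≋ y → y ≋ z → x ≋ z
≋-trans {x} {y} {z} (mod p) (mod q) = mod (≡.subst (_ ℤ∣.∣_) (chain x y z) (ℤ∣.∣m∣n⇒∣m+n p q))
  where
  chain : ∀ x y z → (x ℤ.- y) ℤ.+ (y ℤ.- z) ≡ x ℤ.- z
  chain = solve-∀

+-≋ : ∀ {x y u v} → x ≋ y → u ≋ v → x ℤ.+ u ≋ y ℤ.+ v
+-≋ {x} {y} {u} {v} (mod p) (mod q) = mod (≡.subst (_ ℤ∣.∣_) (regroup x y u v) (ℤ∣.∣m∣n⇒∣m+n p q))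
  where
  regroup : ∀ x y u v → (x ℤ.- y) ℤ.+ (u ℤ.- v) ≡ (x ℤ.+ u) ℤ.- (y ℤ.+ v)
  regroup = solve-∀

*-≋ : ∀ {x y u v} → x ≋ y → u ≋ v → x ℤ.* u ≋ y ℤ.* v
*-≋ {x} {y} {u} {v} (mod p) (mod q) = mod (≡.subst (_ ℤ∣.∣_) (expand x y u v)
  (ℤ∣.∣m∣n⇒∣m+n (ℤ∣.∣m⇒∣m*n u p) (ℤ∣.∣n⇒∣m*n y q)))
  where
  expand : ∀ x y u v → (x ℤ.- y) ℤ.* u ℤ.+ y ℤ.* (u ℤ.- v) ≡ x ℤ.* u ℤ.- y ℤ.* v
  expand = solve-∀

neg-≋ : ∀ {x y} → x ≋ y → ℤ.- x ≋ ℤ.- y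
neg-≋ {x} {y} (mod p) = mod (≡.subst (_ ℤ∣.∣_) (distribute x y) (ℤ∣.∣m⇒∣-m p))
  where
  distribute : ∀ x y → ℤ.- (x ℤ.- y) ≡ ℤ.- x ℤ.- ℤ.- y
  distribute = solve-∀

%-≋ : ∀ n → + (n % 25) ≋ + n
%-≋ n = ≋-sym (mod (ℤ∣.divides (+ (n ℕ./ 25)) (begin
  + n ℤ.- + (n % 25)                                       ≡⟨ cong (λ m → + m ℤ.- + (n % 25)) (ℕ.m≡m%n+[m/n]*n n 25) ⟩
  + (n % 25 + n ℕ./ 25 * 25) ℤ.- + (n % 25)                ≡⟨ cong (λ m → m ℤ.- + (n % 25)) (ℤ.pos-+ (n % 25) _) ⟩
  + (n % 25) ℤ.+ + (n ℕ./ 25 * 25) ℤ.- + (n % 25)          ≡⟨ cancel (+ (n % 25)) _ ⟩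
  + (n ℕ./ 25 * 25)                                        ≡⟨ ℤ.pos-* (n ℕ./ 25) 25 ⟩
  + (n ℕ./ 25) ℤ.* + 25                                    ∎)))
  where
  open ≡.≡-Reasoning
  cancel : ∀ x y → x ℤ.+ y ℤ.- x ≡ y
  cancel = solve-∀

-- Opaque, so that ring expressions keep their shape under unification and in the solver; elsewhere
-- coefficients are reached through `⊕-at`, `⊖-at`, `⊗-at`, `scalar-zero` and `scalar-suc`. The
-- transparent `_⊛_` stays available where a coefficient is to be computed.
opaque
  infixl 6 _⊕_
  infixl 7 _⊗_
  infix  8 ⊖_

  _⊕_ : PS → PS → PS
  (f ⊕ g) n = f n ℤ.+ g n

  ⊖_ : PS → PS
  (⊖ f) n = ℤ.- f n

  _⊗_ : PS → PS → PS
  _⊗_ = _⊛_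

  scalar : ℤ → PS
  scalar c zero    = c
  scalar c (suc n) = + 0

const : ℕ → PS
const k = scalar (+ k)

infix 4 _≈_
record _≈_ (f g : PS) : Set where
  constructor coeffwise
  field at : ∀ n → f n ≋ g n
open _≈_

tail : PS → PS
tail f = f ∘ suc

-- Exact laws of convolution, by induction on the coefficient through the
-- decomposition f = f 0 + q · tail f.
module Convolution where
  open ≡.≡-Reasoning

  sumTo-head : ∀ h n → sumTo h (suc n) ≡ h 0 ℤ.+ sumTo (tail h) n
  sumTo-head h zero    = refl
  sumTo-head h (suc n) = ≡.trans (cong (ℤ._+ h (2 + n)) (sumTo-head h n)) (ℤ.+-assoc (h 0) _ _)

  ⊛-head : ∀ f g n → (f ⊛ g) (suc n) ≡ f 0 ℤ.* g (suc n) ℤ.+ (tail f ⊛ g) n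
  ⊛-head f g n = sumTo-head (λ i → f i ℤ.* g (suc n ∸ i)) n

  ⊛-last : ∀ f g n → (f ⊛ g) (suc n) ≡ (f ⊛ tail g) n ℤ.+ f (suc n) ℤ.* g 0
  ⊛-last f g zero    = refl
  ⊛-last f g (suc n) = begin
    (f ⊛ g) (2 + n)                                                          ≡⟨ ⊛-head f g (suc n) ⟩
    f 0 ℤ.* g (2 + n) ℤ.+ (tail f ⊛ g) (suc n)                               ≡⟨ cong (λ t → (f 0 ℤ.* g (2 + n)) ℤ.+ t) (⊛-last (tail f) g n) ⟩
    f 0 ℤ.* g (2 + n) ℤ.+ ((tail f ⊛ tail g) n ℤ.+ f (2 + n) ℤ.* g 0)        ≡⟨ ℤ.+-assoc (f 0 ℤ.* g (2 + n)) _ _ ⟨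
    f 0 ℤ.* g (2 + n) ℤ.+ (tail f ⊛ tail g) n ℤ.+ f (2 + n) ℤ.* g 0          ≡⟨ cong (ℤ._+ (f (2 + n) ℤ.* g 0)) (⊛-head f (tail g) n) ⟨
    (f ⊛ tail g) (suc n) ℤ.+ f (2 + n) ℤ.* g 0                               ∎

  ⊛-comm : ∀ f g n → (f ⊛ g) n ≡ (g ⊛ f) n
  ⊛-comm f g zero    = ℤ.*-comm (f 0) (g 0)
  ⊛-comm f g (suc n) = begin
    (f ⊛ g) (suc n)                               ≡⟨ ⊛-head f g n ⟩
    f 0 ℤ.* g (suc n) ℤ.+ (tail f ⊛ g) n          ≡⟨ cong₂ ℤ._+_ (ℤ.*-comm (f 0) _) (⊛-comm (tail f) g n) ⟩
    g (suc n) ℤ.* f 0 ℤ.+ (g ⊛ tail f) n          ≡⟨ ℤ.+-comm (g (suc n) ℤ.* f 0) _ ⟩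
    (g ⊛ tail f) n ℤ.+ g (suc n) ℤ.* f 0          ≡⟨ ⊛-last g f n ⟨
    (g ⊛ f) (suc n)                               ∎

  sumTo-cong : ∀ {h k} → (∀ n → h n ≡ k n) → ∀ n → sumTo h n ≡ sumTo k n
  sumTo-cong p zero    = p 0
  sumTo-cong p (suc n) = cong₂ ℤ._+_ (sumTo-cong p n) (p (suc n))

  sumTo-linear : ∀ a h k n → sumTo (λ i → a ℤ.* h i ℤ.+ k i) n ≡ a ℤ.* sumTo h n ℤ.+ sumTo k n
  sumTo-linear a h k zero    = refl
  sumTo-linear a h k (suc n) =
    ≡.trans (cong (ℤ._+ (a ℤ.* h (suc n) ℤ.+ k (suc n))) (sumTo-linear a h k n)) (rearrange a _ _ _ _)
    where
    rearrange : ∀ a x y u v → a ℤ.* x ℤ.+ y ℤ.+ (a ℤ.* u ℤ.+ v) ≡ a ℤ.* (x ℤ.+ u) ℤ.+ (y ℤ.+ v)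
    rearrange = solve-∀

  ⊛-linear : ∀ a f g h n → ((λ i → a ℤ.* f i ℤ.+ g i) ⊛ h) n ≡ a ℤ.* (f ⊛ h) n ℤ.+ (g ⊛ h) n
  ⊛-linear a f g h n = ≡.trans (sumTo-cong (λ i → rearrange a (f i) (g i) (h (n ∸ i))) n) (sumTo-linear a _ _ n)
    where
    rearrange : ∀ a x y z → (a ℤ.* x ℤ.+ y) ℤ.* z ≡ a ℤ.* (x ℤ.* z) ℤ.+ y ℤ.* z
    rearrange = solve-∀

  ⊛-assoc : ∀ f g h n → ((f ⊛ g) ⊛ h) n ≡ (f ⊛ (g ⊛ h)) n
  ⊛-assoc f g h zero    = ℤ.*-assoc (f 0) (g 0) (h 0)
  ⊛-assoc f g h (suc n) = begin
    ((f ⊛ g) ⊛ h) (suc n)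
      ≡⟨ ⊛-head (f ⊛ g) h n ⟩
    f 0 ℤ.* g 0 ℤ.* h (suc n) ℤ.+ (tail (f ⊛ g) ⊛ h) n
      ≡⟨ cong (λ t → (f 0 ℤ.* g 0 ℤ.* h (suc n)) ℤ.+ t)
           (sumTo-cong (λ i → cong (ℤ._* h (n ∸ i)) (⊛-head f g i)) n) ⟩
    f 0 ℤ.* g 0 ℤ.* h (suc n) ℤ.+ ((λ i → f 0 ℤ.* tail g i ℤ.+ (tail f ⊛ g) i) ⊛ h) n
      ≡⟨ cong (λ t → (f 0 ℤ.* g 0 ℤ.* h (suc n)) ℤ.+ t) (⊛-linear (f 0) (tail g) (tail f ⊛ g) h n) ⟩
    f 0 ℤ.* g 0 ℤ.* h (suc n) ℤ.+ (f 0 ℤ.* (tail g ⊛ h) n ℤ.+ ((tail f ⊛ g) ⊛ h) n)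
      ≡⟨ rearrange (f 0) (g 0) _ _ _ ⟩
    f 0 ℤ.* (g 0 ℤ.* h (suc n) ℤ.+ (tail g ⊛ h) n) ℤ.+ ((tail f ⊛ g) ⊛ h) n
      ≡⟨ cong₂ (λ x y → f 0 ℤ.* x ℤ.+ y) (≡.sym (⊛-head g h n)) (⊛-assoc (tail f) g h n) ⟩
    f 0 ℤ.* (g ⊛ h) (suc n) ℤ.+ (tail f ⊛ (g ⊛ h)) n
      ≡⟨ ⊛-head f (g ⊛ h) n ⟨
    (f ⊛ (g ⊛ h)) (suc n) ∎
    where
    rearrange : ∀ a b x y z → a ℤ.* b ℤ.* x ℤ.+ (a ℤ.* y ℤ.+ z) ≡ a ℤ.* (b ℤ.* x ℤ.+ y) ℤ.+ z
    rearrange = solve-∀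

  ⊛-zeroˡ : ∀ f n → ((λ _ → + 0) ⊛ f) n ≡ + 0
  ⊛-zeroˡ f zero    = refl
  ⊛-zeroˡ f (suc n) = ≡.trans (⊛-head (λ _ → + 0) f n) (≡.trans (ℤ.+-identityˡ _) (⊛-zeroˡ f n))

  ⊛-distribʳ : ∀ h f g n → ((λ i → f i ℤ.+ g i) ⊛ h) n ≡ (f ⊛ h) n ℤ.+ (g ⊛ h) n
  ⊛-distribʳ h f g n = begin
    ((λ i → f i ℤ.+ g i) ⊛ h) n              ≡⟨ sumTo-cong (λ i → cong (λ x → (x ℤ.+ g i) ℤ.* h (n ∸ i)) (≡.sym (ℤ.*-identityˡ (f i)))) n ⟩
    ((λ i → + 1 ℤ.* f i ℤ.+ g i) ⊛ h) n      ≡⟨ ⊛-linear (+ 1) f g h n ⟩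
    + 1 ℤ.* (f ⊛ h) n ℤ.+ (g ⊛ h) n          ≡⟨ cong (ℤ._+ (g ⊛ h) n) (ℤ.*-identityˡ ((f ⊛ h) n)) ⟩
    (f ⊛ h) n ℤ.+ (g ⊛ h) n                  ∎

open Convolution using (⊛-head)

sumTo-≋ : ∀ {h k} n → (∀ i → i ≤ n → h i ≋ k i) → sumTo h n ≋ sumTo k n
sumTo-≋ zero    p = p 0 z≤n
sumTo-≋ (suc n) p = +-≋ (sumTo-≋ n λ i i≤n → p i (ℕ.m≤n⇒m≤1+n i≤n)) (p (suc n) ℕ.≤-refl)

-- The n-th coefficient of a product depends on the factors up to degree n only.
⊛-≋ : ∀ {f f′ g g′} n → (∀ i → i ≤ n → f i ≋ f′ i) → (∀ i → i ≤ n → g i ≋ g′ i) → (f ⊛ g) n ≋ (f′ ⊛ g′) n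
⊛-≋ n p r = sumTo-≋ n λ i i≤n → *-≋ (p i i≤n) (r (n ∸ i) (ℕ.m∸n≤m n i))

opaque
  unfolding _⊕_

  ⊕-at : ∀ f g n → (f ⊕ g) n ≡ f n ℤ.+ g n
  ⊕-at f g n = refl

  ⊖-at : ∀ f n → (⊖ f) n ≡ ℤ.- f n
  ⊖-at f n = refl

  ⊗-at : ∀ f g n → (f ⊗ g) n ≡ (f ⊛ g) n
  ⊗-at f g n = refl

  scalar-zero : ∀ c → scalar c 0 ≡ c
  scalar-zero c = refl

  scalar-suc : ∀ c n → scalar c (suc n) ≡ + 0
  scalar-suc c n = refl

  isSeriesRing : IsCommutativeRing _≈_ _⊕_ _⊗_ ⊖_ (const 0) (const 1)
  isSeriesRing = record
    { isRing = record
      { +-isAbelianGroup = record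
        { isGroup = record
          { isMonoid = record
            { isSemigroup = record
              { isMagma = record
                { isEquivalence = record
                  { refl  = coeffwise λ _ → ≋-refl
                  ; sym   = λ p → coeffwise λ n → ≋-sym (at p n)
                  ; trans = λ p r → coeffwise λ n → ≋-trans (at p n) (at r n)
                  }
                ; ∙-cong = λ p r → coeffwise λ n → +-≋ (at p n) (at r n)
                }
              ; assoc = λ f g h → coeffwise λ n → ≋-reflexive (ℤ.+-assoc (f n) (g n) (h n))
              }
            ; identity = (λ f → coeffwise λ n → ≋-reflexive (≡.trans (cong (ℤ._+ f n) (zero≡ n)) (ℤ.+-identityˡ (f n))))
                       , (λ f → coeffwise λ n → ≋-reflexive (≡.trans (cong (λ t → f n ℤ.+ t) (zero≡ n)) (ℤ.+-identityʳ (f n))))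
            }
          ; inverse = (λ f → coeffwise λ n → ≋-reflexive (≡.trans (ℤ.+-inverseˡ (f n)) (≡.sym (zero≡ n))))
                    , (λ f → coeffwise λ n → ≋-reflexive (≡.trans (ℤ.+-inverseʳ (f n)) (≡.sym (zero≡ n))))
          ; ⁻¹-cong = λ p → coeffwise λ n → neg-≋ (at p n)
          }
        ; comm = λ f g → coeffwise λ n → ≋-reflexive (ℤ.+-comm (f n) (g n))
        }
      ; *-cong = λ p r → coeffwise λ n → ⊛-≋ n (λ i _ → at p i) (λ i _ → at r i)
      ; *-assoc = λ f g h → coeffwise λ n → ≋-reflexive (Convolution.⊛-assoc f g h n)
      ; *-identity = identityˡ
                   , (λ f → coeffwise λ n → ≋-trans (≋-reflexive (Convolution.⊛-comm f (const 1) n)) (at (identityˡ f) n))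
      ; distrib = (λ h f g → coeffwise λ n → ≋-reflexive (distribˡ h f g n))
                , (λ h f g → coeffwise λ n → ≋-reflexive (Convolution.⊛-distribʳ h f g n))
      }
    ; *-comm = λ f g → coeffwise λ n → ≋-reflexive (Convolution.⊛-comm f g n)
    }
    where
    zero≡ : ∀ n → const 0 n ≡ + 0
    zero≡ zero    = refl
    zero≡ (suc n) = refl
    identityˡ : ∀ f → const 1 ⊗ f ≈ f
    identityˡ f = coeffwise λ where
      zero    → ≋-reflexive (ℤ.*-identityˡ (f 0))
      (suc n) → ≋-reflexive (≡.trans (⊛-head (const 1) f n)
                  (≡.trans (cong₂ ℤ._+_ (ℤ.*-identityˡ (f (suc n))) (Convolution.⊛-zeroˡ f n)) (ℤ.+-identityʳ _)))
    distribˡ : ∀ h f g n → (h ⊗ (f ⊕ g)) n ≡ (h ⊗ f) n ℤ.+ (h ⊗ g) n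
    distribˡ h f g n = ≡.trans (Convolution.⊛-comm h (f ⊕ g) n)
      (≡.trans (Convolution.⊛-distribʳ h f g n) (cong₂ ℤ._+_ (Convolution.⊛-comm f h n) (Convolution.⊛-comm g h n)))

seriesRing : CommutativeRing 0ℓ 0ℓ
seriesRing = record { isCommutativeRing = isSeriesRing }

module R = CommutativeRing seriesRing
open R using () renaming (refl to ≈-refl; sym to ≈-sym; trans to ≈-trans; reflexive to ≈-reflexive;
            +-cong to ⊕-cong; *-cong to ⊗-cong; -‿cong to ⊖-cong)

scalar-cong : ∀ {c d} → c ≋ d → scalar c ≈ scalar d
scalar-cong {c} {d} p = coeffwise λ where
  zero    → ≋-trans (≋-reflexive (scalar-zero c)) (≋-trans p (≋-reflexive (≡.sym (scalar-zero d))))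
  (suc i) → ≋-reflexive (≡.trans (scalar-suc c i) (≡.sym (scalar-suc d i)))

scalar-⊗-at : ∀ c f n → (scalar c ⊗ f) n ≡ c ℤ.* f n
scalar-⊗-at c f n = ≡.trans (⊗-at (scalar c) f n) (lemma n)
  where
  open ≡.≡-Reasoning
  lemma : ∀ n → (scalar c ⊛ f) n ≡ c ℤ.* f n
  lemma zero    = cong (ℤ._* f 0) (scalar-zero c)
  lemma (suc n) = begin
    (scalar c ⊛ f) (suc n)
      ≡⟨ ⊛-head (scalar c) f n ⟩
    scalar c 0 ℤ.* f (suc n) ℤ.+ (tail (scalar c) ⊛ f) n
      ≡⟨ cong₂ (λ x y → x ℤ.* f (suc n) ℤ.+ y) (scalar-zero c)
           (≡.trans (Convolution.sumTo-cong (λ i → cong (ℤ._* f (n ∸ i)) (scalar-suc c i)) n) (Convolution.⊛-zeroˡ f n)) ⟩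
    c ℤ.* f (suc n) ℤ.+ + 0
      ≡⟨ ℤ.+-identityʳ _ ⟩
    c ℤ.* f (suc n) ∎

const-+ : ∀ m n → const (m + n) ≈ const m ⊕ const n
const-+ m n = coeffwise λ where
  zero    → ≋-reflexive (≡.trans (scalar-zero _) (≡.trans (ℤ.pos-+ m n)
              (≡.sym (≡.trans (⊕-at _ _ 0) (cong₂ ℤ._+_ (scalar-zero _) (scalar-zero _))))))
  (suc i) → ≋-reflexive (≡.trans (scalar-suc _ i)
              (≡.sym (≡.trans (⊕-at _ _ (suc i)) (cong₂ ℤ._+_ (scalar-suc _ i) (scalar-suc _ i)))))

const-* : ∀ m n → const (m * n) ≈ const m ⊗ const n
const-* m n = coeffwise λ where
  zero    → ≋-reflexive (≡.trans (scalar-zero _) (≡.trans (ℤ.pos-* m n)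
              (≡.sym (≡.trans (scalar-⊗-at (+ m) _ 0) (cong (λ t → + m ℤ.* t) (scalar-zero _))))))
  (suc i) → ≋-reflexive (≡.trans (scalar-suc _ i)
              (≡.sym (≡.trans (scalar-⊗-at (+ m) _ (suc i))
                (≡.trans (cong (λ t → + m ℤ.* t) (scalar-suc _ i)) (ℤ.*-zeroʳ (+ m))))))

-- Coefficients of the ring solver: residues modulo 25, always reduced.
residues : RawRing 0ℓ 0ℓ
residues = record
  { Carrier = ℕ ; _≈_ = _≡_
  ; _+_ = λ m n → (m + n) % 25 ; _*_ = λ m n → (m * n) % 25 ; -_ = λ m → (24 * m) % 25
  ; 0# = 0 ; 1# = 1 }

residue-hom : residues -Raw-AlmostCommutative⟶ fromCommutativeRing seriesRing
residue-hom = record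
  { ⟦_⟧    = const
  ; +-homo = λ m n → ≈-trans (scalar-cong (%-≋ (m + n))) (const-+ m n)
  ; *-homo = λ m n → ≈-trans (scalar-cong (%-≋ (m * n))) (const-* m n)
  ; -‿homo = λ m → ≈-trans (scalar-cong (%-≋ (24 * m))) (negate m)
  ; 0-homo = ≈-refl
  ; 1-homo = ≈-refl
  }
  where
  open import Relation.Binary.Reasoning.Setoid R.setoid
  cancel : ∀ m → const (24 * m) ⊕ const m ≈ const 0
  cancel m = begin
    const (24 * m) ⊕ const m  ≈⟨ const-+ (24 * m) m ⟨
    const (24 * m + m)        ≡⟨ cong const (ℕ.+-comm (24 * m) m) ⟩
    const (25 * m)            ≈⟨ const-* 25 m ⟩
    const 25 ⊗ const m        ≈⟨ ⊗-cong (scalar-cong (%-≋ 25)) ≈-refl ⟨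
    const 0 ⊗ const m         ≈⟨ R.zeroˡ (const m) ⟩
    const 0                   ∎
  negate : ∀ m → const (24 * m) ≈ ⊖ const m
  negate m = begin
    const (24 * m)                          ≈⟨ R.+-identityʳ _ ⟨
    const (24 * m) ⊕ const 0                ≈⟨ ⊕-cong ≈-refl (R.-‿inverseʳ (const m)) ⟨
    const (24 * m) ⊕ (const m ⊕ ⊖ const m)  ≈⟨ R.+-assoc _ _ _ ⟨
    const (24 * m) ⊕ const m ⊕ ⊖ const m    ≈⟨ ⊕-cong (cancel m) ≈-refl ⟩
    const 0 ⊕ ⊖ const m                     ≈⟨ R.+-identityˡ _ ⟩
    ⊖ const m                               ∎

residue≟ : ∀ m n → Maybe (const m ≈ const n)
residue≟ m n with m ℕ.≟ n
... | yes m≡n = just (≈-reflexive (cong const m≡n))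
... | no  _   = nothing

import Algebra.Solver.Ring residues (fromCommutativeRing seriesRing) residue-hom residue≟ as Horner
open Horner using (Polynomial; var; con; ⟦_⟧; _:+_; _:*_; _:-_; :-_; _:^_)

-- Residues modulo 25 have zero divisors, so the normal forms of Horner can contain vanishing
-- coefficients, which have to be removed.
pruneH : ∀ {n} → Horner.HNF (suc n) → Horner.HNF (suc n)
prune : ∀ {n} → Horner.Normal n → Horner.Normal n
pruneH Horner.∅         = Horner.∅
pruneH (p Horner.*x+ c) = pruneH p Horner.*x+HN prune c
prune (Horner.con c)  = Horner.con c
prune (Horner.poly p) = Horner.poly (pruneH p)

pruneH-correct : ∀ {n} (p : Horner.HNF (suc n)) ρ → Horner.⟦ pruneH p ⟧H ρ ≈ Horner.⟦ p ⟧H ρ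
prune-correct : ∀ {n} (p : Horner.Normal n) ρ → Horner.⟦ prune p ⟧N ρ ≈ Horner.⟦ p ⟧N ρ
pruneH-correct Horner.∅         ρ       = ≈-refl
pruneH-correct (p Horner.*x+ c) (x ∷ ρ) = ≈-trans (Horner.*x+HN≈*x+ (pruneH p) (prune c) (x ∷ ρ))
  (⊕-cong (⊗-cong (pruneH-correct p (x ∷ ρ)) ≈-refl) (prune-correct c ρ))
prune-correct (Horner.con c)  ρ = ≈-refl
prune-correct (Horner.poly p) ρ = pruneH-correct p ρ

⟦_⟧↓ : ∀ {n} → Polynomial n → Vec PS n → PS
⟦ p ⟧↓ ρ = Horner.⟦ prune (Horner.normalise p) ⟧N ρ

open import Relation.Binary.Reflection R.setoid var ⟦_⟧ ⟦_⟧↓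
  (λ p ρ → ≈-trans (prune-correct (Horner.normalise p) ρ) (Horner.correct p ρ))
  using (prove; solve) renaming (_⊜_ to _:=_)
open import Algebra.Properties.Semiring.Exp R.semiring using (_^_; ^-homo-*; ^-congˡ; ^-assocʳ)
open import Algebra.Properties.CommutativeSemiring.Exp R.commutativeSemiring using (^-distrib-*)

-- Truncated equality, limits and reciprocals

infix 4 _≈[_]_
record _≈[_]_ (f : PS) (N : ℕ) (g : PS) : Set where
  constructor below
  field upto : ∀ n → n < N → f n ≋ g n
open _≈[_]_

truncate : ∀ {f g N} → f ≈ g → f ≈[ N ] g
truncate p = below λ n _ → at p n

untruncate : ∀ {f g} → (∀ N → f ≈[ N ] g) → f ≈ g
untruncate p = coeffwise λ n → upto (p (suc n)) n ℕ.≤-refl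

weaken : ∀ {f g M N} → M ≤ N → f ≈[ N ] g → f ≈[ M ] g
weaken M≤N p = below λ n n<M → upto p n (ℕ.≤-trans n<M M≤N)

truncated : ℕ → Setoid 0ℓ 0ℓ
truncated N = record
  { Carrier = PS ; _≈_ = _≈[ N ]_
  ; isEquivalence = record
    { refl  = truncate ≈-refl
    ; sym   = λ p → below λ n n<N → ≋-sym (upto p n n<N)
    ; trans = λ p r → below λ n n<N → ≋-trans (upto p n n<N) (upto r n n<N)
    }
  }

module _ {N : ℕ} where
  open Setoid (truncated N) public using () renaming (refl to ≈[]-refl; sym to ≈[]-sym; trans to ≈[]-trans)

opaque
  unfolding _⊕_
  ⊕-cong-[] : ∀ {N f f′ g g′} → f ≈[ N ] f′ → g ≈[ N ] g′ → f ⊕ g ≈[ N ] f′ ⊕ g′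
  ⊕-cong-[] p r = below λ n n<N → +-≋ (upto p n n<N) (upto r n n<N)

  ⊖-cong-[] : ∀ {N f f′} → f ≈[ N ] f′ → ⊖ f ≈[ N ] ⊖ f′
  ⊖-cong-[] p = below λ n n<N → neg-≋ (upto p n n<N)

  ⊗-cong-[] : ∀ {N f f′ g g′} → f ≈[ N ] f′ → g ≈[ N ] g′ → f ⊗ g ≈[ N ] f′ ⊗ g′
  ⊗-cong-[] p r = below λ n n<N →
    ⊛-≋ n (λ i i≤n → upto p i (ℕ.≤-<-trans i≤n n<N)) (λ i i≤n → upto r i (ℕ.≤-<-trans i≤n n<N))

^-cong-[] : ∀ {N f g} k → f ≈[ N ] g → f ^ k ≈[ N ] g ^ k
^-cong-[] zero    p = ≈[]-refl
^-cong-[] (suc k) p = ⊗-cong-[] p (^-cong-[] k p)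

shift : PS → PS
shift f zero    = + 0
shift f (suc n) = f n

q : PS
q = shift (const 1)

shift≈q⊗ : ∀ f → shift f ≈ q ⊗ f
shift≈q⊗ f = coeffwise λ where
  zero    → ≋-reflexive (≡.sym (⊗-at q f 0))
  (suc n) → ≋-trans (≋-sym (at (R.*-identityˡ f) n))
    (≋-reflexive (≡.trans (⊗-at (const 1) f n) (≡.sym (≡.trans (⊗-at q f (suc n)) (≡.trans (⊛-head q f n) (ℤ.+-identityˡ _))))))

-- This gain of one order drives the inductions on precision below: a head-tail step splits off a
-- constant and leaves a factor q in front of the recursive call.
q-cong-[] : ∀ {N f g} → f ≈[ N ] g → q ⊗ f ≈[ suc N ] q ⊗ g
q-cong-[] {f = f} {g} p = ≈[]-trans (truncate (≈-sym (shift≈q⊗ f)))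
  (≈[]-trans (below λ { zero _ → ≋-refl ; (suc n) (s≤s n<N) → upto p n n<N }) (truncate (shift≈q⊗ g)))

head-tail : ∀ f → f ≈ scalar (f 0) ⊕ q ⊗ tail f
head-tail f = ≈-trans (coeffwise λ where
    zero    → ≋-reflexive (≡.sym (≡.trans (⊕-at _ _ 0) (≡.trans (cong (ℤ._+ + 0) (scalar-zero (f 0))) (ℤ.+-identityʳ (f 0)))))
    (suc n) → ≋-reflexive (≡.sym (≡.trans (⊕-at _ _ (suc n))
                (≡.trans (cong (ℤ._+ f (suc n)) (scalar-suc (f 0) n)) (ℤ.+-identityˡ (f (suc n)))))))
  (⊕-cong ≈-refl (shift≈q⊗ (tail f)))

head-tail-⊗ : ∀ f g → f ⊗ g ≈ scalar (f 0) ⊗ g ⊕ q ⊗ (tail f ⊗ g)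
head-tail-⊗ f g = ≈-trans (⊗-cong (head-tail f) ≈-refl)
  (solve 4 (λ c x f g → (c :+ x :* f) :* g := c :* g :+ x :* (f :* g)) ≈-refl (scalar (f 0)) q (tail f) g)

q^-cong-[] : ∀ {N f g} k → f ≈[ N ] g → q ^ k ⊗ f ≈[ k + N ] q ^ k ⊗ g
q^-cong-[] {N} {f} {g} zero p = ⊗-cong-[] {f = const 1} ≈[]-refl p
q^-cong-[] {N} {f} {g} (suc k) p =
  ≈[]-trans (truncate (R.*-assoc q (q ^ k) f)) (≈[]-trans (q-cong-[] (q^-cong-[] k p)) (truncate (≈-sym (R.*-assoc q (q ^ k) g))))

q^-small : ∀ k f → q ^ k ⊗ f ≈[ k ] const 0
q^-small k f = ≈[]-trans (weaken (ℕ.≤-reflexive (≡.sym (ℕ.+-identityʳ k))) (q^-cong-[] {0} {f} {const 0} k (below λ n ())))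
  (truncate (R.zeroʳ (q ^ k)))

-- If F n and F (suc n) agree below qⁿ for all n, the coefficient of qⁿ no longer changes from F
-- (suc n) on; hence the index.
lim : (ℕ → PS) → PS
lim F n = F (suc n) n

lim-approx : ∀ F → (∀ n → F n ≈[ n ] F (suc n)) → ∀ N → lim F ≈[ N ] F N
lim-approx F p N = below λ n n<N → climb n N n<N
  where
  climb : ∀ n N → n < N → F (suc n) n ≋ F N n
  climb n (suc N) (s≤s n≤N) with ℕ.m≤n⇒m<n∨m≡n n≤N
  ... | inj₁ n<N  = ≋-trans (climb n N n<N) (upto (p N) n n<N)
  ... | inj₂ refl = ≋-refl

-- Iterates of g ↦ 1 - q (tail f) g. Each step settles one more coefficient, and the fixed point
-- inverts 1 + q (tail f), which is f when its constant term is 1.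
reciprocalUpTo : PS → ℕ → PS
reciprocalUpTo f zero    = const 1
reciprocalUpTo f (suc n) = const 1 ⊕ ⊖ (q ⊗ (tail f ⊗ reciprocalUpTo f n))

reciprocal : PS → PS
reciprocal f = lim (reciprocalUpTo f)

reciprocal-step : ∀ f {N g h} → g ≈[ N ] h →
                  const 1 ⊕ ⊖ (q ⊗ (tail f ⊗ g)) ≈[ suc N ] const 1 ⊕ ⊖ (q ⊗ (tail f ⊗ h))
reciprocal-step f p = ⊕-cong-[] ≈[]-refl (⊖-cong-[] (q-cong-[] (⊗-cong-[] ≈[]-refl p)))

reciprocal-approx : ∀ f N → reciprocal f ≈[ N ] reciprocalUpTo f N
reciprocal-approx f = lim-approx (reciprocalUpTo f) coherent
  where
  coherent : ∀ n → reciprocalUpTo f n ≈[ n ] reciprocalUpTo f (suc n)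
  coherent zero    = below λ n ()
  coherent (suc n) = reciprocal-step f (coherent n)

reciprocal-inverse : ∀ f → f 0 ≋ + 1 → f ⊗ reciprocal f ≈ const 1
reciprocal-inverse f f0≋1 = begin
  f ⊗ f⁻¹                                        ≈⟨ head-tail-⊗ f f⁻¹ ⟩
  scalar (f 0) ⊗ f⁻¹ ⊕ q ⊗ (tail f ⊗ f⁻¹)        ≈⟨ ⊕-cong (⊗-cong (scalar-cong f0≋1) fixpoint) ≈-refl ⟩
  const 1 ⊗ (const 1 ⊕ ⊖ (q ⊗ (tail f ⊗ f⁻¹))) ⊕ q ⊗ (tail f ⊗ f⁻¹)
                                                 ≈⟨ solve 1 (λ x → con 1 :* (con 1 :+ :- x) :+ x := con 1) ≈-refl (q ⊗ (tail f ⊗ f⁻¹)) ⟩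
  const 1                                        ∎
  where
  open import Relation.Binary.Reasoning.Setoid R.setoid
  f⁻¹ = reciprocal f
  fixpoint : f⁻¹ ≈ const 1 ⊕ ⊖ (q ⊗ (tail f ⊗ f⁻¹))
  fixpoint = untruncate λ N → weaken (ℕ.n≤1+n N)
    (≈[]-trans (reciprocal-approx f (suc N)) (reciprocal-step f (≈[]-sym (reciprocal-approx f N))))

-- Modulo 25 there are zero divisors, so a factor is cancelled by inverting it. Constant term 1
-- makes it a unit.
⊗-cancelˡ : ∀ u {f g} → u 0 ≋ + 1 → u ⊗ f ≈ u ⊗ g → f ≈ g
⊗-cancelˡ u {f} {g} u0 p = begin
  f                     ≈⟨ R.*-identityˡ f ⟨
  const 1 ⊗ f           ≈⟨ ⊗-cong inverse ≈-refl ⟨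
  u⁻¹ ⊗ u ⊗ f           ≈⟨ R.*-assoc u⁻¹ u f ⟩
  u⁻¹ ⊗ (u ⊗ f)         ≈⟨ ⊗-cong ≈-refl p ⟩
  u⁻¹ ⊗ (u ⊗ g)         ≈⟨ R.*-assoc u⁻¹ u g ⟨
  u⁻¹ ⊗ u ⊗ g           ≈⟨ ⊗-cong inverse ≈-refl ⟩
  const 1 ⊗ g           ≈⟨ R.*-identityˡ g ⟩
  g                     ∎
  where
  open import Relation.Binary.Reasoning.Setoid R.setoid
  u⁻¹ = reciprocal u
  inverse : u⁻¹ ⊗ u ≈ const 1
  inverse = ≈-trans (R.*-comm u⁻¹ u) (reciprocal-inverse u u0)

-- spread e c f = q^c f(q^(1+e)), by counting down the zeros between two coefficients of f
spread : ℕ → ℕ → PS → PS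
spread e zero    f zero    = f 0
spread e zero    f (suc n) = spread e e (tail f) n
spread e (suc c) f zero    = + 0
spread e (suc c) f (suc n) = spread e c f n

spread-cong-[] : ∀ {N f g} e c → f ≈[ N ] g → spread e c f ≈[ N ] spread e c g
spread-cong-[] {N} e c p = below λ n n<N → go c n p n<N
  where
  go : ∀ {N f g} c n → f ≈[ N ] g → n < N → spread e c f n ≋ spread e c g n
  go zero    zero    p n<N       = upto p 0 n<N
  go zero    (suc n) p (s≤s n<N) = go e n (below λ i i<N → upto p (suc i) (s≤s i<N)) n<N
  go (suc c) zero    p n<N       = ≋-refl
  go (suc c) (suc n) p n<N       = go c n p (ℕ.<-trans (ℕ.n<1+n n) n<N)

spread-cong : ∀ {f g} e c → f ≈ g → spread e c f ≈ spread e c g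
spread-cong e c p = untruncate λ N → spread-cong-[] e c (truncate p)

spread-⊕ : ∀ e c f g → spread e c (f ⊕ g) ≈ spread e c f ⊕ spread e c g
spread-⊕ e c f g = coeffwise λ n → ≋-trans (go c n (λ i → ≋-reflexive (⊕-at f g i))) (≋-reflexive (≡.sym (⊕-at _ _ n)))
  where
  go : ∀ {f g h} c n → (∀ i → h i ≋ f i ℤ.+ g i) → spread e c h n ≋ spread e c f n ℤ.+ spread e c g n
  go zero    zero    p = p 0
  go zero    (suc n) p = go e n λ i → p (suc i)
  go (suc c) zero    p = ≋-refl
  go (suc c) (suc n) p = go c n p

spread-scalar-⊗ : ∀ e c k f → spread e c (scalar k ⊗ f) ≈ scalar k ⊗ spread e c f
spread-scalar-⊗ e c k f = coeffwise λ n → ≋-trans (go c n (λ i → ≋-reflexive (scalar-⊗-at k f i))) (≋-reflexive (≡.sym (scalar-⊗-at k _ n)))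
  where
  go : ∀ {f h} c n → (∀ i → h i ≋ k ℤ.* f i) → spread e c h n ≋ k ℤ.* spread e c f n
  go zero    zero    p = p 0
  go zero    (suc n) p = go e n λ i → p (suc i)
  go (suc c) zero    p = ≋-reflexive (≡.sym (ℤ.*-zeroʳ k))
  go (suc c) (suc n) p = go c n p

spread-suc : ∀ e c f → spread e (suc c) f ≈ q ⊗ spread e c f
spread-suc e c f = ≈-trans (coeffwise λ { zero → ≋-refl ; (suc n) → ≋-refl }) (shift≈q⊗ _)

spread≈ : ∀ e c f → spread e c f ≈ q ^ c ⊗ spread e 0 f
spread≈ e zero    f = ≈-sym (R.*-identityˡ _)
spread≈ e (suc c) f = ≈-trans (spread-suc e c f) (≈-trans (⊗-cong ≈-refl (spread≈ e c f)) (≈-sym (R.*-assoc q (q ^ c) _)))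

spread-q⊗ : ∀ e f → spread e 0 (q ⊗ f) ≈ q ^ suc e ⊗ spread e 0 f
spread-q⊗ e f = ≈-trans (spread-cong e 0 (≈-sym (shift≈q⊗ f)))
  (≈-trans (coeffwise λ { zero → ≋-refl ; (suc n) → ≋-refl })
  (≈-trans (shift≈q⊗ (spread e e f)) (≈-trans (⊗-cong ≈-refl (spread≈ e e f)) (≈-sym (R.*-assoc q (q ^ e) _)))))

spread-zeros : ∀ {f} e c n → (∀ i → f i ≋ + 0) → spread e c f n ≋ + 0
spread-zeros e zero    zero    p = p 0
spread-zeros e zero    (suc n) p = spread-zeros e e n λ i → p (suc i)
spread-zeros e (suc c) zero    p = ≋-refl
spread-zeros e (suc c) (suc n) p = spread-zeros e c n p

spread-scalar : ∀ e k → spread e 0 (scalar k) ≈ scalar k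
spread-scalar e k = coeffwise λ where
  zero    → ≋-refl
  (suc n) → ≋-trans (spread-zeros e e n λ i → ≋-reflexive (scalar-suc k i)) (≋-reflexive (≡.sym (scalar-suc k n)))

spread-head-tail : ∀ e f → spread e 0 f ≈ scalar (f 0) ⊕ q ^ suc e ⊗ spread e 0 (tail f)
spread-head-tail e f = ≈-trans (spread-cong e 0 (head-tail f))
  (≈-trans (spread-⊕ e 0 _ _) (⊕-cong (spread-scalar e (f 0)) (spread-q⊗ e (tail f))))

spread-⊗ : ∀ e f g → spread e 0 (f ⊗ g) ≈ spread e 0 f ⊗ spread e 0 g
spread-⊗ e f g = untruncate λ N → go N f g
  where
  open import Relation.Binary.Reasoning.MultiSetoid
  S = spread e 0
  go : ∀ N f g → S (f ⊗ g) ≈[ N ] S f ⊗ S g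
  go zero    f g = below λ n ()
  go (suc N) f g = begin⟨ truncated (suc N) ⟩
    S (f ⊗ g)
      ≈⟨ truncate (spread-cong e 0 (head-tail-⊗ f g)) ⟩
    S (scalar (f 0) ⊗ g ⊕ q ⊗ (tail f ⊗ g))
      ≈⟨ truncate (≈-trans (spread-⊕ e 0 _ _) (⊕-cong (spread-scalar-⊗ e 0 (f 0) g)
           (≈-trans (spread-q⊗ e (tail f ⊗ g)) (R.*-assoc q (q ^ e) _)))) ⟩
    scalar (f 0) ⊗ S g ⊕ q ⊗ (q ^ e ⊗ S (tail f ⊗ g))
      ≈⟨ ⊕-cong-[] ≈[]-refl (q-cong-[] (⊗-cong-[] ≈[]-refl (go N (tail f) g))) ⟩
    scalar (f 0) ⊗ S g ⊕ q ⊗ (q ^ e ⊗ (S (tail f) ⊗ S g))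
      ≈⟨ truncate (solve 5 (λ c x y f g → c :* g :+ x :* (y :* (f :* g)) := (c :+ x :* y :* f) :* g) ≈-refl
           (scalar (f 0)) q (q ^ e) (S (tail f)) (S g)) ⟩
    (scalar (f 0) ⊕ q ^ suc e ⊗ S (tail f)) ⊗ S g
      ≈⟨ truncate (⊗-cong (spread-head-tail e f) ≈-refl) ⟨
    S f ⊗ S g ∎

-- Dissection by exponents modulo 5

δ σ : PS → PS
δ = spread 1 0
σ = spread 4 0

-- Σ f(5n+i) qⁿ; the modulus comes last so that 5 + n * 5 and suc n * 5 agree definitionally.
U : ℕ → PS → PS
U i f n = f (i + n * 5)

U-cong : ∀ {f g} i → f ≈ g → U i f ≈ U i g
U-cong i p = coeffwise λ n → at p (i + n * 5)

U-⊕ : ∀ i f g → U i (f ⊕ g) ≈ U i f ⊕ U i g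
U-⊕ i f g = coeffwise λ n → ≋-reflexive (≡.trans (⊕-at f g _) (≡.sym (⊕-at (U i f) (U i g) n)))

U-scalar⊗ : ∀ i k f → U i (scalar k ⊗ f) ≈ scalar k ⊗ U i f
U-scalar⊗ i k f = coeffwise λ n → ≋-reflexive (≡.trans (scalar-⊗-at k f _) (≡.sym (scalar-⊗-at k (U i f) n)))

U-⊖ : ∀ i f → U i (⊖ f) ≈ ⊖ U i f
U-⊖ i f = coeffwise λ n → ≋-reflexive (≡.trans (⊖-at f _) (≡.sym (⊖-at (U i f) n)))

U-suc-q⊗ : ∀ i f → U (suc i) (q ⊗ f) ≈ U i f
U-suc-q⊗ i f = ≈-sym (U-cong (suc i) (shift≈q⊗ f))

U-zero-q⊗ : ∀ f → U 0 (q ⊗ f) ≈ q ⊗ U 4 f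
U-zero-q⊗ f = ≈-trans (≈-sym (U-cong 0 (shift≈q⊗ f)))
  (≈-trans (coeffwise λ { zero → ≋-refl ; (suc n) → ≋-refl }) (shift≈q⊗ (U 4 f)))

U-zero-head : ∀ f → U 0 f ≈ scalar (f 0) ⊕ q ⊗ U 4 (tail f)
U-zero-head f = head-tail (U 0 f)

record Parts (X : Set) : Set where
  constructor ⟨_,_,_,_,_⟩
  field p₀ p₁ p₂ p₃ p₄ : X

infix 4 _≈⁵_
record _≈⁵_ (u v : Parts PS) : Set where
  constructor [_,_,_,_,_]
  private
    module u = Parts u
    module v = Parts v
  field
    ≈₀ : u.p₀ ≈ v.p₀
    ≈₁ : u.p₁ ≈ v.p₁
    ≈₂ : u.p₂ ≈ v.p₂
    ≈₃ : u.p₃ ≈ v.p₃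
    ≈₄ : u.p₄ ≈ v.p₄
open _≈⁵_

≈⁵-trans : ∀ {u v w} → u ≈⁵ v → v ≈⁵ w → u ≈⁵ w
≈⁵-trans [ a , b , c , d , e ] [ a′ , b′ , c′ , d′ , e′ ] =
  [ ≈-trans a a′ , ≈-trans b b′ , ≈-trans c c′ , ≈-trans d d′ , ≈-trans e e′ ]

U⁵ : PS → Parts PS
U⁵ f = ⟨ U 0 f , U 1 f , U 2 f , U 3 f , U 4 f ⟩

U⁵-cong : ∀ {f g} → f ≈ g → U⁵ f ≈⁵ U⁵ g
U⁵-cong p = [ U-cong 0 p , U-cong 1 p , U-cong 2 p , U-cong 3 p , U-cong 4 p ]

-- The carrier is arbitrary because this is applied both to series and to the polynomials handed to
-- the solver. The factor q is the carry when two residues add up to 5 or more.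
convolve : {X : Set} (_+_ _*_ : X → X → X) → X → Parts X → Parts X → Parts X
convolve _+_ _*_ q ⟨ x₀ , x₁ , x₂ , x₃ , x₄ ⟩ ⟨ y₀ , y₁ , y₂ , y₃ , y₄ ⟩ = ⟨
    (x₀ * y₀) + (q * ((((x₁ * y₄) + (x₂ * y₃)) + (x₃ * y₂)) + (x₄ * y₁)))
  , ((x₀ * y₁) + (x₁ * y₀)) + (q * (((x₂ * y₄) + (x₃ * y₃)) + (x₄ * y₂)))
  , (((x₀ * y₂) + (x₁ * y₁)) + (x₂ * y₀)) + (q * ((x₃ * y₄) + (x₄ * y₃)))
  , ((((x₀ * y₃) + (x₁ * y₂)) + (x₂ * y₁)) + (x₃ * y₀)) + (q * (x₄ * y₄))
  , ((((x₀ * y₄) + (x₁ * y₃)) + (x₂ * y₂)) + (x₃ * y₁)) + (x₄ * y₀) ⟩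

product : PS → PS → Parts PS
product f g = convolve _⊕_ _⊗_ q (U⁵ f) (U⁵ g)

module PartsOfProduct where
  open Parts
  private
    Holds : ℕ → (Parts PS → PS) → ℕ → Set
    Holds i p N = ∀ f g → U i (f ⊗ g) ≈[ N ] p (product f g)

    U-head-⊗ : ∀ i f g → U i (f ⊗ g) ≈ scalar (f 0) ⊗ U i g ⊕ U i (q ⊗ (tail f ⊗ g))
    U-head-⊗ i f g = ≈-trans (U-cong i (head-tail-⊗ f g)) (≈-trans (U-⊕ i _ _) (⊕-cong (U-scalar⊗ i (f 0) g) ≈-refl))

    wrap : ∀ {N} → Holds 4 p₄ N → Holds 0 p₀ (suc N)
    wrap p f g =
      ≈[]-trans (truncate (≈-trans (U-head-⊗ 0 f g) (⊕-cong ≈-refl (U-zero-q⊗ _))))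
      (≈[]-trans (⊕-cong-[] ≈[]-refl (q-cong-[] (p (tail f) g)))
      (truncate (≈-trans
        (solve 12 (λ c x a₀ a₁ a₂ a₃ a₄ b₀ b₁ b₂ b₃ b₄ →
           c :* b₀ :+ x :* (a₀ :* b₄ :+ a₁ :* b₃ :+ a₂ :* b₂ :+ a₃ :* b₁ :+ a₄ :* b₀)
           := (c :+ x :* a₄) :* b₀ :+ x :* (a₀ :* b₄ :+ a₁ :* b₃ :+ a₂ :* b₂ :+ a₃ :* b₁)) ≈-refl
           (scalar (f 0)) q (U 1 f) (U 2 f) (U 3 f) (U 4 f) (U 5 f) (U 0 g) (U 1 g) (U 2 g) (U 3 g) (U 4 g))
        (⊕-cong (⊗-cong (≈-sym (U-zero-head f)) ≈-refl) ≈-refl))))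

    next : ∀ {N} i s t → Holds i s N →
           (∀ f g → scalar (f 0) ⊗ U (suc i) g ⊕ s (product (tail f) g) ≈ t (product f g)) → Holds (suc i) t N
    next i s t p r f g = ≈[]-trans (truncate (≈-trans (U-head-⊗ (suc i) f g) (⊕-cong ≈-refl (U-suc-q⊗ i _))))
      (≈[]-trans (⊕-cong-[] ≈[]-refl (p (tail f) g)) (truncate (r f g)))

    product₁ : ∀ f g → scalar (f 0) ⊗ U 1 g ⊕ p₀ (product (tail f) g) ≈ p₁ (product f g)
    product₁ f g = ≈-trans
      (solve 12 (λ c x a₁ a₂ a₃ a₄ a₅ b₀ b₁ b₂ b₃ b₄ →
         c :* b₁ :+ (a₁ :* b₀ :+ x :* (a₂ :* b₄ :+ a₃ :* b₃ :+ a₄ :* b₂ :+ a₅ :* b₁))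
         := (c :+ x :* a₅) :* b₁ :+ a₁ :* b₀ :+ x :* (a₂ :* b₄ :+ a₃ :* b₃ :+ a₄ :* b₂)) ≈-refl
         (scalar (f 0)) q (U 1 f) (U 2 f) (U 3 f) (U 4 f) (U 5 f) (U 0 g) (U 1 g) (U 2 g) (U 3 g) (U 4 g))
      (⊕-cong (⊕-cong (⊗-cong (≈-sym (U-zero-head f)) ≈-refl) ≈-refl) ≈-refl)

    product₂ : ∀ f g → scalar (f 0) ⊗ U 2 g ⊕ p₁ (product (tail f) g) ≈ p₂ (product f g)
    product₂ f g = ≈-trans
      (solve 12 (λ c x a₁ a₂ a₃ a₄ a₅ b₀ b₁ b₂ b₃ b₄ →
         c :* b₂ :+ (a₁ :* b₁ :+ a₂ :* b₀ :+ x :* (a₃ :* b₄ :+ a₄ :* b₃ :+ a₅ :* b₂))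
         := (c :+ x :* a₅) :* b₂ :+ a₁ :* b₁ :+ a₂ :* b₀ :+ x :* (a₃ :* b₄ :+ a₄ :* b₃)) ≈-refl
         (scalar (f 0)) q (U 1 f) (U 2 f) (U 3 f) (U 4 f) (U 5 f) (U 0 g) (U 1 g) (U 2 g) (U 3 g) (U 4 g))
      (⊕-cong (⊕-cong (⊕-cong (⊗-cong (≈-sym (U-zero-head f)) ≈-refl) ≈-refl) ≈-refl) ≈-refl)

    product₃ : ∀ f g → scalar (f 0) ⊗ U 3 g ⊕ p₂ (product (tail f) g) ≈ p₃ (product f g)
    product₃ f g = ≈-trans
      (solve 12 (λ c x a₁ a₂ a₃ a₄ a₅ b₀ b₁ b₂ b₃ b₄ →
         c :* b₃ :+ (a₁ :* b₂ :+ a₂ :* b₁ :+ a₃ :* b₀ :+ x :* (a₄ :* b₄ :+ a₅ :* b₃))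
         := (c :+ x :* a₅) :* b₃ :+ a₁ :* b₂ :+ a₂ :* b₁ :+ a₃ :* b₀ :+ x :* (a₄ :* b₄)) ≈-refl
         (scalar (f 0)) q (U 1 f) (U 2 f) (U 3 f) (U 4 f) (U 5 f) (U 0 g) (U 1 g) (U 2 g) (U 3 g) (U 4 g))
      (⊕-cong (⊕-cong (⊕-cong (⊕-cong (⊗-cong (≈-sym (U-zero-head f)) ≈-refl) ≈-refl) ≈-refl) ≈-refl) ≈-refl)

    product₄ : ∀ f g → scalar (f 0) ⊗ U 4 g ⊕ p₃ (product (tail f) g) ≈ p₄ (product f g)
    product₄ f g = ≈-trans
      (solve 12 (λ c x a₁ a₂ a₃ a₄ a₅ b₀ b₁ b₂ b₃ b₄ →
         c :* b₄ :+ (a₁ :* b₃ :+ a₂ :* b₂ :+ a₃ :* b₁ :+ a₄ :* b₀ :+ x :* (a₅ :* b₄))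
         := (c :+ x :* a₅) :* b₄ :+ a₁ :* b₃ :+ a₂ :* b₂ :+ a₃ :* b₁ :+ a₄ :* b₀) ≈-refl
         (scalar (f 0)) q (U 1 f) (U 2 f) (U 3 f) (U 4 f) (U 5 f) (U 0 g) (U 1 g) (U 2 g) (U 3 g) (U 4 g))
      (⊕-cong (⊕-cong (⊕-cong (⊕-cong (⊗-cong (≈-sym (U-zero-head f)) ≈-refl) ≈-refl) ≈-refl) ≈-refl) ≈-refl)

    -- The induction runs round the five classes: splitting off f 0 turns class i + 1 of f g into
    -- class i of (tail f) g, and class 0 into class 4 with a factor q. Only the passage through
    -- class 0 raises the precision, so that is where the recursion decreases.
    holds₀ : ∀ N → Holds 0 p₀ N
    holds₁ : ∀ N → Holds 1 p₁ N
    holds₂ : ∀ N → Holds 2 p₂ N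
    holds₃ : ∀ N → Holds 3 p₃ N
    holds₄ : ∀ N → Holds 4 p₄ N
    holds₀ zero    f g = below λ n ()
    holds₀ (suc N) = wrap (holds₄ N)
    holds₁ N = next 0 p₀ p₁ (holds₀ N) product₁
    holds₂ N = next 1 p₁ p₂ (holds₁ N) product₂
    holds₃ N = next 2 p₂ p₃ (holds₂ N) product₃
    holds₄ N = next 3 p₃ p₄ (holds₃ N) product₄

  U⁵-product : ∀ f g → U⁵ (f ⊗ g) ≈⁵ product f g
  U⁵-product f g =
    [ untruncate (λ N → holds₀ N f g) , untruncate (λ N → holds₁ N f g) , untruncate (λ N → holds₂ N f g)
    , untruncate (λ N → holds₃ N f g) , untruncate (λ N → holds₄ N f g) ]

open PartsOfProduct using (U⁵-product)

-- Dissection of monomials and of series in q⁵ and q²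

q^-at-same : ∀ k → (q ^ k) k ≋ + 1
q^-at-same zero    = ≋-reflexive (scalar-zero (+ 1))
q^-at-same (suc k) = ≋-trans (≋-sym (at (shift≈q⊗ (q ^ k)) (suc k))) (q^-at-same k)

q^-at-other : ∀ k n → n ≢ k → (q ^ k) n ≋ + 0
q^-at-other zero    zero    0≢0 = ⊥-elim (0≢0 refl)
q^-at-other zero    (suc n) _   = ≋-reflexive (scalar-suc (+ 1) n)
q^-at-other (suc k) zero    _   = ≋-sym (at (shift≈q⊗ (q ^ k)) 0)
q^-at-other (suc k) (suc n) n≢k =
  ≋-trans (≋-sym (at (shift≈q⊗ (q ^ k)) (suc n))) (q^-at-other k n λ n≡k → n≢k (cong suc n≡k))

scalar0-at : ∀ n → const 0 n ≡ + 0
scalar0-at zero    = scalar-zero (+ 0)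
scalar0-at (suc n) = scalar-suc (+ 0) n

-- Written as a record so that r and X can be inferred.
infix 4 _≡_+_*5
record _≡_+_*5 (N r X : ℕ) : Set where
  constructor exponent
  field division : N ≡ r + X * 5

U-q^-other : ∀ i {N r X} → N ≡ r + X *5 → i % 5 ≢ r % 5 → U i (q ^ N) ≈ const 0
U-q^-other i {r = r} {X} (exponent refl) i≢r = coeffwise λ n → ≋-trans
  (q^-at-other (r + X * 5) (i + n * 5) λ eq → i≢r
    (≡.trans (≡.sym (ℕ.[m+kn]%n≡m%n i n 5)) (≡.trans (cong (_% 5) eq) (ℕ.[m+kn]%n≡m%n r X 5))))
  (≋-reflexive (≡.sym (scalar0-at n)))

U-q^-same : ∀ r {N X} → N ≡ r + X *5 → U r (q ^ N) ≈ q ^ X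
U-q^-same r {X = X} (exponent refl) = coeffwise λ n → go n
  where
  go : ∀ n → (q ^ (r + X * 5)) (r + n * 5) ≋ (q ^ X) n
  go n with n ℕ.≟ X
  ... | yes refl = ≋-trans (q^-at-same (r + n * 5)) (≋-sym (q^-at-same n))
  ... | no n≢X   = ≋-trans (q^-at-other (r + X * 5) (r + n * 5) λ eq → n≢X (ℕ.*-cancelʳ-≡ n X 5 (ℕ.+-cancelˡ-≡ r _ _ eq)))
                           (≋-sym (q^-at-other X n n≢X))

U-cong-[] : ∀ {N f g} i {_ : True (i ℕ.<? 5)} → f ≈[ N * 5 ] g → U i f ≈[ N ] U i g
U-cong-[] {N} i {i<5} p = below λ n n<N → upto p (i + n * 5)
  (ℕ.≤-trans (ℕ.+-monoˡ-< (n * 5) (toWitness i<5)) (ℕ.*-monoˡ-≤ 5 n<N))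

U-q⁵⊗ : ∀ i {_ : True (i ℕ.<? 5)} f → U i (q ^ 5 ⊗ f) ≈ q ⊗ U i f
U-q⁵⊗ i {i<5} f = ≈-trans (U-cong i shifted) (≈-trans (go i (toWitness i<5)) (shift≈q⊗ (U i f)))
  where
  shifted : q ^ 5 ⊗ f ≈ shift (shift (shift (shift (shift f))))
  shifted = ≈-trans (solve 2 (λ x f → x :^ 5 :* f := x :* (x :* (x :* (x :* (x :* f))))) ≈-refl q f)
    (≈-sym (≈-trans (shift≈q⊗ _) (⊗-cong ≈-refl (≈-trans (shift≈q⊗ _) (⊗-cong ≈-refl (≈-trans (shift≈q⊗ _)
      (⊗-cong ≈-refl (≈-trans (shift≈q⊗ _) (⊗-cong ≈-refl (shift≈q⊗ f))))))))))
  go : ∀ i → i < 5 → U i (shift (shift (shift (shift (shift f))))) ≈ shift (U i f)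
  go 0 _ = coeffwise λ { zero → ≋-refl ; (suc n) → ≋-refl }
  go 1 _ = coeffwise λ { zero → ≋-refl ; (suc n) → ≋-refl }
  go 2 _ = coeffwise λ { zero → ≋-refl ; (suc n) → ≋-refl }
  go 3 _ = coeffwise λ { zero → ≋-refl ; (suc n) → ≋-refl }
  go 4 _ = coeffwise λ { zero → ≋-refl ; (suc n) → ≋-refl }
  go (suc (suc (suc (suc (suc _))))) (s≤s (s≤s (s≤s (s≤s (s≤s ())))))

-- Because of this rule denominators are traded below for powers of `e` and `e′`, the images of E1
-- and E2 under `σ`, which leave `U i` as plain factors E1 and E2.
U-σ⊗ : ∀ i {i<5 : True (i ℕ.<? 5)} f g → U i (σ f ⊗ g) ≈ f ⊗ U i g
U-σ⊗ i {i<5} f g = untruncate λ N → go N f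
  where
  open import Relation.Binary.Reasoning.MultiSetoid
  go : ∀ N f → U i (σ f ⊗ g) ≈[ N ] f ⊗ U i g
  go zero    f = below λ n ()
  go (suc N) f = begin⟨ truncated (suc N) ⟩
    U i (σ f ⊗ g)
      ≈⟨ truncate (U-cong i (≈-trans (⊗-cong (spread-head-tail 4 f) ≈-refl)
           (solve 4 (λ c x f g → (c :+ x :^ 5 :* f) :* g := c :* g :+ x :^ 5 :* (f :* g)) ≈-refl (scalar (f 0)) q (σ (tail f)) g))) ⟩
    U i (scalar (f 0) ⊗ g ⊕ q ^ 5 ⊗ (σ (tail f) ⊗ g))
      ≈⟨ truncate (≈-trans (U-⊕ i _ _) (⊕-cong (U-scalar⊗ i (f 0) g) (U-q⁵⊗ i {i<5} _))) ⟩
    scalar (f 0) ⊗ U i g ⊕ q ⊗ U i (σ (tail f) ⊗ g)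
      ≈⟨ ⊕-cong-[] ≈[]-refl (q-cong-[] (go N (tail f))) ⟩
    scalar (f 0) ⊗ U i g ⊕ q ⊗ (tail f ⊗ U i g)
      ≈⟨ truncate (head-tail-⊗ f (U i g)) ⟨
    f ⊗ U i g ∎

U₀-σ : ∀ f → U 0 (σ f) ≈ f
U₀-σ f = coeffwise λ n → ≋-reflexive (go f n)
  where
  go : ∀ f n → σ f (n * 5) ≡ f n
  go f zero    = refl
  go f (suc n) = go (tail f) n

spread-^ : ∀ e f k → spread e 0 (f ^ k) ≈ spread e 0 f ^ k
spread-^ e f zero    = spread-scalar e (+ 1)
spread-^ e f (suc k) = ≈-trans (spread-⊗ e f (f ^ k)) (⊗-cong ≈-refl (spread-^ e f k))

spread-q : ∀ e → spread e 0 q ≈ q ^ suc e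
spread-q e = ≈-trans (spread-cong e 0 (≈-sym (R.*-identityʳ q)))
  (≈-trans (spread-q⊗ e (const 1)) (≈-trans (⊗-cong ≈-refl (spread-scalar e (+ 1))) (R.*-identityʳ _)))

q^^ : ∀ m n → (q ^ m) ^ n ≈ q ^ (m * n)
q^^ m n = ^-assocʳ q m n

spread-q^ : ∀ e k → spread e 0 (q ^ k) ≈ q ^ (suc e * k)
spread-q^ e k = ≈-trans (spread-^ e q k) (≈-trans (^-congˡ k (spread-q e)) (q^^ (suc e) k))

spread-⊖ : ∀ e f → spread e 0 (⊖ f) ≈ ⊖ spread e 0 f
spread-⊖ e f = ≈-trans (spread-cong e 0 (negation f))
  (≈-trans (spread-⊗ e (const 24) f) (≈-trans (⊗-cong (spread-scalar e (+ 24)) ≈-refl) (≈-sym (negation (spread e 0 f)))))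
  where
  negation : ∀ f → ⊖ f ≈ const 24 ⊗ f
  negation = solve 1 (λ f → :- f := con 24 :* f) ≈-refl

spread-spread : ∀ a b c f → suc a * suc b ≡ suc c → spread a 0 (spread b 0 f) ≈ spread c 0 f
spread-spread a b c f eq = untruncate λ N → go N f
  where
  open import Relation.Binary.Reasoning.MultiSetoid
  go : ∀ N f → spread a 0 (spread b 0 f) ≈[ N ] spread c 0 f
  go zero    f = below λ n ()
  go (suc N) f = begin⟨ truncated (suc N) ⟩
    spread a 0 (spread b 0 f)
      ≈⟨ truncate (≈-trans (spread-cong a 0 (spread-head-tail b f)) (≈-trans (spread-⊕ a 0 _ _)
           (⊕-cong (spread-scalar a (f 0)) (≈-trans (spread-⊗ a _ _) (⊗-cong
             (≈-trans (spread-q^ a (suc b)) (≈-reflexive (cong (q ^_) eq))) ≈-refl))))) ⟩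
    scalar (f 0) ⊕ q ^ suc c ⊗ spread a 0 (spread b 0 (tail f))
      ≈⟨ ⊕-cong-[] ≈[]-refl (weaken (s≤s (ℕ.m≤n+m N c)) (q^-cong-[] (suc c) (go N (tail f)))) ⟩
    scalar (f 0) ⊕ q ^ suc c ⊗ spread c 0 (tail f)
      ≈⟨ truncate (spread-head-tail c f) ⟨
    spread c 0 f ∎

δσ : ∀ f → δ (σ f) ≈ σ (δ f)
δσ f = ≈-trans (spread-spread 1 4 9 f refl) (≈-sym (spread-spread 4 1 9 f refl))

-- Doubling the exponents sends the residues 0, 1, 2, 3, 4 to 0, 2, 4, 1, 3; for 3 and 4 the doubled
-- residue exceeds 5, which is the factor q in `U₁-δ` and `U₃-δ`. The other cases reduce to this one
-- by dropping initial coefficients.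
U₀-δ : ∀ f → U 0 (δ f) ≈ δ (U 0 f)
U₀-δ f = coeffwise λ n → ≋-reflexive (go f n)
  where
  go : ∀ f n → δ f (n * 5) ≡ δ (U 0 f) n
  go f zero          = refl
  go f (suc zero)    = refl
  go f (suc (suc n)) = go (λ i → f (5 + i)) n

U₂-δ : ∀ f → U 2 (δ f) ≈ δ (U 1 f)
U₂-δ f = U₀-δ (tail f)

U₄-δ : ∀ f → U 4 (δ f) ≈ δ (U 2 f)
U₄-δ f = U₀-δ (tail (tail f))

U₁-δ : ∀ f → U 1 (δ f) ≈ q ⊗ δ (U 3 f)
U₁-δ f = ≈-trans (coeffwise λ { zero → ≋-refl ; (suc n) → at (U₀-δ (tail (tail (tail f)))) n }) (shift≈q⊗ _)

U₃-δ : ∀ f → U 3 (δ f) ≈ q ⊗ δ (U 4 f)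
U₃-δ f = U₁-δ (tail f)

spread-at : ∀ e c f n → (∃ λ k → n ≡ c + k * suc e × spread e c f n ≡ f k) ⊎ spread e c f n ≡ + 0
spread-at e zero    f zero    = inj₁ (0 , refl , refl)
spread-at e zero    f (suc n) with spread-at e e (tail f) n
... | inj₁ (k , eq , p) = inj₁ (suc k , cong suc eq , p)
... | inj₂ p            = inj₂ p
spread-at e (suc c) f zero    = inj₂ refl
spread-at e (suc c) f (suc n) with spread-at e c f n
... | inj₁ (k , eq , p) = inj₁ (k , cong suc eq , p)
... | inj₂ p            = inj₂ p

-- The exponents that occur are k (1 + e), and 5 divides such a product only if it divides k; so
-- only class 0 of f can contribute.
U₀-spread-coprime : ∀ e f → ¬ (5 ℕ∣.∣ suc e) → U 0 f ≈ const 0 → U 0 (spread e 0 f) ≈ const 0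
U₀-spread-coprime e f 5∤ p = coeffwise go
  where
  go : ∀ n → spread e 0 f (n * 5) ≋ const 0 n
  go n with spread-at e 0 f (n * 5)
  ... | inj₂ eq = ≋-reflexive (≡.trans eq (≡.sym (scalar0-at n)))
  ... | inj₁ (k , eq , val) with euclidsLemma k (suc e) (from-yes (prime? 5)) (ℕ∣.divides n (≡.sym eq))
  ...   | inj₁ (ℕ∣.divides t refl) = ≋-trans (≋-reflexive val) (≋-trans (at p t)
                                    (≋-reflexive (≡.trans (scalar0-at t) (≡.sym (scalar0-at n)))))
  ...   | inj₂ 5∣suc-e          = ⊥-elim (5∤ 5∣suc-e)

-- Infinite products as limits of finite ones

⊛≈⊗ : ∀ f g → f ⊛ g ≈ f ⊗ g
⊛≈⊗ f g = coeffwise λ n → ≋-reflexive (≡.sym (⊗-at f g n))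

one≈ : one ≈ const 1
one≈ = coeffwise λ where
  zero    → ≋-reflexive (≡.sym (scalar-zero (+ 1)))
  (suc n) → ≋-reflexive (≡.sym (scalar-suc (+ 1) n))

1-q^ : ℕ → PS
1-q^ k = const 1 ⊕ ⊖ (q ^ k)

oneMinus≈ : ∀ j → oneMinus (suc j) ≈ 1-q^ (suc j)
oneMinus≈ j = coeffwise λ n → ≋-trans (go n) (≋-reflexive (≡.sym
    (≡.trans (⊕-at (const 1) (⊖ (q ^ suc j)) n) (cong (λ t → const 1 n ℤ.+ t) (⊖-at (q ^ suc j) n)))))
  where
  go : ∀ n → oneMinus (suc j) n ≋ const 1 n ℤ.+ ℤ.- (q ^ suc j) n
  go zero = ≋-sym (+-≋ (≋-reflexive (scalar-zero (+ 1))) (neg-≋ (q^-at-other (suc j) 0 λ ())))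
  go (suc n) with suc n ℕ.≟ suc j
  ... | yes refl = ≋-sym (+-≋ (≋-reflexive (scalar-suc (+ 1) n)) (neg-≋ (q^-at-same (suc j))))
  ... | no n≢j   = ≋-sym (+-≋ (≋-reflexive (scalar-suc (+ 1) n)) (neg-≋ (q^-at-other (suc j) (suc n) n≢j)))

finProd-suc : ∀ e m → finProd (suc e) (suc m) ≈ finProd (suc e) m ⊗ 1-q^ (suc e * suc m)
finProd-suc e m = ≈-trans (⊛≈⊗ _ _) (⊗-cong ≈-refl (oneMinus≈ (m + e * suc m)))

finProd≈spread : ∀ e m → finProd (suc e) m ≈ spread e 0 (finProd 1 m)
finProd≈spread e zero    = ≈-trans one≈ (≈-sym (≈-trans (spread-cong e 0 one≈) (spread-scalar e (+ 1))))
finProd≈spread e (suc m) = begin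
  finProd (suc e) (suc m)                               ≈⟨ finProd-suc e m ⟩
  finProd (suc e) m ⊗ 1-q^ (suc e * suc m)              ≈⟨ ⊗-cong (finProd≈spread e m) (≈-sym factor) ⟩
  spread e 0 (finProd 1 m) ⊗ spread e 0 (1-q^ (suc m))  ≈⟨ spread-⊗ e _ _ ⟨
  spread e 0 (finProd 1 m ⊗ 1-q^ (suc m))               ≡⟨ cong (λ k → spread e 0 (finProd 1 m ⊗ 1-q^ k)) (ℕ.*-identityˡ (suc m)) ⟨
  spread e 0 (finProd 1 m ⊗ 1-q^ (1 * suc m))           ≈⟨ spread-cong e 0 (finProd-suc 0 m) ⟨
  spread e 0 (finProd 1 (suc m))                        ∎
  where
  open import Relation.Binary.Reasoning.Setoid R.setoid
  factor : spread e 0 (1-q^ (suc m)) ≈ 1-q^ (suc e * suc m)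
  factor = ≈-trans (spread-⊕ e 0 _ _) (⊕-cong (spread-scalar e (+ 1)) (≈-trans (spread-⊖ e _) (⊖-cong (spread-q^ e (suc m)))))

⊗-1-q^ : ∀ f k → f ⊗ 1-q^ k ≈[ k ] f
⊗-1-q^ f k = ≈[]-trans (truncate (solve 2 (λ f x → f :* (con 1 :+ :- x) := f :+ :- (x :* f)) ≈-refl f (q ^ k)))
  (≈[]-trans (⊕-cong-[] ≈[]-refl (⊖-cong-[] (q^-small k f)))
  (truncate (solve 1 (λ f → f :+ :- con 0 := f) ≈-refl f)))

qPoch-approx : ∀ e N → qPoch (suc e) ≈[ suc N ] finProd (suc e) N
qPoch-approx e N = lim-approx approximation coherent (suc N)
  where
  approximation : ℕ → PS
  -- `qPoch` reads coefficient n off n factors, but `lim` reads it off the term with index n + 1;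
  -- the predecessor makes the two agree definitionally.
  approximation n = finProd (suc e) (ℕ.pred n)
  coherent : ∀ n → approximation n ≈[ n ] approximation (suc n)
  coherent zero    = below λ n ()
  coherent (suc n) = ≈[]-sym (≈[]-trans (truncate (finProd-suc e n))
    (weaken (ℕ.m≤m+n (suc n) (e * suc n)) (⊗-1-q^ (finProd (suc e) n) (suc e * suc n))))

qPoch≈spread : ∀ e → qPoch (suc e) ≈ spread e 0 (qPoch 1)
qPoch≈spread e = untruncate λ N → weaken (ℕ.n≤1+n N)
  (≈[]-trans (qPoch-approx e N) (≈[]-trans (truncate (finProd≈spread e N))
    (spread-cong-[] e 0 (≈[]-sym (qPoch-approx 0 N)))))

-- The pentagonal series and the squares

sign : ℕ → PS
sign zero    = const 1
sign (suc n) = ⊖ sign n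

Σ< : ℕ → (ℕ → PS) → PS
Σ< zero    t = const 0
Σ< (suc n) t = Σ< n t ⊕ t n

-- Shanks' telescoping proof of Euler's and Gauss's series: y = 0 gives the pentagonal numbers,
-- y = 1 the squares.
module Shanks
  (y : PS) (P W : ℕ → PS)
  (P-suc : ∀ m → P (suc m) ⊗ (const 1 ⊕ y ⊗ q ^ suc m) ≈ P m ⊗ 1-q^ (suc m))
  (W-suc : ∀ s → W (suc s) ⊗ 1-q^ (suc s) ≈ W s ⊗ (y ⊕ q ^ suc s))
  (W-zero : W 0 ≈ const 1)
  where
  open import Relation.Binary.Reasoning.Setoid R.setoid

  term : ℕ → ℕ → PS
  term m s = sign s ⊗ W s ⊗ P m ⊗ 1-q^ (suc m) ⊗ (q ^ suc m) ^ s

  remainder : ℕ → ℕ → PS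
  remainder m k = sign k ⊗ P (suc m) ⊗ W k ⊗ 1-q^ k ⊗ (q ^ suc m) ^ k

  theta : ℕ → PS
  theta j = sign j ⊗ (P j ⊗ W j) ⊗ (q ^ j) ^ j ⊗ 1-q^ (suc (j + j))

  -- `remainder` is a certificate in the style of Wilf and Zeilberger: the difference of `term` in m
  -- is the difference of `remainder` in s. It vanishes at s = 0 through its factor 1 - q⁰, so in
  -- `telescope` only the upper boundary is left.
  term-step : ∀ m s → remainder m s ⊕ term (suc m) s ≈ term m s ⊕ remainder m (suc s)
  term-step m s = begin
    σs ⊗ P⁺ ⊗ Ws ⊗ (const 1 ⊕ ⊖ S) ⊗ X ⊕ σs ⊗ Ws ⊗ P⁺ ⊗ (const 1 ⊕ ⊖ (q ⊗ A)) ⊗ (q ⊗ A) ^ s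
      ≈⟨ ⊕-cong ≈-refl (⊗-cong ≈-refl (^-distrib-* q A s)) ⟩
    σs ⊗ P⁺ ⊗ Ws ⊗ (const 1 ⊕ ⊖ S) ⊗ X ⊕ σs ⊗ Ws ⊗ P⁺ ⊗ (const 1 ⊕ ⊖ (q ⊗ A)) ⊗ (S ⊗ X)
      ≈⟨ solve 8 (λ σs Ws P⁺ S X A q y →
           σs :* P⁺ :* Ws :* (con 1 :+ :- S) :* X :+ σs :* Ws :* P⁺ :* (con 1 :+ :- (q :* A)) :* (S :* X)
           := σs :* Ws :* (P⁺ :* (con 1 :+ y :* A)) :* X :+ :- (σs :* P⁺ :* (Ws :* (y :+ q :* S)) :* (A :* X)))
           ≈-refl σs Ws P⁺ S X A q y ⟩
    σs ⊗ Ws ⊗ (P⁺ ⊗ (const 1 ⊕ y ⊗ A)) ⊗ X ⊕ ⊖ (σs ⊗ P⁺ ⊗ (Ws ⊗ (y ⊕ q ⊗ S)) ⊗ (A ⊗ X))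
      ≈⟨ ⊕-cong (⊗-cong (⊗-cong ≈-refl (P-suc m)) ≈-refl)
           (⊖-cong (⊗-cong (⊗-cong ≈-refl (≈-sym (W-suc s))) ≈-refl)) ⟩
    σs ⊗ Ws ⊗ (P m ⊗ (const 1 ⊕ ⊖ A)) ⊗ X ⊕ ⊖ (σs ⊗ P⁺ ⊗ (W (suc s) ⊗ (const 1 ⊕ ⊖ (q ⊗ S))) ⊗ (A ⊗ X))
      ≈⟨ solve 9 (λ σs Ws Pm A X P⁺ W⁺ S q →
           σs :* Ws :* (Pm :* (con 1 :+ :- A)) :* X :+ :- (σs :* P⁺ :* (W⁺ :* (con 1 :+ :- (q :* S))) :* (A :* X))
           := σs :* Ws :* Pm :* (con 1 :+ :- A) :* X :+ :- σs :* P⁺ :* W⁺ :* (con 1 :+ :- (q :* S)) :* (A :* X))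
           ≈-refl σs Ws (P m) A X P⁺ (W (suc s)) S q ⟩
    term m s ⊕ remainder m (suc s) ∎
    where
    σs = sign s
    Ws = W s
    P⁺ = P (suc m)
    S = q ^ s
    A = q ^ suc m
    X = A ^ s

  telescope : ∀ m k → Σ< k (term (suc m)) ≈ Σ< k (term m) ⊕ remainder m k
  telescope m zero = ≈-sym (solve 3 (λ p w x → con 0 :+ con 1 :* p :* w :* (con 1 :+ :- con 1) :* con 1 := con 0)
    ≈-refl (P (suc m)) (W 0) (q ^ suc m))
  telescope m (suc k) = begin
    Σ< k (term (suc m)) ⊕ term (suc m) k                  ≈⟨ ⊕-cong (telescope m k) ≈-refl ⟩
    Σ< k (term m) ⊕ remainder m k ⊕ term (suc m) k        ≈⟨ R.+-assoc _ _ _ ⟩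
    Σ< k (term m) ⊕ (remainder m k ⊕ term (suc m) k)      ≈⟨ ⊕-cong ≈-refl (term-step m k) ⟩
    Σ< k (term m) ⊕ (term m k ⊕ remainder m (suc k))      ≈⟨ R.+-assoc _ _ _ ⟨
    Σ< (suc k) (term m) ⊕ remainder m (suc k)             ∎

  top-term : ∀ m → remainder m (suc m) ⊕ term (suc m) (suc m) ≈ theta (suc m)
  top-term m = begin
    remainder m (suc m) ⊕ term (suc m) (suc m)
      ≈⟨ ⊕-cong ≈-refl (⊗-cong ≈-refl (^-distrib-* q A (suc m))) ⟩
    remainder m (suc m) ⊕ sign (suc m) ⊗ W (suc m) ⊗ P (suc m) ⊗ (const 1 ⊕ ⊖ (q ⊗ A)) ⊗ (A ⊗ A ^ suc m)
      ≈⟨ solve 6 (λ σs Ws P⁺ q A X →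
           σs :* P⁺ :* Ws :* (con 1 :+ :- A) :* X :+ σs :* Ws :* P⁺ :* (con 1 :+ :- (q :* A)) :* (A :* X)
           := σs :* (P⁺ :* Ws) :* X :* (con 1 :+ :- (q :* (A :* A)))) ≈-refl
           (sign (suc m)) (W (suc m)) (P (suc m)) q A (A ^ suc m) ⟩
    sign (suc m) ⊗ (P (suc m) ⊗ W (suc m)) ⊗ A ^ suc m ⊗ (const 1 ⊕ ⊖ (q ⊗ (A ⊗ A)))
      ≈⟨ ⊗-cong ≈-refl (⊕-cong ≈-refl (⊖-cong (⊗-cong ≈-refl (≈-sym (^-homo-* q (suc m) (suc m)))))) ⟩
    theta (suc m) ∎
    where A = q ^ suc m

  -- Raising m by one adds the boundary value of the telescoping and the new last summand; by
  -- `top-term` these combine to a single `theta`.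
  sum≈theta : ∀ m → Σ< (suc m) (term m) ≈ Σ< (suc m) theta
  sum≈theta zero = solve 3 (λ x p w → con 0 :+ con 1 :* w :* p :* (con 1 :+ :- (x :* con 1)) :* con 1
                              := con 0 :+ con 1 :* (p :* w) :* con 1 :* (con 1 :+ :- (x :* con 1))) ≈-refl q (P 0) (W 0)
  sum≈theta (suc m) = begin
    Σ< (suc m) (term (suc m)) ⊕ term (suc m) (suc m)                       ≈⟨ ⊕-cong (telescope m (suc m)) ≈-refl ⟩
    Σ< (suc m) (term m) ⊕ remainder m (suc m) ⊕ term (suc m) (suc m)       ≈⟨ R.+-assoc _ _ _ ⟩
    Σ< (suc m) (term m) ⊕ (remainder m (suc m) ⊕ term (suc m) (suc m))     ≈⟨ ⊕-cong (sum≈theta m) (top-term m) ⟩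
    Σ< (suc (suc m)) theta                                                 ∎

  -- `term m s` carries q to the power (m + 1) s, so below q^(m+1) only s = 0 remains, which is P m
  -- up to a factor 1 - q^(m+1).
  sum-approx : ∀ m k → Σ< (suc k) (term m) ≈[ suc m ] P m
  sum-approx m zero = ≈[]-trans (truncate (≈-trans
      (⊕-cong ≈-refl (⊗-cong (⊗-cong (⊗-cong (⊗-cong ≈-refl W-zero) ≈-refl) ≈-refl) ≈-refl))
      (solve 2 (λ p x → con 0 :+ con 1 :* con 1 :* p :* x :* con 1 := p :* x) ≈-refl (P m) (1-q^ (suc m)))))
    (⊗-1-q^ (P m) (suc m))
  sum-approx m (suc k) = ≈[]-trans (⊕-cong-[] (sum-approx m k) small) (truncate (R.+-identityʳ (P m)))
    where
    small : term m (suc k) ≈[ suc m ] const 0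
    small = ≈[]-trans (truncate (solve 3 (λ a x y → a :* (x :* y) := x :* (a :* y)) ≈-refl _ (q ^ suc m) _)) (q^-small (suc m) _)

  approx : ∀ m → P m ≈[ suc m ] Σ< (suc m) theta
  approx m = ≈[]-trans (≈[]-sym (sum-approx m m)) (truncate (sum≈theta m))

E1 E2 : PS
E1 = qPoch 1
E2 = qPoch 2

E2≈δE1 : E2 ≈ δ E1
E2≈δE1 = qPoch≈spread 1

E1-0 : E1 0 ≋ + 1
E1-0 = ≋-refl

E2-0 : E2 0 ≋ + 1
E2-0 = ≋-refl

E2⁻¹ : PS
E2⁻¹ = reciprocal E2

finProd-0 : ∀ e m → finProd (suc e) m 0 ≋ + 1
finProd-0 e zero    = ≋-refl
finProd-0 e (suc m) = *-≋ (finProd-0 e m) (≋-refl {+ 1})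

Q-suc : ∀ m → finProd 1 (suc m) ≈ finProd 1 m ⊗ 1-q^ (suc m)
Q-suc m = ≈-trans (finProd-suc 0 m) (≈-reflexive (cong (λ k → finProd 1 m ⊗ 1-q^ k) (ℕ.*-identityˡ (suc m))))

module _ where
  open import Relation.Binary.Reasoning.Setoid R.setoid
  reciprocal-ratio : ∀ {u v x y} → u 0 ≋ + 1 → v 0 ≋ + 1 → u ⊗ x ≈ v ⊗ y →
                     reciprocal v ⊗ x ≈ reciprocal u ⊗ y
  reciprocal-ratio {u} {v} {x} {y} u0 v0 p = begin
    v⁻¹ ⊗ x                     ≈⟨ R.*-identityˡ _ ⟨
    const 1 ⊗ (v⁻¹ ⊗ x)         ≈⟨ ⊗-cong (reciprocal-inverse u u0) ≈-refl ⟨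
    u ⊗ u⁻¹ ⊗ (v⁻¹ ⊗ x)         ≈⟨ solve 4 (λ u u′ v′ x → u :* u′ :* (v′ :* x) := u′ :* v′ :* (u :* x)) ≈-refl u u⁻¹ v⁻¹ x ⟩
    u⁻¹ ⊗ v⁻¹ ⊗ (u ⊗ x)         ≈⟨ ⊗-cong ≈-refl p ⟩
    u⁻¹ ⊗ v⁻¹ ⊗ (v ⊗ y)         ≈⟨ solve 4 (λ u′ v′ v y → u′ :* v′ :* (v :* y) := u′ :* (v :* v′) :* y) ≈-refl u⁻¹ v⁻¹ v y ⟩
    u⁻¹ ⊗ (v ⊗ v⁻¹) ⊗ y         ≈⟨ ⊗-cong (⊗-cong ≈-refl (reciprocal-inverse v v0)) ≈-refl ⟩
    u⁻¹ ⊗ const 1 ⊗ y           ≈⟨ ⊗-cong (R.*-identityʳ u⁻¹) ≈-refl ⟩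
    u⁻¹ ⊗ y                     ∎
    where
    u⁻¹ = reciprocal u
    v⁻¹ = reciprocal v

triangle : ℕ → ℕ
triangle zero    = 0
triangle (suc n) = suc n + triangle n

module Pentagonal where
  Q : ℕ → PS
  Q = finProd 1
  -- The solution with W 0 = 1 of the recurrence `W-suc` at y = 0. Its product with `Q j` is
  -- q^(j(j+1)/2), which together with the q^(j²) of `theta` gives the pentagonal exponents
  -- j(3j+1)/2; the factor 1 - q^(2j+1) supplies those of the index -(j+1).
  W : ℕ → PS
  W s = q ^ triangle s ⊗ reciprocal (Q s)

  W-suc : ∀ s → W (suc s) ⊗ 1-q^ (suc s) ≈ W s ⊗ (const 0 ⊕ q ^ suc s)
  W-suc s = begin
    q ^ (suc s + triangle s) ⊗ reciprocal (Q (suc s)) ⊗ 1-q^ (suc s)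
      ≈⟨ R.*-assoc _ _ _ ⟩
    q ^ (suc s + triangle s) ⊗ (reciprocal (Q (suc s)) ⊗ 1-q^ (suc s))
      ≈⟨ ⊗-cong (^-homo-* q (suc s) (triangle s)) (reciprocal-ratio (finProd-0 0 s) (finProd-0 0 (suc s))
           (≈-trans (≈-sym (Q-suc s)) (≈-sym (R.*-identityʳ _)))) ⟩
    q ^ suc s ⊗ q ^ triangle s ⊗ (reciprocal (Q s) ⊗ const 1)
      ≈⟨ solve 3 (λ x t r → x :* t :* (r :* con 1) := t :* r :* (con 0 :+ x)) ≈-refl (q ^ suc s) (q ^ triangle s) (reciprocal (Q s)) ⟩
    W s ⊗ (const 0 ⊕ q ^ suc s) ∎
    where open import Relation.Binary.Reasoning.Setoid R.setoid

  W-zero : W 0 ≈ const 1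
  W-zero = ≈-trans (⊗-cong (≈-sym one≈) ≈-refl) (reciprocal-inverse one ≋-refl)

  open Shanks (const 0) Q W
    (λ m → ≈-trans (solve 2 (λ p x → p :* (con 1 :+ con 0 :* x) := p) ≈-refl _ (q ^ suc m)) (Q-suc m))
    W-suc W-zero public

  V : ∀ j → Q j ⊗ W j ≈ q ^ triangle j
  V j = ≈-trans (solve 3 (λ a b c → a :* (b :* c) := b :* (a :* c)) ≈-refl (Q j) (q ^ triangle j) (reciprocal (Q j)))
    (≈-trans (⊗-cong ≈-refl (reciprocal-inverse (Q j) (finProd-0 0 j))) (R.*-identityʳ _))

module Squares where
  -- ∏ (1 - q^k)/(1 + q^k)
  P : ℕ → PS
  P m = finProd 1 m ⊗ finProd 1 m ⊗ reciprocal (finProd 2 m)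

  P-0 : ∀ m → P m 0 ≋ + 1
  P-0 m = ≋-trans (≋-reflexive (≡.trans (⊗-at _ _ 0) (cong (ℤ._* reciprocal (finProd 2 m) 0) (⊗-at _ _ 0))))
    (*-≋ (*-≋ (finProd-0 0 m) (finProd-0 0 m)) (reciprocal-0 (finProd 2 m)))
    where
    reciprocal-0 : ∀ f → reciprocal f 0 ≋ + 1
    reciprocal-0 f = ≋-trans (upto (reciprocal-approx f 1) 0 (s≤s z≤n))
      (≋-reflexive (≡.trans (⊕-at _ _ 0) (cong₂ ℤ._+_ (scalar-zero (+ 1)) (≡.trans (⊖-at _ 0) (cong ℤ.-_ (⊗-at q _ 0))))))

  P-suc : ∀ m → P (suc m) ⊗ (const 1 ⊕ const 1 ⊗ q ^ suc m) ≈ P m ⊗ 1-q^ (suc m)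
  P-suc m = begin
    Q⁺ ⊗ Q⁺ ⊗ R⁺ ⊗ (const 1 ⊕ const 1 ⊗ x)
      ≈⟨ ⊗-cong (⊗-cong (⊗-cong (Q-suc m) (Q-suc m)) ≈-refl) ≈-refl ⟩
    Qm ⊗ (const 1 ⊕ ⊖ x) ⊗ (Qm ⊗ (const 1 ⊕ ⊖ x)) ⊗ R⁺ ⊗ (const 1 ⊕ const 1 ⊗ x)
      ≈⟨ solve 3 (λ p r x → p :* (con 1 :+ :- x) :* (p :* (con 1 :+ :- x)) :* r :* (con 1 :+ con 1 :* x)
           := p :* p :* (r :* (con 1 :+ :- (x :* x))) :* (con 1 :+ :- x)) ≈-refl Qm R⁺ x ⟩
    Qm ⊗ Qm ⊗ (R⁺ ⊗ (const 1 ⊕ ⊖ (x ⊗ x))) ⊗ (const 1 ⊕ ⊖ x)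
      ≈⟨ ⊗-cong (⊗-cong ≈-refl (reciprocal-ratio (finProd-0 1 m) (finProd-0 1 (suc m)) ratio)) ≈-refl ⟩
    Qm ⊗ Qm ⊗ (reciprocal (finProd 2 m) ⊗ const 1) ⊗ (const 1 ⊕ ⊖ x)
      ≈⟨ ⊗-cong (⊗-cong ≈-refl (R.*-identityʳ _)) ≈-refl ⟩
    P m ⊗ 1-q^ (suc m) ∎
    where
    open import Relation.Binary.Reasoning.Setoid R.setoid
    Q⁺ = finProd 1 (suc m)
    Qm = finProd 1 m
    R⁺ = reciprocal (finProd 2 (suc m))
    x = q ^ suc m
    ratio : finProd 2 m ⊗ (const 1 ⊕ ⊖ (x ⊗ x)) ≈ finProd 2 (suc m) ⊗ const 1
    ratio = ≈-trans (⊗-cong ≈-refl (⊕-cong ≈-refl (⊖-cong (≈-trans (≈-sym (^-homo-* q (suc m) (suc m)))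
        (≈-reflexive (cong (λ k → q ^ (suc m + k)) (≡.sym (ℕ.+-identityʳ (suc m)))))))))
      (≈-trans (≈-sym (finProd-suc 1 m)) (≈-sym (R.*-identityʳ _)))

  W-suc : ∀ s → reciprocal (P (suc s)) ⊗ 1-q^ (suc s) ≈ reciprocal (P s) ⊗ (const 1 ⊕ q ^ suc s)
  W-suc s = reciprocal-ratio (P-0 s) (P-0 (suc s))
    (≈-trans (≈-sym (P-suc s)) (⊗-cong ≈-refl (⊕-cong ≈-refl (R.*-identityˡ _))))

  W-zero : reciprocal (P 0) ≈ const 1
  W-zero = ≈-trans (≈-sym (R.*-identityˡ _)) (≈-trans (⊗-cong (≈-sym P₀) ≈-refl) (reciprocal-inverse (P 0) (P-0 0)))
    where
    P₀ : P 0 ≈ const 1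
    P₀ = ≈-trans (solve 2 (λ a r → a :* a :* r := a :* (a :* r)) ≈-refl one (reciprocal one))
      (≈-trans (⊗-cong one≈ (reciprocal-inverse one ≋-refl)) (R.*-identityˡ _))

  open Shanks (const 1) P (λ s → reciprocal (P s)) P-suc W-suc W-zero public

  V : ∀ j → P j ⊗ reciprocal (P j) ≈ const 1
  V j = reciprocal-inverse (P j) (P-0 j)

U-sign⊗ : ∀ i j f → U i (sign j ⊗ f) ≈ sign j ⊗ U i f
U-sign⊗ i zero    f = ≈-trans (U-cong i (R.*-identityˡ f)) (≈-sym (R.*-identityˡ _))
U-sign⊗ i (suc j) f = ≈-trans (U-cong i (pull (sign j) f)) (≈-trans (U-⊖ i _)
  (≈-trans (⊖-cong (U-sign⊗ i j f)) (≈-sym (pull (sign j) (U i f)))))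
  where
  pull : ∀ s f → ⊖ s ⊗ f ≈ ⊖ (s ⊗ f)
  pull = solve 2 (λ s f → :- s :* f := :- (s :* f)) ≈-refl

sign-n*5 : ∀ n → sign (n * 5) ≈ sign n
sign-n*5 zero    = ≈-refl
sign-n*5 (suc n) = ≈-trans (solve 1 (λ s → :- :- :- :- :- s := :- s) ≈-refl (sign (n * 5))) (⊖-cong (sign-n*5 n))

σ-sign : ∀ n → σ (sign n) ≈ sign n
σ-sign zero    = spread-scalar 4 (+ 1)
σ-sign (suc n) = ≈-trans (spread-⊖ 4 (sign n)) (⊖-cong (σ-sign n))

σ-Σ< : ∀ N t → σ (Σ< N t) ≈ Σ< N (λ n → σ (t n))
σ-Σ< zero    t = spread-scalar 4 (+ 0)
σ-Σ< (suc N) t = ≈-trans (spread-⊕ 4 0 _ _) (⊕-cong (σ-Σ< N t) ≈-refl)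

module _ where
  open import Relation.Binary.Reasoning.Setoid R.setoid

  -- The theta series are summed in blocks of five terms: the residue modulo 5 of each exponent
  -- depends only on its place in the block, and the sign of a whole block is that of n because 5 is
  -- odd.
  U-block : ∀ i θ n {w₀ w₁ w₂ w₃ w₄ w} →
    U i (θ (n * 5)) ≈ sign (n * 5) ⊗ w₀ → U i (θ (1 + n * 5)) ≈ sign (1 + n * 5) ⊗ w₁ →
    U i (θ (2 + n * 5)) ≈ sign (2 + n * 5) ⊗ w₂ → U i (θ (3 + n * 5)) ≈ sign (3 + n * 5) ⊗ w₃ →
    U i (θ (4 + n * 5)) ≈ sign (4 + n * 5) ⊗ w₄ →
    w₀ ⊕ ⊖ w₁ ⊕ w₂ ⊕ ⊖ w₃ ⊕ w₄ ≈ w →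
    U i (Σ< (suc n * 5) θ) ≈ U i (Σ< (n * 5) θ) ⊕ sign n ⊗ w
  U-block i θ n {w₀} {w₁} {w₂} {w₃} {w₄} {w} p₀ p₁ p₂ p₃ p₄ p = begin
    U i (X ⊕ θ (n * 5) ⊕ θ (1 + n * 5) ⊕ θ (2 + n * 5) ⊕ θ (3 + n * 5) ⊕ θ (4 + n * 5))
      ≈⟨ ≈-trans (U-⊕ i _ _) (⊕-cong (≈-trans (U-⊕ i _ _) (⊕-cong (≈-trans (U-⊕ i _ _) (⊕-cong
           (≈-trans (U-⊕ i _ _) (⊕-cong (≈-trans (U-⊕ i _ _) (⊕-cong ≈-refl p₀)) p₁)) p₂)) p₃)) p₄) ⟩
    U i X ⊕ s ⊗ w₀ ⊕ ⊖ s ⊗ w₁ ⊕ ⊖ ⊖ s ⊗ w₂ ⊕ ⊖ ⊖ ⊖ s ⊗ w₃ ⊕ ⊖ ⊖ ⊖ ⊖ s ⊗ w₄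
      ≈⟨ solve 7 (λ x s a b c d e → x :+ s :* a :+ :- s :* b :+ :- :- s :* c :+ :- :- :- s :* d :+ :- :- :- :- s :* e
           := x :+ s :* (a :+ :- b :+ c :+ :- d :+ e)) ≈-refl (U i X) s w₀ w₁ w₂ w₃ w₄ ⟩
    U i X ⊕ s ⊗ (w₀ ⊕ ⊖ w₁ ⊕ w₂ ⊕ ⊖ w₃ ⊕ w₄)
      ≈⟨ ⊕-cong ≈-refl (⊗-cong (sign-n*5 n) p) ⟩
    U i X ⊕ sign n ⊗ w ∎
    where
    X = Σ< (n * 5) θ
    s = sign (n * 5)

  U-sum : ∀ i θ w → (∀ n → U i (Σ< (suc n * 5) θ) ≈ U i (Σ< (n * 5) θ) ⊕ w n) →
          ∀ N → U i (Σ< (N * 5) θ) ≈ Σ< N w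
  U-sum i θ w p zero    = coeffwise λ n → ≋-reflexive (≡.trans (scalar0-at (i + n * 5)) (≡.sym (scalar0-at n)))
  U-sum i θ w p (suc N) = ≈-trans (p N) (⊕-cong (U-sum i θ w p N) ≈-refl)

  Σ<-zero : ∀ N w → (∀ n → w n ≈ const 0) → Σ< N w ≈ const 0
  Σ<-zero zero    w p = ≈-refl
  Σ<-zero (suc N) w p = ≈-trans (⊕-cong (Σ<-zero N w p) (p N)) (R.+-identityˡ _)

  Σ<-cong : ∀ N {v w} → (∀ n → v n ≈ w n) → Σ< N v ≈ Σ< N w
  Σ<-cong zero    p = ≈-refl
  Σ<-cong (suc N) p = ⊕-cong (Σ<-cong N p) (p N)

U-pair : ∀ i j a b {θ u v} → θ ≈ sign j ⊗ (q ^ a ⊕ ⊖ (q ^ b)) → U i (q ^ a) ≈ u → U i (q ^ b) ≈ v →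
         U i θ ≈ sign j ⊗ (u ⊕ ⊖ v)
U-pair i j a b p r s = ≈-trans (U-cong i p) (≈-trans (U-sign⊗ i j _)
  (⊗-cong ≈-refl (≈-trans (U-⊕ i _ _) (⊕-cong r (≈-trans (U-⊖ i _) (⊖-cong s))))))

module PentagonalDissection where
  open Pentagonal using (theta; V; approx)

  pent : ℕ → ℕ
  pent j = triangle j + j * j

  theta≈ : ∀ j → theta j ≈ sign j ⊗ (q ^ pent j ⊕ ⊖ (q ^ (pent j + suc (j + j))))
  theta≈ j = begin
    sign j ⊗ (finProd 1 j ⊗ Pentagonal.W j) ⊗ (q ^ j) ^ j ⊗ (const 1 ⊕ ⊖ (q ^ suc (j + j)))
      ≈⟨ ⊗-cong (⊗-cong (⊗-cong ≈-refl (V j)) (q^^ j j)) ≈-refl ⟩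
    sign j ⊗ q ^ triangle j ⊗ q ^ (j * j) ⊗ (const 1 ⊕ ⊖ (q ^ suc (j + j)))
      ≈⟨ solve 4 (λ s x y z → s :* x :* y :* (con 1 :+ :- z) := s :* (x :* y :+ :- (x :* y :* z))) ≈-refl
           (sign j) (q ^ triangle j) (q ^ (j * j)) (q ^ suc (j + j)) ⟩
    sign j ⊗ (q ^ triangle j ⊗ q ^ (j * j) ⊕ ⊖ (q ^ triangle j ⊗ q ^ (j * j) ⊗ q ^ suc (j + j)))
      ≈⟨ ⊗-cong ≈-refl (⊕-cong (≈-sym (^-homo-* q (triangle j) (j * j)))
           (⊖-cong (≈-trans (⊗-cong (≈-sym (^-homo-* q (triangle j) (j * j))) ≈-refl) (≈-sym (^-homo-* q (pent j) (suc (j + j))))))) ⟩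
    sign j ⊗ (q ^ pent j ⊕ ⊖ (q ^ (pent j + suc (j + j)))) ∎
    where open import Relation.Binary.Reasoning.Setoid R.setoid

  triangle-double : ∀ n → triangle n + triangle n ≡ n * n + n
  triangle-double zero    = refl
  triangle-double (suc n) = ≡.trans (regroup n (triangle n)) (≡.trans (cong (λ t → suc n + suc n + t) (triangle-double n)) (close n))
    where
    regroup : ∀ n t → suc n + t + (suc n + t) ≡ suc n + suc n + (t + t)
    regroup = ℕ-solver.solve-∀
    close : ∀ n → suc n + suc n + (n * n + n) ≡ suc n * suc n + suc n
    close = ℕ-solver.solve-∀

  triangle-n*5 : ∀ n → triangle (n * 5) ≡ (triangle n + 2 * (n * n)) * 5
  triangle-n*5 zero    = refl
  triangle-n*5 (suc n) = ≡.trans (cong (λ T → 5 + n * 5 + (4 + n * 5 + (3 + n * 5 + (2 + n * 5 + (1 + n * 5 + T))))) (triangle-n*5 n))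
    (close n (triangle n))
    where
    close : ∀ n t → 5 + n * 5 + (4 + n * 5 + (3 + n * 5 + (2 + n * 5 + (1 + n * 5 + (t + 2 * (n * n)) * 5))))
          ≡ (suc n + t + 2 * (suc n * suc n)) * 5
    close = ℕ-solver.solve-∀

  -- This is n(15n+1)/2, a fifth of `pent (n * 5)`; the other quotients are measured from it.
  base : ℕ → ℕ
  base n = triangle n + 7 * (n * n)

  open _≡_+_*5

  a₀ : ∀ n → pent (n * 5) ≡ 0 + base n *5
  a₀ n = exponent (≡.trans (cong (λ T → T + n * 5 * (n * 5)) (triangle-n*5 n)) (go n (triangle n)))
    where
    go : ∀ n t → (t + 2 * (n * n)) * 5 + n * 5 * (n * 5) ≡ 0 + (t + 7 * (n * n)) * 5
    go = ℕ-solver.solve-∀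

  a₁ : ∀ n → pent (1 + n * 5) ≡ 2 + (base n + 3 * n) *5
  a₁ n = exponent (≡.trans (cong (λ T → 1 + n * 5 + T + (1 + n * 5) * (1 + n * 5)) (triangle-n*5 n)) (go n (triangle n)))
    where
    go : ∀ n t → 1 + n * 5 + (t + 2 * (n * n)) * 5 + (1 + n * 5) * (1 + n * 5) ≡ 2 + (t + 7 * (n * n) + 3 * n) * 5
    go = ℕ-solver.solve-∀

  a₂ : ∀ n → pent (2 + n * 5) ≡ 2 + (base n + 6 * n + 1) *5
  a₂ n = exponent (≡.trans (cong (λ T → 2 + n * 5 + (1 + n * 5 + T) + (2 + n * 5) * (2 + n * 5)) (triangle-n*5 n)) (go n (triangle n)))
    where
    go : ∀ n t → 2 + n * 5 + (1 + n * 5 + (t + 2 * (n * n)) * 5) + (2 + n * 5) * (2 + n * 5)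
       ≡ 2 + (t + 7 * (n * n) + 6 * n + 1) * 5
    go = ℕ-solver.solve-∀

  a₃ : ∀ n → pent (3 + n * 5) ≡ 0 + (base n + 9 * n + 3) *5
  a₃ n = exponent (≡.trans (cong (λ T → 3 + n * 5 + (2 + n * 5 + (1 + n * 5 + T)) + (3 + n * 5) * (3 + n * 5)) (triangle-n*5 n)) (go n (triangle n)))
    where
    go : ∀ n t → 3 + n * 5 + (2 + n * 5 + (1 + n * 5 + (t + 2 * (n * n)) * 5)) + (3 + n * 5) * (3 + n * 5)
       ≡ 0 + (t + 7 * (n * n) + 9 * n + 3) * 5
    go = ℕ-solver.solve-∀

  a₄ : ∀ n → pent (4 + n * 5) ≡ 1 + (base n + 12 * n + 5) *5
  a₄ n = exponent (≡.trans (cong (λ T → 4 + n * 5 + (3 + n * 5 + (2 + n * 5 + (1 + n * 5 + T))) + (4 + n * 5) * (4 + n * 5)) (triangle-n*5 n)) (go n (triangle n)))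
    where
    go : ∀ n t → 4 + n * 5 + (3 + n * 5 + (2 + n * 5 + (1 + n * 5 + (t + 2 * (n * n)) * 5))) + (4 + n * 5) * (4 + n * 5)
       ≡ 1 + (t + 7 * (n * n) + 12 * n + 5) * 5
    go = ℕ-solver.solve-∀

  b₀ : ∀ n → pent (n * 5) + suc (n * 5 + n * 5) ≡ 1 + (base n + 2 * n) *5
  b₀ n = exponent (≡.trans (cong (_+ suc (n * 5 + n * 5)) (division (a₀ n))) (go n (base n)))
    where
    go : ∀ n b → 0 + b * 5 + (1 + (n * 5 + n * 5)) ≡ 1 + (b + 2 * n) * 5
    go = ℕ-solver.solve-∀

  b₁ : ∀ n → pent (1 + n * 5) + suc (1 + n * 5 + (1 + n * 5)) ≡ 0 + (base n + 5 * n + 1) *5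
  b₁ n = exponent (≡.trans (cong (_+ suc (1 + n * 5 + (1 + n * 5))) (division (a₁ n))) (go n (base n)))
    where
    go : ∀ n b → 2 + (b + 3 * n) * 5 + (1 + (1 + n * 5 + (1 + n * 5))) ≡ 0 + (b + 5 * n + 1) * 5
    go = ℕ-solver.solve-∀

  b₂ : ∀ n → pent (2 + n * 5) + suc (2 + n * 5 + (2 + n * 5)) ≡ 2 + (base n + 8 * n + 2) *5
  b₂ n = exponent (≡.trans (cong (_+ suc (2 + n * 5 + (2 + n * 5))) (division (a₂ n))) (go n (base n)))
    where
    go : ∀ n b → 2 + (b + 6 * n + 1) * 5 + (1 + (2 + n * 5 + (2 + n * 5))) ≡ 2 + (b + 8 * n + 2) * 5
    go = ℕ-solver.solve-∀

  b₃ : ∀ n → pent (3 + n * 5) + suc (3 + n * 5 + (3 + n * 5)) ≡ 2 + (base n + 11 * n + 4) *5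
  b₃ n = exponent (≡.trans (cong (_+ suc (3 + n * 5 + (3 + n * 5))) (division (a₃ n))) (go n (base n)))
    where
    go : ∀ n b → 0 + (b + 9 * n + 3) * 5 + (1 + (3 + n * 5 + (3 + n * 5))) ≡ 2 + (b + 11 * n + 4) * 5
    go = ℕ-solver.solve-∀

  b₄ : ∀ n → pent (4 + n * 5) + suc (4 + n * 5 + (4 + n * 5)) ≡ 0 + (base n + 14 * n + 7) *5
  b₄ n = exponent (≡.trans (cong (_+ suc (4 + n * 5 + (4 + n * 5))) (division (a₄ n))) (go n (base n)))
    where
    go : ∀ n b → 1 + (b + 12 * n + 5) * 5 + (1 + (4 + n * 5 + (4 + n * 5))) ≡ 0 + (b + 14 * n + 7) * 5
    go = ℕ-solver.solve-∀

  vanish : ∀ i → i % 5 ≢ 0 → i % 5 ≢ 1 → i % 5 ≢ 2 → ∀ N → U i (Σ< (N * 5) theta) ≈ const 0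
  vanish i ≢0 ≢1 ≢2 N = ≈-trans
    (U-sum i theta (λ n → sign n ⊗ const 0) (λ n → U-block i theta n
      (pair 0 n (U-q^-other i (a₀ n) ≢0) (U-q^-other i (b₀ n) ≢1))
      (pair 1 n (U-q^-other i (a₁ n) ≢2) (U-q^-other i (b₁ n) ≢0))
      (pair 2 n (U-q^-other i (a₂ n) ≢2) (U-q^-other i (b₂ n) ≢2))
      (pair 3 n (U-q^-other i (a₃ n) ≢0) (U-q^-other i (b₃ n) ≢2))
      (pair 4 n (U-q^-other i (a₄ n) ≢1) (U-q^-other i (b₄ n) ≢0))
      (solve 0 (z :+ :- z :+ z :+ :- z :+ z := con 0) ≈-refl)) N)
    (Σ<-zero N _ λ n → R.zeroʳ (sign n))
    where
    z = con 0 :+ :- con 0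
    pair : ∀ k n {u v} → U i (q ^ pent (k + n * 5)) ≈ u →
           U i (q ^ (pent (k + n * 5) + suc (k + n * 5 + (k + n * 5)))) ≈ v → U i (theta (k + n * 5)) ≈ sign (k + n * 5) ⊗ (u ⊕ ⊖ v)
    pair k n = U-pair i (k + n * 5) (pent (k + n * 5)) (pent (k + n * 5) + suc (k + n * 5 + (k + n * 5))) (theta≈ (k + n * 5))

  σ-theta : ∀ n → σ (theta n) ≈ sign n ⊗ (q ^ (base n + 2 * n) ⊕ ⊖ (q ^ (base n + 12 * n + 5)))
  σ-theta n = ≈-trans (spread-cong 4 0 (theta≈ n)) (≈-trans (spread-⊗ 4 _ _) (⊗-cong (σ-sign n)
    (≈-trans (spread-⊕ 4 0 _ _) (⊕-cong
      (≈-trans (spread-q^ 4 (pent n)) (≈-reflexive (cong (q ^_) lower)))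
      (≈-trans (spread-⊖ 4 _) (⊖-cong (≈-trans (spread-q^ 4 (pent n + suc (n + n))) (≈-reflexive (cong (q ^_) upper)))))))))
    where
    t = triangle n
    split : ∀ n t → 5 * (t + n * n) ≡ t + 5 * (n * n) + 2 * (t + t)
    split = ℕ-solver.solve-∀
    join : ∀ n t → t + 5 * (n * n) + 2 * (n * n + n) ≡ t + 7 * (n * n) + 2 * n
    join = ℕ-solver.solve-∀
    lower : 5 * pent n ≡ base n + 2 * n
    lower = ≡.trans (split n t) (≡.trans (cong (λ d → t + 5 * (n * n) + 2 * d) (triangle-double n)) (join n t))
    distribute : ∀ n p → 5 * (p + suc (n + n)) ≡ 5 * p + (10 * n + 5)
    distribute = ℕ-solver.solve-∀
    collect : ∀ n b → b + 2 * n + (10 * n + 5) ≡ b + 12 * n + 5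
    collect = ℕ-solver.solve-∀
    upper : 5 * (pent n + suc (n + n)) ≡ base n + 12 * n + 5
    upper = ≡.trans (distribute n (pent n)) (≡.trans (cong (_+ (10 * n + 5)) lower) (collect n (base n)))

  -- Pentagonal numbers P make 24P + 1 a square. For P = 5m + 1 this square is 5(24m + 5), so 25
  -- divides it, 5 divides m, and m/5 gives a square again. Concretely the quotients in `b₀` and
  -- `a₄` are five times the two exponents of `theta n`, as `σ-theta` records.
  U₁-sum : ∀ N → U 1 (Σ< (N * 5) theta) ≈ ⊖ σ (Σ< N theta)
  U₁-sum N = ≈-trans
    (U-sum 1 theta (λ n → sign n ⊗ w n) (λ n → U-block 1 theta n
      (pair 0 n (U-q^-other 1 (a₀ n) λ ()) (U-q^-same 1 (b₀ n)))
      (pair 1 n (U-q^-other 1 (a₁ n) λ ()) (U-q^-other 1 (b₁ n) λ ()))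
      (pair 2 n (U-q^-other 1 (a₂ n) λ ()) (U-q^-other 1 (b₂ n) λ ()))
      (pair 3 n (U-q^-other 1 (a₃ n) λ ()) (U-q^-other 1 (b₃ n) λ ()))
      (pair 4 n (U-q^-same 1 (a₄ n)) (U-q^-other 1 (b₄ n) λ ()))
      (solve 2 (λ x y → con 0 :+ :- x :+ :- z :+ z :+ :- z :+ (y :+ :- con 0) := :- (x :+ :- y)) ≈-refl
        (q ^ (base n + 2 * n)) (q ^ (base n + 12 * n + 5)))) N)
    (≈-trans (Σ<-cong N (λ n → ≈-trans (solve 2 (λ s x → s :* :- x := :- (s :* x)) ≈-refl (sign n) (v n)) (⊖-cong (≈-sym (σ-theta n)))))
    (≈-trans (Σ<-⊖ N) (⊖-cong (≈-sym (σ-Σ< N theta)))))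
    where
    z : ∀ {n} → Polynomial n
    z = con 0 :+ :- con 0
    v w : ℕ → PS
    v n = q ^ (base n + 2 * n) ⊕ ⊖ (q ^ (base n + 12 * n + 5))
    w n = ⊖ v n
    Σ<-⊖ : ∀ N {t} → Σ< N (λ n → ⊖ t n) ≈ ⊖ Σ< N t
    Σ<-⊖ zero    = solve 0 (con 0 := :- con 0) ≈-refl
    Σ<-⊖ (suc N) = ≈-trans (⊕-cong (Σ<-⊖ N) ≈-refl) (solve 2 (λ x y → :- x :+ :- y := :- (x :+ y)) ≈-refl _ _)
    pair : ∀ k n {u v} → U 1 (q ^ pent (k + n * 5)) ≈ u →
           U 1 (q ^ (pent (k + n * 5) + suc (k + n * 5 + (k + n * 5)))) ≈ v → U 1 (theta (k + n * 5)) ≈ sign (k + n * 5) ⊗ (u ⊕ ⊖ v)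
    pair k n = U-pair 1 (k + n * 5) (pent (k + n * 5)) (pent (k + n * 5) + suc (k + n * 5 + (k + n * 5))) (theta≈ (k + n * 5))

  E1≈theta : ∀ N → E1 ≈[ N ] Σ< N theta
  E1≈theta zero    = below λ n ()
  E1≈theta (suc m) = ≈[]-trans (qPoch-approx 0 m) (approx m)

U₃-E1 : U 3 E1 ≈ const 0
U₃-E1 = untruncate λ N → ≈[]-trans (U-cong-[] 3 (PentagonalDissection.E1≈theta (N * 5)))
  (truncate (PentagonalDissection.vanish 3 (λ ()) (λ ()) (λ ()) N))

U₄-E1 : U 4 E1 ≈ const 0
U₄-E1 = untruncate λ N → ≈[]-trans (U-cong-[] 4 (PentagonalDissection.E1≈theta (N * 5)))
  (truncate (PentagonalDissection.vanish 4 (λ ()) (λ ()) (λ ()) N))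

U₁-E1 : U 1 E1 ≈ ⊖ σ E1
U₁-E1 = untruncate λ N → ≈[]-trans (U-cong-[] 1 (PentagonalDissection.E1≈theta (N * 5)))
  (≈[]-trans (truncate (PentagonalDissection.U₁-sum N))
  (⊖-cong-[] (spread-cong-[] 4 0 (≈[]-sym (PentagonalDissection.E1≈theta N)))))

module SquaresDissection where
  open Squares using (P; theta; V; approx)

  theta≈ : ∀ j → theta j ≈ sign j ⊗ (q ^ (j * j) ⊕ ⊖ (q ^ (j * j + suc (j + j))))
  theta≈ j = ≈-trans
    (⊗-cong (⊗-cong (⊗-cong ≈-refl (V j)) (q^^ j j)) ≈-refl)
    (≈-trans (solve 3 (λ s x y → s :* con 1 :* x :* (con 1 :+ :- y) := s :* (x :+ :- (x :* y))) ≈-refl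
       (sign j) (q ^ (j * j)) (q ^ suc (j + j)))
    (⊗-cong ≈-refl (⊕-cong ≈-refl (⊖-cong (≈-sym (^-homo-* q (j * j) (suc (j + j))))))))

  a₀ : ∀ n → n * 5 * (n * 5) ≡ 0 + 5 * (n * n) *5
  a₀ n = exponent (go n)
    where
    go : ∀ n → n * 5 * (n * 5) ≡ 0 + 5 * (n * n) * 5
    go = ℕ-solver.solve-∀

  a₁ : ∀ n → (1 + n * 5) * (1 + n * 5) ≡ 1 + (5 * (n * n) + 2 * n) *5
  a₁ n = exponent (go n)
    where
    go : ∀ n → (1 + n * 5) * (1 + n * 5) ≡ 1 + (5 * (n * n) + 2 * n) * 5
    go = ℕ-solver.solve-∀

  a₂ : ∀ n → (2 + n * 5) * (2 + n * 5) ≡ 4 + (5 * (n * n) + 4 * n) *5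
  a₂ n = exponent (go n)
    where
    go : ∀ n → (2 + n * 5) * (2 + n * 5) ≡ 4 + (5 * (n * n) + 4 * n) * 5
    go = ℕ-solver.solve-∀

  a₃ : ∀ n → (3 + n * 5) * (3 + n * 5) ≡ 4 + (5 * (n * n) + 6 * n + 1) *5
  a₃ n = exponent (go n)
    where
    go : ∀ n → (3 + n * 5) * (3 + n * 5) ≡ 4 + (5 * (n * n) + 6 * n + 1) * 5
    go = ℕ-solver.solve-∀

  a₄ : ∀ n → (4 + n * 5) * (4 + n * 5) ≡ 1 + (5 * (n * n) + 8 * n + 3) *5
  a₄ n = exponent (go n)
    where
    go : ∀ n → (4 + n * 5) * (4 + n * 5) ≡ 1 + (5 * (n * n) + 8 * n + 3) * 5
    go = ℕ-solver.solve-∀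

  next-square : ∀ j → j * j + suc (j + j) ≡ suc j * suc j
  next-square = go
    where
    go : ∀ j → j * j + (1 + (j + j)) ≡ (1 + j) * (1 + j)
    go = ℕ-solver.solve-∀

  next : ∀ j {r X} → suc j * suc j ≡ r + X *5 → j * j + suc (j + j) ≡ r + X *5
  next j (exponent eq) = exponent (≡.trans (next-square j) eq)

  pair : ∀ i k n {u v} → U i (q ^ ((k + n * 5) * (k + n * 5))) ≈ u →
         U i (q ^ ((k + n * 5) * (k + n * 5) + suc (k + n * 5 + (k + n * 5)))) ≈ v →
         U i (theta (k + n * 5)) ≈ sign (k + n * 5) ⊗ (u ⊕ ⊖ v)
  pair i k n = U-pair i j (j * j) (j * j + suc (j + j)) (theta≈ j)
    where j = k + n * 5

  vanish : ∀ i → i % 5 ≢ 0 → i % 5 ≢ 1 → i % 5 ≢ 4 → ∀ N → U i (Σ< (N * 5) theta) ≈ const 0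
  vanish i ≢0 ≢1 ≢4 N = ≈-trans
    (U-sum i theta (λ n → sign n ⊗ const 0) (λ n → U-block i theta n
      (pair i 0 n (U-q^-other i (a₀ n) ≢0) (U-q^-other i (next (n * 5) (a₁ n)) ≢1))
      (pair i 1 n (U-q^-other i (a₁ n) ≢1) (U-q^-other i (next (1 + n * 5) (a₂ n)) ≢4))
      (pair i 2 n (U-q^-other i (a₂ n) ≢4) (U-q^-other i (next (2 + n * 5) (a₃ n)) ≢4))
      (pair i 3 n (U-q^-other i (a₃ n) ≢4) (U-q^-other i (next (3 + n * 5) (a₄ n)) ≢1))
      (pair i 4 n (U-q^-other i (a₄ n) ≢1) (U-q^-other i (next (4 + n * 5) (a₀ (suc n))) ≢0))
      (solve 0 (z :+ :- z :+ z :+ :- z :+ z := con 0) ≈-refl)) N)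
    (Σ<-zero N _ λ n → R.zeroʳ (sign n))
    where z = con 0 :+ :- con 0

  -- A square divisible by 5 is (5n)², its quotient by 5 is 5n², and (-1)^(5n) = (-1)ⁿ. The square
  -- (5n+5)² belongs to the last pair of the block, hence `a₀ (suc n)`.
  U₀-sum : ∀ N → U 0 (Σ< (N * 5) theta) ≈ σ (Σ< N theta)
  U₀-sum N = ≈-trans
    (U-sum 0 theta (λ n → sign n ⊗ (q ^ (5 * (n * n)) ⊕ ⊖ (q ^ (5 * (suc n * suc n))))) (λ n → U-block 0 theta n
      (pair 0 0 n (U-q^-same 0 (a₀ n)) (U-q^-other 0 (next (n * 5) (a₁ n)) λ ()))
      (pair 0 1 n (U-q^-other 0 (a₁ n) λ ()) (U-q^-other 0 (next (1 + n * 5) (a₂ n)) λ ()))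
      (pair 0 2 n (U-q^-other 0 (a₂ n) λ ()) (U-q^-other 0 (next (2 + n * 5) (a₃ n)) λ ()))
      (pair 0 3 n (U-q^-other 0 (a₃ n) λ ()) (U-q^-other 0 (next (3 + n * 5) (a₄ n)) λ ()))
      (pair 0 4 n (U-q^-other 0 (a₄ n) λ ()) (U-q^-same 0 (next (4 + n * 5) (a₀ (suc n)))))
      (solve 2 (λ x y → x :+ :- con 0 :+ :- z :+ z :+ :- z :+ (con 0 :+ :- y) := x :+ :- y) ≈-refl
        (q ^ (5 * (n * n))) (q ^ (5 * (suc n * suc n))))) N)
    (≈-trans (Σ<-cong N (λ n → ≈-sym (σ-theta n))) (≈-sym (σ-Σ< N theta)))
    where
    z : ∀ {n} → Polynomial n
    z = con 0 :+ :- con 0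
    σ-theta : ∀ n → σ (theta n) ≈ sign n ⊗ (q ^ (5 * (n * n)) ⊕ ⊖ (q ^ (5 * (suc n * suc n))))
    σ-theta n = ≈-trans (spread-cong 4 0 (theta≈ n)) (≈-trans (spread-⊗ 4 _ _) (⊗-cong (σ-sign n)
      (≈-trans (spread-⊕ 4 0 _ _) (⊕-cong (spread-q^ 4 (n * n))
        (≈-trans (spread-⊖ 4 _) (⊖-cong (≈-trans (spread-q^ 4 (n * n + suc (n + n)))
          (≈-reflexive (cong (λ k → q ^ (5 * k)) (next-square n))))))))))

φ : PS
φ = E1 ⊗ E1 ⊗ E2⁻¹

φ⊗E2 : φ ⊗ E2 ≈ E1 ⊗ E1
φ⊗E2 = ≈-trans (solve 3 (λ a b c → a :* b :* c := a :* (c :* b)) ≈-refl (E1 ⊗ E1) E2⁻¹ E2)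
  (≈-trans (⊗-cong ≈-refl (reciprocal-inverse E2 E2-0)) (R.*-identityʳ _))

reciprocal-cong-[] : ∀ {N f g} → f 0 ≋ + 1 → g 0 ≋ + 1 → f ≈[ N ] g → reciprocal f ≈[ N ] reciprocal g
reciprocal-cong-[] {N} {f} {g} f0 g0 p = begin
  f⁻¹                  ≈⟨ truncate (≈-trans (⊗-cong ≈-refl (reciprocal-inverse g g0)) (R.*-identityʳ f⁻¹)) ⟨
  f⁻¹ ⊗ (g ⊗ g⁻¹)      ≈⟨ ⊗-cong-[] {f = f⁻¹} ≈[]-refl (⊗-cong-[] {g = g⁻¹} p ≈[]-refl) ⟨
  f⁻¹ ⊗ (f ⊗ g⁻¹)      ≈⟨ truncate (solve 3 (λ x y z → x :* (y :* z) := y :* x :* z) ≈-refl f⁻¹ f g⁻¹) ⟩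
  f ⊗ f⁻¹ ⊗ g⁻¹        ≈⟨ truncate (≈-trans (⊗-cong (reciprocal-inverse f f0) ≈-refl) (R.*-identityˡ g⁻¹)) ⟩
  g⁻¹                  ∎
  where
  open import Relation.Binary.Reasoning.Setoid (truncated N)
  f⁻¹ = reciprocal f
  g⁻¹ = reciprocal g

φ≈theta : ∀ N → φ ≈[ N ] Σ< N Squares.theta
φ≈theta zero    = below λ n ()
φ≈theta (suc m) = ≈[]-trans (⊗-cong-[] (⊗-cong-[] (qPoch-approx 0 m) (qPoch-approx 0 m))
  (reciprocal-cong-[] E2-0 (finProd-0 1 m) (qPoch-approx 1 m))) (Squares.approx m)

U₂-φ : U 2 φ ≈ const 0
U₂-φ = untruncate λ N → ≈[]-trans (U-cong-[] 2 (φ≈theta (N * 5)))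
  (truncate (SquaresDissection.vanish 2 (λ ()) (λ ()) (λ ()) N))

U₃-φ : U 3 φ ≈ const 0
U₃-φ = untruncate λ N → ≈[]-trans (U-cong-[] 3 (φ≈theta (N * 5)))
  (truncate (SquaresDissection.vanish 3 (λ ()) (λ ()) (λ ()) N))

U₀-φ : U 0 φ ≈ σ φ
U₀-φ = untruncate λ N → ≈[]-trans (U-cong-[] 0 (φ≈theta (N * 5)))
  (≈[]-trans (truncate (SquaresDissection.U₀-sum N)) (spread-cong-[] 4 0 (≈[]-sym (φ≈theta N))))

-- The fifth power of E1

-- (1 - q)⁵ ≡ (1 - q⁵)(1 - 5Y) modulo 25
Y numerator : PS
numerator = q ⊕ ⊖ (const 2 ⊗ q ^ 2) ⊕ const 2 ⊗ q ^ 3 ⊕ ⊖ (q ^ 4)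
Y = σ (reciprocal (const 1 ⊕ ⊖ q)) ⊗ numerator

1-q-0 : (const 1 ⊕ ⊖ q) 0 ≋ + 1
1-q-0 = ≋-reflexive (≡.trans (⊕-at _ _ 0) (cong₂ ℤ._+_ (scalar-zero (+ 1)) (⊖-at q 0)))

module _ where
  open import Relation.Binary.Reasoning.Setoid R.setoid

  factor⁵ : (const 1 ⊕ ⊖ q) ^ 5 ≈ (const 1 ⊕ ⊖ (q ^ 5)) ⊗ (const 1 ⊕ ⊖ (const 5 ⊗ Y))
  factor⁵ = begin
    (const 1 ⊕ ⊖ q) ^ 5
      ≈⟨ solve 1 (λ x → (con 1 :+ :- x) :^ 5 := (con 1 :+ :- (x :^ 5)) :+ :- (con 5 :* (con 1 :*
           (x :+ :- (con 2 :* x :^ 2) :+ con 2 :* x :^ 3 :+ :- (x :^ 4))))) ≈-refl q ⟩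
    const 1 ⊕ ⊖ (q ^ 5) ⊕ ⊖ (const 5 ⊗ (const 1 ⊗ numerator))
      ≈⟨ ⊕-cong ≈-refl (⊖-cong (⊗-cong ≈-refl (⊗-cong inverse ≈-refl))) ⟨
    const 1 ⊕ ⊖ (q ^ 5) ⊕ ⊖ (const 5 ⊗ ((const 1 ⊕ ⊖ (q ^ 5)) ⊗ G ⊗ numerator))
      ≈⟨ solve 3 (λ u g p → u :+ :- (con 5 :* (u :* g :* p)) := u :* (con 1 :+ :- (con 5 :* (g :* p)))) ≈-refl
           (const 1 ⊕ ⊖ (q ^ 5)) G numerator ⟩
    (const 1 ⊕ ⊖ (q ^ 5)) ⊗ (const 1 ⊕ ⊖ (const 5 ⊗ Y)) ∎
    where
    G = σ (reciprocal (const 1 ⊕ ⊖ q))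
    inverse : (const 1 ⊕ ⊖ (q ^ 5)) ⊗ G ≈ const 1
    inverse = begin
      (const 1 ⊕ ⊖ (q ^ 5)) ⊗ G     ≈⟨ ⊗-cong (⊕-cong (spread-scalar 4 (+ 1)) (≈-trans (spread-⊖ 4 q) (⊖-cong (spread-q 4)))) ≈-refl ⟨
      (σ (const 1) ⊕ σ (⊖ q)) ⊗ G   ≈⟨ ⊗-cong (spread-⊕ 4 0 _ _) ≈-refl ⟨
      σ (const 1 ⊕ ⊖ q) ⊗ G         ≈⟨ spread-⊗ 4 _ _ ⟨
      σ ((const 1 ⊕ ⊖ q) ⊗ reciprocal (const 1 ⊕ ⊖ q))  ≈⟨ spread-cong 4 0 (reciprocal-inverse _ 1-q-0) ⟩
      σ (const 1)                   ≈⟨ spread-scalar 4 (+ 1) ⟩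
      const 1                       ∎

  spread-factor⁵ : ∀ e → 1-q^ (suc e) ^ 5 ≈ 1-q^ (5 * suc e) ⊗ (const 1 ⊕ ⊖ (const 5 ⊗ spread e 0 Y))
  spread-factor⁵ e = begin
    1-q^ (suc e) ^ 5                  ≈⟨ ^-congˡ 5 (≈-trans (spread-⊕ e 0 _ _) (⊕-cong (spread-scalar e (+ 1)) (≈-trans (spread-⊖ e q) (⊖-cong (spread-q e))))) ⟨
    spread e 0 (const 1 ⊕ ⊖ q) ^ 5    ≈⟨ spread-^ e _ 5 ⟨
    spread e 0 ((const 1 ⊕ ⊖ q) ^ 5)  ≈⟨ spread-cong e 0 factor⁵ ⟩
    spread e 0 ((const 1 ⊕ ⊖ (q ^ 5)) ⊗ (const 1 ⊕ ⊖ (const 5 ⊗ Y)))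
      ≈⟨ spread-⊗ e _ _ ⟩
    spread e 0 (const 1 ⊕ ⊖ (q ^ 5)) ⊗ spread e 0 (const 1 ⊕ ⊖ (const 5 ⊗ Y))
      ≈⟨ ⊗-cong
           (≈-trans (spread-⊕ e 0 _ _) (⊕-cong (spread-scalar e (+ 1)) (≈-trans (spread-⊖ e _) (⊖-cong
             (≈-trans (spread-q^ e 5) (≈-reflexive (cong (q ^_) (ℕ.*-comm (suc e) 5))))))))
           (≈-trans (spread-⊕ e 0 _ _) (⊕-cong (spread-scalar e (+ 1)) (≈-trans (spread-⊖ e _) (⊖-cong (spread-scalar-⊗ e 0 (+ 5) Y))))) ⟩
    1-q^ (5 * suc e) ⊗ (const 1 ⊕ ⊖ (const 5 ⊗ spread e 0 Y)) ∎

  partialL : ℕ → PS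
  partialL m = Σ< m (λ e → spread e 0 Y)

  -- Modulo 25 a product of factors 1 - 5 Y(q^k) is 1 minus five times the sum of the Y(q^k), so a
  -- product formula turns into a Lambert series.
  finProd⁵ : ∀ m → finProd 1 m ^ 5 ≈ finProd 5 m ⊗ (const 1 ⊕ ⊖ (const 5 ⊗ partialL m))
  finProd⁵ zero = ≈-trans (^-congˡ 5 one≈) (≈-trans (solve 0 (con 1 :^ 5 := con 1 :* (con 1 :+ :- (con 5 :* con 0))) ≈-refl)
    (⊗-cong (≈-sym one≈) ≈-refl))
  finProd⁵ (suc m) = begin
    finProd 1 (suc m) ^ 5
      ≈⟨ ^-congˡ 5 (Q-suc m) ⟩
    (finProd 1 m ⊗ 1-q^ (suc m)) ^ 5
      ≈⟨ ^-distrib-* _ _ 5 ⟩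
    finProd 1 m ^ 5 ⊗ 1-q^ (suc m) ^ 5
      ≈⟨ ⊗-cong (finProd⁵ m) (spread-factor⁵ m) ⟩
    finProd 5 m ⊗ (const 1 ⊕ ⊖ (const 5 ⊗ partialL m)) ⊗ (1-q^ (5 * suc m) ⊗ (const 1 ⊕ ⊖ (const 5 ⊗ spread m 0 Y)))
      ≈⟨ solve 4 (λ p l u y → p :* (con 1 :+ :- (con 5 :* l)) :* (u :* (con 1 :+ :- (con 5 :* y)))
           := p :* u :* (con 1 :+ :- (con 5 :* (l :+ y)))) ≈-refl (finProd 5 m) (partialL m) (1-q^ (5 * suc m)) (spread m 0 Y) ⟩
    finProd 5 m ⊗ 1-q^ (5 * suc m) ⊗ (const 1 ⊕ ⊖ (const 5 ⊗ partialL (suc m)))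
      ≈⟨ ⊗-cong (finProd-suc 4 m) ≈-refl ⟨
    finProd 5 (suc m) ⊗ (const 1 ⊕ ⊖ (const 5 ⊗ partialL (suc m))) ∎

Y-0 : Y 0 ≋ + 0
Y-0 = ≋-trans (≋-reflexive (⊗-at (σ (reciprocal (const 1 ⊕ ⊖ q))) numerator 0))
  (≋-trans (*-≋ {x = σ (reciprocal (const 1 ⊕ ⊖ q)) 0} ≋-refl numerator-0)
  (≋-reflexive (ℤ.*-zeroʳ (σ (reciprocal (const 1 ⊕ ⊖ q)) 0))))
  where
  numerator-0 : numerator 0 ≋ + 0
  numerator-0 = ≋-trans (at (solve 1 (λ x → x :+ :- (con 2 :* x :^ 2) :+ con 2 :* x :^ 3 :+ :- (x :^ 4)
      := x :* (con 1 :+ :- (con 2 :* x) :+ con 2 :* x :^ 2 :+ :- (x :^ 3))) ≈-refl q) 0)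
    (≋-reflexive (⊗-at q _ 0))

spread-small : ∀ e f → f 0 ≋ + 0 → spread e 0 f ≈[ suc e ] const 0
spread-small e f f0 = ≈[]-trans (truncate (≈-trans (spread-head-tail e f)
    (≈-trans (⊕-cong (scalar-cong f0) ≈-refl) (R.+-identityˡ _)))) (q^-small (suc e) _)

L : PS
L = lim partialL

L-approx : ∀ N → L ≈[ N ] partialL N
L-approx = lim-approx partialL λ n → ≈[]-sym (≈[]-trans
  (⊕-cong-[] ≈[]-refl (weaken (ℕ.n≤1+n n) (spread-small n Y Y-0))) (truncate (R.+-identityʳ _)))

E1^5≈ : E1 ^ 5 ≈ σ E1 ⊗ (const 1 ⊕ ⊖ (const 5 ⊗ L))
E1^5≈ = untruncate λ N → ≈[]-trans (^-cong-[] 5 (weaken (ℕ.n≤1+n N) (qPoch-approx 0 N)))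
  (≈[]-trans (truncate (finProd⁵ N)) (≈[]-sym (⊗-cong-[]
    (≈[]-trans (truncate (≈-sym (qPoch≈spread 4))) (weaken (ℕ.n≤1+n N) (qPoch-approx 4 N)))
    (⊕-cong-[] ≈[]-refl (⊖-cong-[] (⊗-cong-[] ≈[]-refl (L-approx N)))))))

U₀-numerator : U 0 numerator ≈ const 0
U₀-numerator = ≈-trans (≈-trans (U-⊕ 0 _ _) (⊕-cong (≈-trans (U-⊕ 0 _ _) (⊕-cong (≈-trans (U-⊕ 0 _ _) (⊕-cong
    (≈-trans (U-cong 0 (≈-sym (R.*-identityʳ q))) (vanish 1 λ ()))
    (≈-trans (U-⊖ 0 _) (⊖-cong (≈-trans (U-scalar⊗ 0 (+ 2) _) (⊗-cong ≈-refl (vanish 2 λ ())))))))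
    (≈-trans (U-scalar⊗ 0 (+ 2) _) (⊗-cong ≈-refl (vanish 3 λ ())))))
    (≈-trans (U-⊖ 0 _) (⊖-cong (vanish 4 λ ())))))
  (solve 0 (con 0 :+ :- (con 2 :* con 0) :+ con 2 :* con 0 :+ :- con 0 := con 0) ≈-refl)
  where
  vanish : ∀ r → 0 ≢ r % 5 → U 0 (q ^ r) ≈ const 0
  vanish r = U-q^-other 0 {r} {r} {0} (exponent (≡.sym (ℕ.+-identityʳ r)))

U₀-Y : U 0 Y ≈ const 0
U₀-Y = ≈-trans (U-σ⊗ 0 _ numerator) (≈-trans (⊗-cong ≈-refl U₀-numerator) (R.zeroʳ _))

-- Y has no exponents divisible by 5. Hence Y(q^k) contributes nothing to class 0 when 5 does not
-- divide k, while Y(q^(5j)) contributes Y(q^j). Summand e of `partialL` is Y(q^(e+1)), so in each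
-- block the last of the five survives.
U₀-partialL : ∀ N → U 0 (partialL (N * 5)) ≈ partialL N
U₀-partialL zero    = coeffwise λ n → ≋-reflexive (≡.trans (scalar0-at (n * 5)) (≡.sym (scalar0-at n)))
U₀-partialL (suc N) = ≈-trans
  (≈-trans (U-⊕ 0 _ _) (⊕-cong (≈-trans (U-⊕ 0 _ _) (⊕-cong (≈-trans (U-⊕ 0 _ _) (⊕-cong
    (≈-trans (U-⊕ 0 _ _) (⊕-cong (≈-trans (U-⊕ 0 _ _) (⊕-cong (U₀-partialL N)
      (coprime 0 λ ()))) (coprime 1 λ ()))) (coprime 2 λ ()))) (coprime 3 λ ())))
    (≈-trans (U-cong 0 (≈-sym (spread-spread 4 N (4 + N * 5) Y (ℕ.*-comm 5 (suc N))))) (U₀-σ _))))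
  (solve 2 (λ x y → x :+ con 0 :+ con 0 :+ con 0 :+ con 0 :+ y := x :+ y) ≈-refl _ _)
  where
  coprime : ∀ j → suc j % 5 ≢ 0 → U 0 (spread (j + N * 5) 0 Y) ≈ const 0
  coprime j j≢0 = U₀-spread-coprime (j + N * 5) Y
    (λ 5∣ → j≢0 (≡.trans (≡.sym (ℕ.[m+kn]%n≡m%n (suc j) N 5)) (ℕ∣.n∣m⇒m%n≡0 (suc j + N * 5) 5 5∣))) U₀-Y

U₀-L : U 0 L ≈ L
U₀-L = untruncate λ N → ≈[]-trans (U-cong-[] 0 (L-approx (N * 5)))
  (≈[]-trans (truncate (U₀-partialL N)) (≈[]-sym (L-approx N)))

-- Dissections of E1, E2 and their powers

open import Relation.Binary.Reasoning.Setoid R.setoid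

U⁵-⊗ : ∀ {f g u v} → U⁵ f ≈⁵ u → U⁵ g ≈⁵ v → U⁵ (f ⊗ g) ≈⁵ convolve _⊕_ _⊗_ q u v
U⁵-⊗ {f} {g} [ a₀ , a₁ , a₂ , a₃ , a₄ ] [ b₀ , b₁ , b₂ , b₃ , b₄ ] = ≈⁵-trans (U⁵-product f g)
  [ ⊕-cong (⊗-cong a₀ b₀) (⊗-cong ≈-refl
      (⊕-cong (⊕-cong (⊕-cong (⊗-cong a₁ b₄) (⊗-cong a₂ b₃)) (⊗-cong a₃ b₂)) (⊗-cong a₄ b₁)))
  , ⊕-cong (⊕-cong (⊗-cong a₀ b₁) (⊗-cong a₁ b₀)) (⊗-cong ≈-refl
      (⊕-cong (⊕-cong (⊗-cong a₂ b₄) (⊗-cong a₃ b₃)) (⊗-cong a₄ b₂)))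
  , ⊕-cong (⊕-cong (⊕-cong (⊗-cong a₀ b₂) (⊗-cong a₁ b₁)) (⊗-cong a₂ b₀)) (⊗-cong ≈-refl
      (⊕-cong (⊗-cong a₃ b₄) (⊗-cong a₄ b₃)))
  , ⊕-cong (⊕-cong (⊕-cong (⊕-cong (⊗-cong a₀ b₃) (⊗-cong a₁ b₂)) (⊗-cong a₂ b₁)) (⊗-cong a₃ b₀))
      (⊗-cong ≈-refl (⊗-cong a₄ b₄))
  , ⊕-cong (⊕-cong (⊕-cong (⊕-cong (⊗-cong a₀ b₄) (⊗-cong a₁ b₃)) (⊗-cong a₂ b₂)) (⊗-cong a₃ b₁)) (⊗-cong a₄ b₀) ]

δ⁵ : Parts PS → Parts PS
δ⁵ ⟨ x₀ , x₁ , x₂ , x₃ , x₄ ⟩ = ⟨ δ x₀ , q ⊗ δ x₃ , δ x₁ , q ⊗ δ x₄ , δ x₂ ⟩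

U⁵-δ : ∀ {f u} → U⁵ f ≈⁵ u → U⁵ (δ f) ≈⁵ δ⁵ u
U⁵-δ {f} [ a₀ , a₁ , a₂ , a₃ , a₄ ] =
  [ ≈-trans (U₀-δ f) (spread-cong 1 0 a₀)
  , ≈-trans (U₁-δ f) (⊗-cong ≈-refl (spread-cong 1 0 a₃))
  , ≈-trans (U₂-δ f) (spread-cong 1 0 a₁)
  , ≈-trans (U₃-δ f) (⊗-cong ≈-refl (spread-cong 1 0 a₄))
  , ≈-trans (U₄-δ f) (spread-cong 1 0 a₂) ]

map⁵ : {X Y : Set} → (X → Y) → Parts X → Parts Y
map⁵ h ⟨ x₀ , x₁ , x₂ , x₃ , x₄ ⟩ = ⟨ h x₀ , h x₁ , h x₂ , h x₃ , h x₄ ⟩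

eval : ∀ {n} → Vec PS n → Parts (Polynomial n) → Parts PS
eval ρ = map⁵ (λ p → ⟦ p ⟧ ρ)

-- q has to be the first variable.
multiply : ∀ {n f g} (ρ : Vec PS n) (u v w : Parts (Polynomial (suc n))) →
           U⁵ f ≈⁵ eval (q ∷ ρ) u → U⁵ g ≈⁵ eval (q ∷ ρ) v →
           map⁵ (λ p → ⟦ p ⟧↓ (q ∷ ρ)) (convolve _:+_ _:*_ (var zero) u v) ≈⁵ map⁵ (λ p → ⟦ p ⟧↓ (q ∷ ρ)) w →
           U⁵ (f ⊗ g) ≈⁵ eval (q ∷ ρ) w
multiply ρ u v w p r [ n₀ , n₁ , n₂ , n₃ , n₄ ] = ≈⁵-trans (U⁵-⊗ p r)
  [ normalised t.p₀ w.p₀ n₀ , normalised t.p₁ w.p₁ n₁ , normalised t.p₂ w.p₂ n₂ , normalised t.p₃ w.p₃ n₃ , normalised t.p₄ w.p₄ n₄ ]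
  where
  module t = Parts (convolve _:+_ _:*_ (var zero) u v)
  module w = Parts w
  normalised = prove (q ∷ ρ)

refl⁵ : ∀ {u} → u ≈⁵ u
refl⁵ = [ ≈-refl , ≈-refl , ≈-refl , ≈-refl , ≈-refl ]

-- x is q^(-1/5) R(q) for the Rogers–Ramanujan continued fraction R, and y is its value at q².
a a′ c c′ e e′ x y : PS
a  = U 0 E1
c  = U 2 E1
e  = σ E1
x  = e ⊗ reciprocal a
a′ = δ a
c′ = δ c
e′ = δ e
y  = δ x

a-0 : a 0 ≋ + 1
a-0 = ≋-refl

ax≈e : a ⊗ x ≈ e
ax≈e = begin
  a ⊗ (e ⊗ reciprocal a)  ≈⟨ solve 3 (λ a e r → a :* (e :* r) := e :* (a :* r)) ≈-refl a e (reciprocal a) ⟩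
  e ⊗ (a ⊗ reciprocal a)  ≈⟨ ⊗-cong ≈-refl (reciprocal-inverse a a-0) ⟩
  e ⊗ const 1             ≈⟨ R.*-identityʳ e ⟩
  e                       ∎

a′y≈e′ : a′ ⊗ y ≈ e′
a′y≈e′ = ≈-trans (≈-sym (spread-⊗ 1 a x)) (spread-cong 1 0 ax≈e)

σE2≈e′ : σ E2 ≈ e′
σE2≈e′ = ≈-trans (spread-cong 4 0 E2≈δE1) (≈-sym (δσ E1))

dissect-E1′ : U⁵ E1 ≈⁵ ⟨ a , ⊖ e , c , const 0 , const 0 ⟩
dissect-E1′ = [ ≈-refl , U₁-E1 , ≈-refl , U₃-E1 , U₄-E1 ]

δ0 : δ (const 0) ≈ const 0
δ0 = spread-scalar 1 (+ 0)

q⊗δ0 : q ⊗ δ (const 0) ≈ const 0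
q⊗δ0 = ≈-trans (⊗-cong ≈-refl δ0) (R.zeroʳ q)

dissect-E2′ : U⁵ E2 ≈⁵ ⟨ a′ , const 0 , ⊖ e′ , const 0 , c′ ⟩
dissect-E2′ = ≈⁵-trans (U⁵-cong E2≈δE1) (≈⁵-trans (U⁵-δ dissect-E1′) [ ≈-refl , q⊗δ0 , spread-⊖ 1 e , q⊗δ0 , ≈-refl ])

A B C : PS
A = σ φ
B = U 1 φ
C = U 4 φ

dissect-φ : U⁵ φ ≈⁵ ⟨ A , B , const 0 , const 0 , C ⟩
dissect-φ = [ U₀-φ , ≈-refl , U₂-φ , U₃-φ , ≈-refl ]

dissect-φE2 : U⁵ (E1 ⊗ E1) ≈⁵
  ⟨ A ⊗ a′ ⊕ q ⊗ (B ⊗ c′) , B ⊗ a′ ⊕ ⊖ (q ⊗ (C ⊗ e′)) , ⊖ (A ⊗ e′) , ⊖ (B ⊗ e′) ⊕ q ⊗ (C ⊗ c′) , A ⊗ c′ ⊕ C ⊗ a′ ⟩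
dissect-φE2 = ≈⁵-trans (U⁵-cong (≈-sym φ⊗E2))
  (multiply (A ∷ B ∷ C ∷ a′ ∷ e′ ∷ c′ ∷ [])
    ⟨ t₀ , t₁ , con 0 , con 0 , t₄ ⟩ ⟨ u , con 0 , :- v , con 0 , w ⟩
    ⟨ t₀ :* u :+ q̂ :* (t₁ :* w) , t₁ :* u :+ :- (q̂ :* (t₄ :* v)) , :- (t₀ :* v) , :- (t₁ :* v) :+ q̂ :* (t₄ :* w) , t₀ :* w :+ t₄ :* u ⟩
    dissect-φ dissect-E2′ refl⁵)
  where
  q̂ = var (# 0)
  t₀ = var (# 1)
  t₁ = var (# 2)
  t₄ = var (# 3)
  u = var (# 4)
  v = var (# 5)
  w = var (# 6)

dissect-E1²′ : U⁵ (E1 ⊗ E1) ≈⁵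
  ⟨ a ⊗ a , ⊖ (const 2 ⊗ (a ⊗ e)) , e ⊗ e ⊕ const 2 ⊗ (a ⊗ c) , ⊖ (const 2 ⊗ (e ⊗ c)) , c ⊗ c ⟩
dissect-E1²′ = multiply (a ∷ e ∷ c ∷ [])
  ⟨ u , :- v , w , con 0 , con 0 ⟩ ⟨ u , :- v , w , con 0 , con 0 ⟩
  ⟨ u :* u , :- (con 2 :* (u :* v)) , v :* v :+ con 2 :* (u :* w) , :- (con 2 :* (v :* w)) , w :* w ⟩
  dissect-E1′ dissect-E1′ refl⁵
  where
  u = var (# 1)
  v = var (# 2)
  w = var (# 3)

Ae′ : A ⊗ e′ ≈ e ⊗ e
Ae′ = begin
  σ φ ⊗ e′        ≈⟨ ⊗-cong ≈-refl σE2≈e′ ⟨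
  σ φ ⊗ σ E2      ≈⟨ spread-⊗ 4 φ E2 ⟨
  σ (φ ⊗ E2)      ≈⟨ spread-cong 4 0 φ⊗E2 ⟩
  σ (E1 ⊗ E1)     ≈⟨ spread-⊗ 4 E1 E1 ⟩
  e ⊗ e           ∎

-- 13 inverts 2 modulo 25.
halve : ∀ {f g} → const 2 ⊗ f ≈ const 2 ⊗ g → f ≈ g
halve {f} {g} p = begin
  f                        ≈⟨ solve 1 (λ f → con 13 :* (con 2 :* f) := f) ≈-refl f ⟨
  const 13 ⊗ (const 2 ⊗ f) ≈⟨ ⊗-cong ≈-refl p ⟩
  const 13 ⊗ (const 2 ⊗ g) ≈⟨ solve 1 (λ f → con 13 :* (con 2 :* f) := f) ≈-refl g ⟩
  g                        ∎

-- E1² is dissected twice, as a square and as φ E2. Since φ has no classes 2 and 3 and E2 none of 1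
-- and 3, class 2 of φ E2 is the single product -A e′, which is -e². No product formulas for a and c
-- are needed.
ac≈-e² : a ⊗ c ≈ ⊖ (e ⊗ e)
ac≈-e² = halve (begin
  const 2 ⊗ (a ⊗ c)                                ≈⟨ solve 2 (λ u v → u := (v :+ u) :+ :- v) ≈-refl (const 2 ⊗ (a ⊗ c)) (e ⊗ e) ⟩
  e ⊗ e ⊕ const 2 ⊗ (a ⊗ c) ⊕ ⊖ (e ⊗ e)            ≈⟨ ⊕-cong (≈-trans (≈-sym (≈₂ dissect-E1²′)) (≈₂ dissect-φE2)) ≈-refl ⟩
  ⊖ (A ⊗ e′) ⊕ ⊖ (e ⊗ e)                           ≈⟨ ⊕-cong (⊖-cong Ae′) ≈-refl ⟩
  ⊖ (e ⊗ e) ⊕ ⊖ (e ⊗ e)                            ≈⟨ solve 1 (λ v → :- v :+ :- v := con 2 :* :- v) ≈-refl (e ⊗ e) ⟩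
  const 2 ⊗ ⊖ (e ⊗ e)                              ∎)

c≈ : c ≈ ⊖ (a ⊗ x ^ 2)
c≈ = ⊗-cancelˡ a a-0 (begin
  a ⊗ c                    ≈⟨ ac≈-e² ⟩
  ⊖ (e ⊗ e)                ≈⟨ ⊖-cong (⊗-cong ax≈e ax≈e) ⟨
  ⊖ (a ⊗ x ⊗ (a ⊗ x))      ≈⟨ solve 2 (λ a x → :- (a :* x :* (a :* x)) := a :* :- (a :* x :^ 2)) ≈-refl a x ⟩
  a ⊗ ⊖ (a ⊗ x ^ 2)        ∎)

c′≈ : c′ ≈ ⊖ (a′ ⊗ y ^ 2)
c′≈ = ≈-trans (spread-cong 1 0 c≈) (≈-trans (spread-⊖ 1 _) (⊖-cong (≈-trans (spread-⊗ 1 _ _) (⊗-cong ≈-refl (spread-^ 1 x 2)))))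

E-parts : ∀ {n} → (q a x : Polynomial n) → Parts (Polynomial n)
E-parts q a x = ⟨ a , :- (a :* x) , :- (a :* x :^ 2) , con 0 , con 0 ⟩

-- The coefficients of powers of 1 - t - t², sorted by degree modulo 5, with t⁵ replaced by q x⁵.
-- Divisibility by 5 is what matters later: class 3 of the cube, class 4 of the fourth power, and
-- all classes but 0 of the fifth power.
E²-parts E³-parts E⁴-parts E⁵-parts : ∀ {n} → (q a x : Polynomial n) → Parts (Polynomial n)
E²-parts q a x = map⁵ (a :^ 2 :*_) ⟨ con 1 , :- (con 2 :* x) , :- (x :^ 2) , con 2 :* x :^ 3 , x :^ 4 ⟩
E³-parts q a x = map⁵ (a :^ 3 :*_) ⟨ con 1 :- con 3 :* z , :- (x :* (con 3 :+ z)) , con 0 , con 5 :* x :^ 3 , con 0 ⟩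
  where z = q :* x :^ 5
E⁴-parts q a x = map⁵ (a :^ 4 :*_)
  ⟨ con 1 :- con 8 :* z , x :* (con 2 :* z :- con 4) , x :^ 2 :* (con 2 :+ con 4 :* z) , x :^ 3 :* (con 8 :+ z) , :- (con 5 :* x :^ 4) ⟩
  where z = q :* x :^ 5
E⁵-parts q a x = map⁵ (a :^ 5 :*_)
  ⟨ con 1 :- con 11 :* z :- z :* z
  , con 5 :* (x :* (con 3 :* z :- con 1)) , con 5 :* (x :^ 2 :* (con 1 :+ con 2 :* z))
  , con 5 :* (x :^ 3 :* (con 2 :- z)) , con 5 :* (x :^ 4 :* :- (con 3 :+ z)) ⟩
  where z = q :* x :^ 5

δ-parts : ∀ {n} → (∀ (q a x : Polynomial n) → Parts (Polynomial n)) → (q a y : Polynomial n) → Parts (Polynomial n)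
δ-parts parts q a y = ⟨ p₀ , q :* p₃ , p₁ , q :* p₄ , p₂ ⟩
  where open Parts (parts (q :^ 2) a y)

Powers : Set
Powers = ∀ {n} → (q a x : Polynomial n) → Parts (Polynomial n)

dissects-E1 dissects-E2 : PS → Powers → Set
dissects-E1 f parts = U⁵ f ≈⁵ eval (q ∷ a ∷ x ∷ []) (parts (var (# 0)) (var (# 1)) (var (# 2)))
dissects-E2 f parts = U⁵ f ≈⁵ eval (q ∷ a′ ∷ y ∷ []) (δ-parts parts (var (# 0)) (var (# 1)) (var (# 2)))

-- The relation between R(q) and R(q²).
modular : x ^ 2 ⊕ q ⊗ x ⊗ y ^ 3 ⊕ q ⊗ x ^ 3 ⊗ y ^ 2 ≈ y
modular = ⊗-cancelˡ (a ⊗ a) aa-0 (begin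
  a ⊗ a ⊗ (x ^ 2 ⊕ q ⊗ x ⊗ y ^ 3 ⊕ q ⊗ x ^ 3 ⊗ y ^ 2)
    ≈⟨ solve 4 (λ a q x y → a :* a :* (x :^ 2 :+ q :* x :* y :^ 3 :+ q :* x :^ 3 :* y :^ 2)
         := a :* x :* (a :* x) :+ q :* y :^ 2 :* (a :* a :* (x :* y :+ x :^ 3))) ≈-refl a q x y ⟩
  a ⊗ x ⊗ (a ⊗ x) ⊕ q ⊗ y ^ 2 ⊗ (a ⊗ a ⊗ (x ⊗ y ⊕ x ^ 3))
    ≈⟨ ⊕-cong (≈-trans (⊗-cong ax≈e ax≈e) (≈-trans (≈-sym Ae′) (⊗-cong ≈-refl (≈-sym a′y≈e′))))
              (⊗-cong ≈-refl B≈) ⟩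
  A ⊗ (a′ ⊗ y) ⊕ q ⊗ y ^ 2 ⊗ ⊖ (a′ ⊗ y ⊗ B)
    ≈⟨ solve 5 (λ A a y q B → A :* (a :* y) :+ q :* y :^ 2 :* :- (a :* y :* B) := y :* (A :* a :+ q :* (B :* :- (a :* y :^ 2))))
         ≈-refl A a′ y q B ⟩
  y ⊗ (A ⊗ a′ ⊕ q ⊗ (B ⊗ ⊖ (a′ ⊗ y ^ 2)))
    ≈⟨ ⊗-cong ≈-refl (≈-trans (⊕-cong ≈-refl (⊗-cong ≈-refl (⊗-cong ≈-refl (≈-sym c′≈))))
         (≈-trans (≈-sym (≈₀ dissect-φE2)) (≈₀ dissect-E1²′))) ⟩
  y ⊗ (a ⊗ a)
    ≈⟨ R.*-comm y (a ⊗ a) ⟩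
  a ⊗ a ⊗ y ∎)
  where
  aa-0 : (a ⊗ a) 0 ≋ + 1
  aa-0 = ≋-reflexive (⊗-at a a 0)
  -- Classes 1 and 3 of E1² = φ E2 are linear in B and C. Adding y times the first to the second
  -- eliminates C, and the resulting B is inserted into class 0.
  class₁ : a′ ⊗ (B ⊕ ⊖ (q ⊗ y ⊗ C)) ≈ ⊖ (const 2 ⊗ (a ⊗ a ⊗ x))
  class₁ = begin
    a′ ⊗ (B ⊕ ⊖ (q ⊗ y ⊗ C))             ≈⟨ solve 5 (λ a B q y C → a :* (B :+ :- (q :* y :* C)) := B :* a :+ :- (q :* (C :* (a :* y)))) ≈-refl a′ B q y C ⟩
    B ⊗ a′ ⊕ ⊖ (q ⊗ (C ⊗ (a′ ⊗ y)))      ≈⟨ ⊕-cong ≈-refl (⊖-cong (⊗-cong ≈-refl (⊗-cong ≈-refl a′y≈e′))) ⟩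
    B ⊗ a′ ⊕ ⊖ (q ⊗ (C ⊗ e′))            ≈⟨ ≈-trans (≈-sym (≈₁ dissect-φE2)) (≈₁ dissect-E1²′) ⟩
    ⊖ (const 2 ⊗ (a ⊗ e))                ≈⟨ ⊖-cong (⊗-cong ≈-refl (≈-trans (⊗-cong ≈-refl (≈-sym ax≈e)) (≈-sym (R.*-assoc a a x)))) ⟩
    ⊖ (const 2 ⊗ (a ⊗ a ⊗ x))            ∎
  class₃ : a′ ⊗ y ⊗ (B ⊕ q ⊗ y ⊗ C) ≈ ⊖ (const 2 ⊗ (a ⊗ a ⊗ x ^ 3))
  class₃ = begin
    a′ ⊗ y ⊗ (B ⊕ q ⊗ y ⊗ C)
      ≈⟨ solve 5 (λ a B q y C → a :* y :* (B :+ q :* y :* C) := :- (:- (B :* (a :* y)) :+ q :* (C :* :- (a :* y :^ 2)))) ≈-refl a′ B q y C ⟩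
    ⊖ (⊖ (B ⊗ (a′ ⊗ y)) ⊕ q ⊗ (C ⊗ ⊖ (a′ ⊗ y ^ 2)))
      ≈⟨ ⊖-cong (⊕-cong (⊖-cong (⊗-cong ≈-refl a′y≈e′)) (⊗-cong ≈-refl (⊗-cong ≈-refl (≈-sym c′≈)))) ⟩
    ⊖ (⊖ (B ⊗ e′) ⊕ q ⊗ (C ⊗ c′))
      ≈⟨ ⊖-cong (≈-trans (≈-sym (≈₃ dissect-φE2)) (≈₃ dissect-E1²′)) ⟩
    ⊖ ⊖ (const 2 ⊗ (e ⊗ c))
      ≈⟨ ⊖-cong (⊖-cong (⊗-cong ≈-refl (⊗-cong (≈-sym ax≈e) c≈))) ⟩
    ⊖ ⊖ (const 2 ⊗ (a ⊗ x ⊗ ⊖ (a ⊗ x ^ 2)))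
      ≈⟨ solve 2 (λ a x → :- :- (con 2 :* (a :* x :* :- (a :* x :^ 2))) := :- (con 2 :* (a :* a :* x :^ 3))) ≈-refl a x ⟩
    ⊖ (const 2 ⊗ (a ⊗ a ⊗ x ^ 3)) ∎
  B≈ : a ⊗ a ⊗ (x ⊗ y ⊕ x ^ 3) ≈ ⊖ (a′ ⊗ y ⊗ B)
  B≈ = halve (begin
    const 2 ⊗ (a ⊗ a ⊗ (x ⊗ y ⊕ x ^ 3))
      ≈⟨ solve 3 (λ a x y → con 2 :* (a :* a :* (x :* y :+ x :^ 3)) := :- (y :* :- (con 2 :* (a :* a :* x)) :+ :- (con 2 :* (a :* a :* x :^ 3))))
           ≈-refl a x y ⟩
    ⊖ (y ⊗ ⊖ (const 2 ⊗ (a ⊗ a ⊗ x)) ⊕ ⊖ (const 2 ⊗ (a ⊗ a ⊗ x ^ 3)))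
      ≈⟨ ⊖-cong (⊕-cong (⊗-cong ≈-refl (≈-sym class₁)) (≈-sym class₃)) ⟩
    ⊖ (y ⊗ (a′ ⊗ (B ⊕ ⊖ (q ⊗ y ⊗ C))) ⊕ a′ ⊗ y ⊗ (B ⊕ q ⊗ y ⊗ C))
      ≈⟨ solve 5 (λ a y B q C → :- (y :* (a :* (B :+ :- (q :* y :* C))) :+ a :* y :* (B :+ q :* y :* C)) := con 2 :* :- (a :* y :* B))
           ≈-refl a′ y B q C ⟩
    const 2 ⊗ ⊖ (a′ ⊗ y ⊗ B) ∎)

dissect-E1 : dissects-E1 E1 E-parts
dissect-E1 = ≈⁵-trans dissect-E1′ [ ≈-refl , ⊖-cong (≈-sym ax≈e) , c≈ , ≈-refl , ≈-refl ]

multiply-E1 : ∀ {f g} (u v w : Powers) → dissects-E1 f u → dissects-E1 g v → _ → dissects-E1 (f ⊗ g) w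
multiply-E1 u v w = multiply (a ∷ x ∷ []) (at-x u) (at-x v) (at-x w)
  where
  at-x : Powers → Parts (Polynomial 3)
  at-x u = u (var (# 0)) (var (# 1)) (var (# 2))

multiply-E2 : ∀ {f g} (u v w : Powers) → dissects-E2 f u → dissects-E2 g v → _ → dissects-E2 (f ⊗ g) w
multiply-E2 u v w = multiply (a′ ∷ y ∷ []) (at-y u) (at-y v) (at-y w)
  where
  at-y : Powers → Parts (Polynomial 3)
  at-y u = δ-parts u (var (# 0)) (var (# 1)) (var (# 2))

dissect-E1² : dissects-E1 (E1 ⊗ E1) E²-parts
dissect-E1² = multiply-E1 E-parts E-parts E²-parts dissect-E1 dissect-E1 refl⁵

dissect-E1³ : dissects-E1 (E1 ⊗ E1 ⊗ E1) E³-parts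
dissect-E1³ = multiply-E1 E²-parts E-parts E³-parts dissect-E1² dissect-E1 refl⁵

dissect-E1⁴ : dissects-E1 (E1 ⊗ E1 ⊗ (E1 ⊗ E1)) E⁴-parts
dissect-E1⁴ = multiply-E1 E²-parts E²-parts E⁴-parts dissect-E1² dissect-E1² refl⁵

dissect-E1⁵ : dissects-E1 (E1 ⊗ E1 ⊗ (E1 ⊗ E1) ⊗ E1) E⁵-parts
dissect-E1⁵ = multiply-E1 E⁴-parts E-parts E⁵-parts dissect-E1⁴ dissect-E1 refl⁵

dissect-E2 : dissects-E2 E2 E-parts
dissect-E2 = ≈⁵-trans dissect-E2′ [ ≈-refl , ≈-sym (R.zeroʳ q) , ⊖-cong (≈-sym a′y≈e′) , ≈-sym (R.zeroʳ q) , c′≈ ]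

dissect-E2² : dissects-E2 (E2 ⊗ E2) E²-parts
dissect-E2² = multiply-E2 E-parts E-parts E²-parts dissect-E2 dissect-E2 refl⁵

dissect-E2³ : dissects-E2 (E2 ⊗ E2 ⊗ E2) E³-parts
dissect-E2³ = multiply-E2 E²-parts E-parts E³-parts dissect-E2² dissect-E2 refl⁵

dissect-E2⁴ : dissects-E2 (E2 ⊗ E2 ⊗ (E2 ⊗ E2)) E⁴-parts
dissect-E2⁴ = multiply-E2 E²-parts E²-parts E⁴-parts dissect-E2² dissect-E2² refl⁵

dissect-E2⁵ : dissects-E2 (E2 ⊗ E2 ⊗ (E2 ⊗ E2) ⊗ E2) E⁵-parts
dissect-E2⁵ = multiply-E2 E⁴-parts E-parts E⁵-parts dissect-E2⁴ dissect-E2 refl⁵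

-- The curve

⊗-0 : ∀ {f g} → f 0 ≋ + 1 → g 0 ≋ + 1 → (f ⊗ g) 0 ≋ + 1
⊗-0 {f} {g} f0 g0 = ≋-trans (≋-reflexive (⊗-at f g 0)) (*-≋ f0 g0)

^-0 : ∀ {f} n → f 0 ≋ + 1 → (f ^ n) 0 ≋ + 1
^-0 zero    f0 = ≋-reflexive (scalar-zero (+ 1))
^-0 (suc n) f0 = ⊗-0 f0 (^-0 n f0)

-- k is Ramanujan's parameter R(q) R(q²)²: D²G, S⁴(M z), D²(M z′) and, modulo 5, D²K are powers of
-- x and y times polynomials in k.
k D S N N₂ z z′ G K : PS
k  = q ⊗ x ⊗ y ^ 2
D  = const 1 ⊕ ⊖ k
S  = const 1 ⊕ k
N  = const 1 ⊕ ⊖ (const 4 ⊗ k) ⊕ ⊖ (k ^ 2)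
N₂ = const 1 ⊕ k ⊕ ⊖ (k ^ 2)
z  = q ⊗ x ^ 5
z′ = q ^ 2 ⊗ y ^ 5
G  = x ^ 4 ⊕ x ^ 2 ⊗ y ⊕ ⊖ (y ^ 2)
K  = x ^ 4 ⊗ (const 1 ⊕ ⊖ (const 3 ⊗ z′)) ⊕ x ^ 2 ⊗ y ⊗ (const 3 ⊕ z′)
   ⊕ ⊖ (y ^ 2 ⊗ (const 1 ⊕ ⊖ (const 3 ⊗ z))) ⊕ ⊖ (q ⊗ x ⊗ y ^ 4 ⊗ (const 3 ⊕ z))

M : PS → PS
M t = const 1 ⊕ ⊖ (const 11 ⊗ t) ⊕ ⊖ (t ⊗ t)

D-0 : D 0 ≋ + 1
D-0 = ≋-trans (≋-reflexive (≡.trans (⊕-at _ _ 0) (cong₂ ℤ._+_ (scalar-zero (+ 1)) (⊖-at k 0)))) (+-≋ {+ 1} ≋-refl (neg-≋ k-0))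
  where
  k-0 : k 0 ≋ + 0
  k-0 = ≋-trans (at (R.*-assoc q x (y ^ 2)) 0) (≋-reflexive (⊗-at q _ 0))

-- The modular relation solved for y/x² = (1+k)/(1-k). It makes k a rational parameter: by the next
-- two lemmas R(q)⁵ = k((1-k)/(1+k))² and R(q²)⁵ = k²(1+k)/(1-k).
yD : y ⊗ D ≈ x ^ 2 ⊗ S
yD = begin
  y ⊗ D
    ≈⟨ solve 3 (λ q x y → y :* (con 1 :- q :* x :* y :^ 2) := y :- q :* x :* y :^ 3) ≈-refl q x y ⟩
  y ⊕ ⊖ (q ⊗ x ⊗ y ^ 3)
    ≈⟨ ⊕-cong (≈-sym modular) ≈-refl ⟩
  x ^ 2 ⊕ q ⊗ x ⊗ y ^ 3 ⊕ q ⊗ x ^ 3 ⊗ y ^ 2 ⊕ ⊖ (q ⊗ x ⊗ y ^ 3)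
    ≈⟨ solve 3 (λ q x y → x :^ 2 :+ q :* x :* y :^ 3 :+ q :* x :^ 3 :* y :^ 2 :- q :* x :* y :^ 3
         := x :^ 2 :* (con 1 :+ q :* x :* y :^ 2)) ≈-refl q x y ⟩
  x ^ 2 ⊗ S ∎

zS² : z ⊗ S ^ 2 ≈ k ⊗ D ^ 2
zS² = begin
  q ⊗ x ^ 5 ⊗ S ^ 2
    ≈⟨ solve 3 (λ q x S → q :* x :^ 5 :* S :^ 2 := q :* x :* (x :^ 2 :* S) :^ 2) ≈-refl q x S ⟩
  q ⊗ x ⊗ (x ^ 2 ⊗ S) ^ 2
    ≈⟨ ⊗-cong ≈-refl (^-congˡ 2 yD) ⟨
  q ⊗ x ⊗ (y ⊗ D) ^ 2
    ≈⟨ solve 4 (λ q x y D → q :* x :* (y :* D) :^ 2 := q :* x :* y :^ 2 :* D :^ 2) ≈-refl q x y D ⟩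
  k ⊗ D ^ 2 ∎

z′D : z′ ⊗ D ≈ k ^ 2 ⊗ S
z′D = begin
  q ^ 2 ⊗ y ^ 5 ⊗ D
    ≈⟨ solve 3 (λ q y D → q :^ 2 :* y :^ 5 :* D := q :^ 2 :* y :^ 4 :* (y :* D)) ≈-refl q y D ⟩
  q ^ 2 ⊗ y ^ 4 ⊗ (y ⊗ D)
    ≈⟨ ⊗-cong ≈-refl yD ⟩
  q ^ 2 ⊗ y ^ 4 ⊗ (x ^ 2 ⊗ S)
    ≈⟨ solve 4 (λ q x y S → q :^ 2 :* y :^ 4 :* (x :^ 2 :* S) := (q :* x :* y :^ 2) :^ 2 :* S) ≈-refl q x y S ⟩
  k ^ 2 ⊗ S ∎

M-z : S ^ 4 ⊗ M z ≈ N ^ 2 ⊗ N₂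
M-z = begin
  S ^ 4 ⊗ M z
    ≈⟨ solve 2 (λ S z → S :^ 4 :* (con 1 :- con 11 :* z :- z :* z) := S :^ 4 :- con 11 :* S :^ 2 :* (z :* S :^ 2) :- (z :* S :^ 2) :^ 2) ≈-refl S z ⟩
  S ^ 4 ⊕ ⊖ (const 11 ⊗ S ^ 2 ⊗ (z ⊗ S ^ 2)) ⊕ ⊖ ((z ⊗ S ^ 2) ^ 2)
    ≈⟨ ⊕-cong (⊕-cong ≈-refl (⊖-cong (⊗-cong ≈-refl zS²))) (⊖-cong (^-congˡ 2 zS²)) ⟩
  S ^ 4 ⊕ ⊖ (const 11 ⊗ S ^ 2 ⊗ (k ⊗ D ^ 2)) ⊕ ⊖ ((k ⊗ D ^ 2) ^ 2)
    ≈⟨ solve 1 (λ k → let D = con 1 :- k; S = con 1 :+ k in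
         S :^ 4 :- con 11 :* S :^ 2 :* (k :* D :^ 2) :- (k :* D :^ 2) :^ 2
         := (con 1 :- con 4 :* k :- k :^ 2) :^ 2 :* (con 1 :+ k :- k :^ 2)) ≈-refl k ⟩
  N ^ 2 ⊗ N₂ ∎

M-z′ : D ^ 2 ⊗ M z′ ≈ N ⊗ N₂ ^ 2
M-z′ = begin
  D ^ 2 ⊗ M z′
    ≈⟨ solve 2 (λ D z → D :^ 2 :* (con 1 :- con 11 :* z :- z :* z) := D :^ 2 :- con 11 :* D :* (z :* D) :- (z :* D) :^ 2) ≈-refl D z′ ⟩
  D ^ 2 ⊕ ⊖ (const 11 ⊗ D ⊗ (z′ ⊗ D)) ⊕ ⊖ ((z′ ⊗ D) ^ 2)
    ≈⟨ ⊕-cong (⊕-cong ≈-refl (⊖-cong (⊗-cong ≈-refl z′D))) (⊖-cong (^-congˡ 2 z′D)) ⟩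
  D ^ 2 ⊕ ⊖ (const 11 ⊗ D ⊗ (k ^ 2 ⊗ S)) ⊕ ⊖ ((k ^ 2 ⊗ S) ^ 2)
    ≈⟨ solve 1 (λ k → let D = con 1 :- k; S = con 1 :+ k in
         D :^ 2 :- con 11 :* D :* (k :^ 2 :* S) :- (k :^ 2 :* S) :^ 2
         := (con 1 :- con 4 :* k :- k :^ 2) :* (con 1 :+ k :- k :^ 2) :^ 2) ≈-refl k ⟩
  N ⊗ N₂ ^ 2 ∎

D²G : D ^ 2 ⊗ G ≈ x ^ 4 ⊗ N
D²G = begin
  D ^ 2 ⊗ G
    ≈⟨ solve 3 (λ D x y → D :^ 2 :* (x :^ 4 :+ x :^ 2 :* y :- y :^ 2)
         := x :^ 4 :* D :^ 2 :+ x :^ 2 :* D :* (y :* D) :- (y :* D) :^ 2) ≈-refl D x y ⟩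
  x ^ 4 ⊗ D ^ 2 ⊕ x ^ 2 ⊗ D ⊗ (y ⊗ D) ⊕ ⊖ ((y ⊗ D) ^ 2)
    ≈⟨ ⊕-cong (⊕-cong ≈-refl (⊗-cong ≈-refl yD)) (⊖-cong (^-congˡ 2 yD)) ⟩
  x ^ 4 ⊗ D ^ 2 ⊕ x ^ 2 ⊗ D ⊗ (x ^ 2 ⊗ S) ⊕ ⊖ ((x ^ 2 ⊗ S) ^ 2)
    ≈⟨ solve 2 (λ x k → let D = con 1 :- k; S = con 1 :+ k in
         x :^ 4 :* D :^ 2 :+ x :^ 2 :* D :* (x :^ 2 :* S) :- (x :^ 2 :* S) :^ 2
         := x :^ 4 :* (con 1 :- con 4 :* k :- k :^ 2)) ≈-refl x k ⟩
  x ^ 4 ⊗ N ∎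

-- Up to powers of x, D and S, the series G, M z, M z′ are N, N² N₂ and N N₂². A power of N is a
-- product of powers of the other two only if its exponent is a multiple of 3; the first case is N³
-- · N N₂² = (N² N₂)².
G³ : x ^ 4 ⊗ G ^ 3 ⊗ M z′ ≈ y ^ 8 ⊗ M z ^ 2
G³ = ⊗-cancelˡ (D ^ 8) (^-0 8 D-0) (begin
  D ^ 8 ⊗ (x ^ 4 ⊗ G ^ 3 ⊗ M z′)
    ≈⟨ solve 4 (λ D x G M → D :^ 8 :* (x :^ 4 :* G :^ 3 :* M) := x :^ 4 :* (D :^ 2 :* G) :^ 3 :* (D :^ 2 :* M)) ≈-refl D x G (M z′) ⟩
  x ^ 4 ⊗ (D ^ 2 ⊗ G) ^ 3 ⊗ (D ^ 2 ⊗ M z′)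
    ≈⟨ ⊗-cong (⊗-cong ≈-refl (^-congˡ 3 D²G)) M-z′ ⟩
  x ^ 4 ⊗ (x ^ 4 ⊗ N) ^ 3 ⊗ (N ⊗ N₂ ^ 2)
    ≈⟨ solve 3 (λ x N N₂ → x :^ 4 :* (x :^ 4 :* N) :^ 3 :* (N :* N₂ :^ 2) := x :^ 16 :* (N :^ 2 :* N₂) :^ 2) ≈-refl x N N₂ ⟩
  x ^ 16 ⊗ (N ^ 2 ⊗ N₂) ^ 2
    ≈⟨ ⊗-cong ≈-refl (^-congˡ 2 M-z) ⟨
  x ^ 16 ⊗ (S ^ 4 ⊗ M z) ^ 2
    ≈⟨ solve 3 (λ x S M → x :^ 16 :* (S :^ 4 :* M) :^ 2 := (x :^ 2 :* S) :^ 8 :* M :^ 2) ≈-refl x S (M z) ⟩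
  (x ^ 2 ⊗ S) ^ 8 ⊗ M z ^ 2
    ≈⟨ ⊗-cong (^-congˡ 8 yD) ≈-refl ⟨
  (y ⊗ D) ^ 8 ⊗ M z ^ 2
    ≈⟨ solve 3 (λ y D M → (y :* D) :^ 8 :* M := D :^ 8 :* (y :^ 8 :* M)) ≈-refl y D (M z ^ 2) ⟩
  D ^ 8 ⊗ (y ^ 8 ⊗ M z ^ 2) ∎)

5D²K : const 5 ⊗ (D ^ 2 ⊗ K) ≈ const 15 ⊗ (x ^ 4 ⊗ N ^ 2)
5D²K = begin
  const 5 ⊗ (D ^ 2 ⊗ K)
    ≈⟨ ⊗-cong ≈-refl (solve 6 (λ D x y z z′ q →
         D :^ 2 :* (x :^ 4 :* (con 1 :- con 3 :* z′) :+ x :^ 2 :* y :* (con 3 :+ z′) :- y :^ 2 :* (con 1 :- con 3 :* z) :- q :* x :* y :^ 4 :* (con 3 :+ z))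
         := x :^ 4 :* D :* (D :- con 3 :* (z′ :* D)) :+ x :^ 2 :* (y :* D) :* (con 3 :* D :+ z′ :* D)
         :- (y :* D) :^ 2 :* (con 1 :- con 3 :* z) :- q :* x :* y :^ 2 :* (y :* D) :^ 2 :* (con 3 :+ z)) ≈-refl D x y z z′ q) ⟩
  const 5 ⊗ (x ^ 4 ⊗ D ⊗ (D ⊕ ⊖ (const 3 ⊗ (z′ ⊗ D))) ⊕ x ^ 2 ⊗ (y ⊗ D) ⊗ (const 3 ⊗ D ⊕ z′ ⊗ D)
    ⊕ ⊖ ((y ⊗ D) ^ 2 ⊗ (const 1 ⊕ ⊖ (const 3 ⊗ z))) ⊕ ⊖ (k ⊗ (y ⊗ D) ^ 2 ⊗ (const 3 ⊕ z)))
    ≈⟨ ⊗-cong ≈-refl (⊕-cong (⊕-cong (⊕-cong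
         (⊗-cong ≈-refl (⊕-cong ≈-refl (⊖-cong (⊗-cong ≈-refl z′D))))
         (⊗-cong (⊗-cong ≈-refl yD) (⊕-cong ≈-refl z′D)))
         (⊖-cong (⊗-cong (^-congˡ 2 yD) ≈-refl)))
         (⊖-cong (⊗-cong (⊗-cong ≈-refl (^-congˡ 2 yD)) ≈-refl))) ⟩
  const 5 ⊗ (x ^ 4 ⊗ D ⊗ (D ⊕ ⊖ (const 3 ⊗ (k ^ 2 ⊗ S))) ⊕ x ^ 2 ⊗ (x ^ 2 ⊗ S) ⊗ (const 3 ⊗ D ⊕ k ^ 2 ⊗ S)
    ⊕ ⊖ ((x ^ 2 ⊗ S) ^ 2 ⊗ (const 1 ⊕ ⊖ (const 3 ⊗ z))) ⊕ ⊖ (k ⊗ (x ^ 2 ⊗ S) ^ 2 ⊗ (const 3 ⊕ z)))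
    ≈⟨ solve 5 (λ D S x k z →
         con 5 :* (x :^ 4 :* D :* (D :- con 3 :* (k :^ 2 :* S)) :+ x :^ 2 :* (x :^ 2 :* S) :* (con 3 :* D :+ k :^ 2 :* S)
           :- (x :^ 2 :* S) :^ 2 :* (con 1 :- con 3 :* z) :- k :* (x :^ 2 :* S) :^ 2 :* (con 3 :+ z))
         := con 5 :* (x :^ 4 :* (D :* (D :- con 3 :* (k :^ 2 :* S)) :+ S :* (con 3 :* D :+ k :^ 2 :* S)
              :- S :^ 2 :- con 3 :* k :* S :^ 2 :+ (con 3 :- k) :* (z :* S :^ 2)))) ≈-refl D S x k z ⟩
  const 5 ⊗ (x ^ 4 ⊗ (D ⊗ (D ⊕ ⊖ (const 3 ⊗ (k ^ 2 ⊗ S))) ⊕ S ⊗ (const 3 ⊗ D ⊕ k ^ 2 ⊗ S)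
    ⊕ ⊖ (S ^ 2) ⊕ ⊖ (const 3 ⊗ k ⊗ S ^ 2) ⊕ (const 3 ⊕ ⊖ k) ⊗ (z ⊗ S ^ 2)))
    ≈⟨ ⊗-cong ≈-refl (⊗-cong ≈-refl (⊕-cong ≈-refl (⊗-cong ≈-refl zS²))) ⟩
  const 5 ⊗ (x ^ 4 ⊗ (D ⊗ (D ⊕ ⊖ (const 3 ⊗ (k ^ 2 ⊗ S))) ⊕ S ⊗ (const 3 ⊗ D ⊕ k ^ 2 ⊗ S)
    ⊕ ⊖ (S ^ 2) ⊕ ⊖ (const 3 ⊗ k ⊗ S ^ 2) ⊕ (const 3 ⊕ ⊖ k) ⊗ (k ⊗ D ^ 2)))
    ≈⟨ solve 2 (λ x k → let D = con 1 :- k; S = con 1 :+ k in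
         con 5 :* (x :^ 4 :* (D :* (D :- con 3 :* (k :^ 2 :* S)) :+ S :* (con 3 :* D :+ k :^ 2 :* S)
              :- S :^ 2 :- con 3 :* k :* S :^ 2 :+ (con 3 :- k) :* (k :* D :^ 2)))
         := con 15 :* (x :^ 4 :* (con 1 :- con 4 :* k :- k :^ 2) :^ 2)) ≈-refl x k ⟩
  const 15 ⊗ (x ^ 4 ⊗ N ^ 2) ∎

-- The second extraction produces K, which is no eta quotient by itself. Multiplied by G, which
-- `g₄-eta` controls, it becomes M z, known from `E1λ₁`.
5KG : const 5 ⊗ (K ⊗ G) ≈ const 15 ⊗ (y ^ 4 ⊗ M z)
5KG = ⊗-cancelˡ (D ^ 4) (^-0 4 D-0) (begin
  D ^ 4 ⊗ (const 5 ⊗ (K ⊗ G))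
    ≈⟨ solve 3 (λ D K G → D :^ 4 :* (con 5 :* (K :* G)) := con 5 :* (D :^ 2 :* K) :* (D :^ 2 :* G)) ≈-refl D K G ⟩
  const 5 ⊗ (D ^ 2 ⊗ K) ⊗ (D ^ 2 ⊗ G)
    ≈⟨ ⊗-cong 5D²K D²G ⟩
  const 15 ⊗ (x ^ 4 ⊗ N ^ 2) ⊗ (x ^ 4 ⊗ N)
    -- N and N₂ differ by 5k, so under the factor 15 one N may be replaced by N₂ to form the product
    -- in `M-z`.
    ≈⟨ solve 2 (λ x k → let N = con 1 :- con 4 :* k :- k :^ 2 in
         con 15 :* (x :^ 4 :* N :^ 2) :* (x :^ 4 :* N) := con 15 :* x :^ 8 :* (N :^ 2 :* (con 1 :+ k :- k :^ 2))) ≈-refl x k ⟩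
  const 15 ⊗ x ^ 8 ⊗ (N ^ 2 ⊗ N₂)
    ≈⟨ ⊗-cong ≈-refl M-z ⟨
  const 15 ⊗ x ^ 8 ⊗ (S ^ 4 ⊗ M z)
    ≈⟨ solve 3 (λ x S M → con 15 :* x :^ 8 :* (S :^ 4 :* M) := con 15 :* ((x :^ 2 :* S) :^ 4 :* M)) ≈-refl x S (M z) ⟩
  const 15 ⊗ ((x ^ 2 ⊗ S) ^ 4 ⊗ M z)
    ≈⟨ ⊗-cong ≈-refl (⊗-cong (^-congˡ 4 yD) ≈-refl) ⟨
  const 15 ⊗ ((y ⊗ D) ^ 4 ⊗ M z)
    ≈⟨ solve 3 (λ y D M → con 15 :* ((y :* D) :^ 4 :* M) := D :^ 4 :* (con 15 :* (y :^ 4 :* M))) ≈-refl y D (M z) ⟩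
  D ^ 4 ⊗ (const 15 ⊗ (y ^ 4 ⊗ M z)) ∎)

-- 17 inverts 3 modulo 25, and the cofactor x² + xy + y² of x - y has constant term 3.
cube-root : ∀ {f g} → f 0 ≋ + 1 → g 0 ≋ + 1 → f ^ 3 ≈ g ^ 3 → f ≈ g
cube-root {f} {g} f0 g0 p = begin
  f                    ≈⟨ solve 2 (λ f g → f := f :- g :+ g) ≈-refl f g ⟩
  f ⊕ ⊖ g ⊕ g          ≈⟨ ⊕-cong (⊗-cancelˡ u u-0 (begin
    u ⊗ (f ⊕ ⊖ g)
      ≈⟨ solve 2 (λ f g → con 17 :* (f :* f :+ f :* g :+ g :* g) :* (f :- g) := con 17 :* (f :^ 3 :- g :^ 3)) ≈-refl f g ⟩
    const 17 ⊗ (f ^ 3 ⊕ ⊖ (g ^ 3))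
      ≈⟨ ⊗-cong ≈-refl (⊕-cong p ≈-refl) ⟩
    const 17 ⊗ (g ^ 3 ⊕ ⊖ (g ^ 3))
      ≈⟨ solve 2 (λ g u → con 17 :* (g :- g) := u :* con 0) ≈-refl (g ^ 3) u ⟩
    u ⊗ const 0 ∎)) ≈-refl ⟩
  const 0 ⊕ g          ≈⟨ R.+-identityˡ g ⟩
  g                    ∎
  where
  u = const 17 ⊗ (f ⊗ f ⊕ f ⊗ g ⊕ g ⊗ g)
  u-0 : u 0 ≋ + 1
  u-0 = ≋-trans (≋-reflexive (scalar-⊗-at (+ 17) _ 0)) (≋-trans (*-≋ {+ 17} ≋-refl
    (≋-trans (≋-reflexive (≡.trans (⊕-at _ _ 0) (cong (ℤ._+ (g ⊗ g) 0) (⊕-at _ _ 0))))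
      (+-≋ (+-≋ (⊗-0 f0 f0) (⊗-0 f0 g0)) (⊗-0 g0 g0)))) (≋-sym (%-≋ 51)))

-- The congruence

E1² E1³ E1⁴ E1⁵ E2² E2³ E2⁴ E2⁵ : PS
E1² = E1 ⊗ E1
E1³ = E1 ⊗ E1 ⊗ E1
E1⁴ = E1 ⊗ E1 ⊗ (E1 ⊗ E1)
E1⁵ = E1 ⊗ E1 ⊗ (E1 ⊗ E1) ⊗ E1
E2² = E2 ⊗ E2
E2³ = E2 ⊗ E2 ⊗ E2
E2⁴ = E2 ⊗ E2 ⊗ (E2 ⊗ E2)
E2⁵ = E2 ⊗ E2 ⊗ (E2 ⊗ E2) ⊗ E2

λ₁ λ₂ : PS
λ₁ = const 1 ⊕ ⊖ (const 5 ⊗ L)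
λ₂ = const 1 ⊕ ⊖ (const 5 ⊗ δ L)

δλ₁ : δ λ₁ ≈ λ₂
δλ₁ = ≈-trans (spread-⊕ 1 0 _ _) (⊕-cong (spread-scalar 1 (+ 1)) (≈-trans (spread-⊖ 1 _) (⊖-cong (spread-scalar-⊗ 1 0 (+ 5) L))))

E1⁵≈ : E1⁵ ≈ e ⊗ λ₁
E1⁵≈ = ≈-trans (solve 1 (λ f → f :* f :* (f :* f) :* f := f :^ 5) ≈-refl E1) E1^5≈

E2⁵≈ : E2⁵ ≈ e′ ⊗ λ₂
E2⁵≈ = begin
  E2⁵                ≈⟨ solve 1 (λ f → f :* f :* (f :* f) :* f := f :^ 5) ≈-refl E2 ⟩
  E2 ^ 5              ≈⟨ ^-congˡ 5 E2≈δE1 ⟩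
  δ E1 ^ 5            ≈⟨ spread-^ 1 E1 5 ⟨
  δ (E1 ^ 5)          ≈⟨ spread-cong 1 0 E1^5≈ ⟩
  δ (e ⊗ λ₁)          ≈⟨ spread-⊗ 1 e λ₁ ⟩
  e′ ⊗ δ λ₁           ≈⟨ ⊗-cong ≈-refl δλ₁ ⟩
  e′ ⊗ λ₂             ∎

U₀-λ₁ : U 0 λ₁ ≈ λ₁
U₀-λ₁ = ≈-trans (U-⊕ 0 _ _) (⊕-cong (≈-trans (U-cong 0 (≈-sym (spread-scalar 4 (+ 1)))) (U₀-σ (const 1)))
  (≈-trans (U-⊖ 0 _) (⊖-cong (≈-trans (U-scalar⊗ 0 (+ 5) L) (⊗-cong ≈-refl U₀-L)))))

U₀-λ₂ : U 0 λ₂ ≈ λ₂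
U₀-λ₂ = begin
  U 0 λ₂      ≈⟨ U-cong 0 δλ₁ ⟨
  U 0 (δ λ₁)  ≈⟨ U₀-δ λ₁ ⟩
  δ (U 0 λ₁)  ≈⟨ spread-cong 1 0 U₀-λ₁ ⟩
  δ λ₁        ≈⟨ δλ₁ ⟩
  λ₂          ∎

-- As λ₁ = E1⁵/e, this is E1⁶/e = a⁵(1 - 11z - z²), the classical 1/R⁵ - 11 - R⁵ = E1⁶/(q e⁶) modulo
-- 25. Class 0 of E1⁵ = e λ₁ yields it because `U 0` fixes λ₁ and turns e into E1.
E1λ₁ : E1 ⊗ λ₁ ≈ a ^ 5 ⊗ M z
E1λ₁ = begin
  E1 ⊗ λ₁          ≈⟨ ⊗-cong ≈-refl U₀-λ₁ ⟨
  E1 ⊗ U 0 λ₁      ≈⟨ U-σ⊗ 0 E1 λ₁ ⟨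
  U 0 (e ⊗ λ₁)     ≈⟨ U-cong 0 E1⁵≈ ⟨
  U 0 E1⁵         ≈⟨ ≈₀ dissect-E1⁵ ⟩
  a ^ 5 ⊗ M z      ∎

E2λ₂ : E2 ⊗ λ₂ ≈ a′ ^ 5 ⊗ M z′
E2λ₂ = begin
  E2 ⊗ λ₂          ≈⟨ ⊗-cong ≈-refl U₀-λ₂ ⟨
  E2 ⊗ U 0 λ₂      ≈⟨ U-σ⊗ 0 E2 λ₂ ⟨
  U 0 (σ E2 ⊗ λ₂)  ≈⟨ U-cong 0 (≈-trans (⊗-cong σE2≈e′ ≈-refl) (≈-sym E2⁵≈)) ⟩
  U 0 E2⁵         ≈⟨ ≈₀ dissect-E2⁵ ⟩
  a′ ^ 5 ⊗ M z′    ∎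

ρ : Vec PS 5
ρ = q ∷ a ∷ x ∷ a′ ∷ y ∷ []

q̂ â x̂ â′ ŷ ẑ ẑ′ : Polynomial 5
q̂ = var (# 0)
â = var (# 1)
x̂ = var (# 2)
â′ = var (# 3)
ŷ = var (# 4)
ẑ = q̂ :* x̂ :^ 5
ẑ′ = q̂ :^ 2 :* ŷ :^ 5

M̂ : Polynomial 5 → Polynomial 5
M̂ t = con 1 :- con 11 :* t :- t :* t

Ĝ : Polynomial 5
Ĝ = x̂ :^ 4 :+ x̂ :^ 2 :* ŷ :- ŷ :^ 2

convolve₅ : Parts (Polynomial 5) → Parts (Polynomial 5) → Parts (Polynomial 5)
convolve₅ = convolve _:+_ _:*_ q̂

g g₄ : PS
g  = E1² ⊗ E2
g₄ = a ^ 2 ⊗ a′ ⊗ G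

g-parts h-parts : Parts (Polynomial 5)
g-parts = convolve₅ (E²-parts q̂ â x̂) (δ-parts E-parts q̂ â′ ŷ)
h-parts = convolve₅ (E³-parts q̂ â x̂) (δ-parts E³-parts q̂ â′ ŷ)

U⁵-g : U⁵ g ≈⁵ eval ρ g-parts
U⁵-g = U⁵-⊗ dissect-E1² dissect-E2

U⁵-h : U⁵ (E1³ ⊗ E2³) ≈⁵ eval ρ h-parts
U⁵-h = U⁵-⊗ dissect-E1³ dissect-E2³

U₄-g : U 4 g ≈ g₄
U₄-g = ≈-trans (≈₄ U⁵-g) (prove ρ (Parts.p₄ g-parts) (â :^ 2 :* â′ :* Ĝ) ≈-refl)

U₄-gE1⁵ : U 4 (g ⊗ E1⁵) ≈ a ^ 5 ⊗ M z ⊗ (g₄ ⊕ const 10 ⊗ (a ^ 2 ⊗ a′ ⊗ x ^ 2 ⊗ y))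
U₄-gE1⁵ = ≈-trans (≈₄ (U⁵-⊗ U⁵-g dissect-E1⁵))
  (prove ρ (Parts.p₄ (convolve₅ g-parts (E⁵-parts q̂ â x̂)))
    (â :^ 5 :* M̂ ẑ :* (â :^ 2 :* â′ :* Ĝ :+ con 10 :* (â :^ 2 :* â′ :* x̂ :^ 2 :* ŷ))) ≈-refl)

-- E1³ has only the classes 0, 1, 3 and E2³ only 0, 2, 1. The residue 4 arises only as 3 + 1, and
-- both of these classes are multiples of 5.
U₄-h : U 4 (E1³ ⊗ E2³) ≈ const 0
U₄-h = ≈-trans (≈₄ U⁵-h) (prove ρ (Parts.p₄ h-parts) (con 0) ≈-refl)

-- Class 0 of E1⁵ meets the vanishing class 4 of E1³ E2³, and the other classes of E1⁵ are multiples
-- of 5; hence the factor 5. The last bracket here and the one in `U₄-hE2⁵` add up to K.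
U₄-hE1⁵ : U 4 (E1³ ⊗ E2³ ⊗ E1⁵) ≈ a ^ 3 ⊗ a′ ^ 3 ⊗ (const 5 ⊗ (a ^ 5 ⊗ M z))
  ⊗ (x ^ 4 ⊗ (const 1 ⊕ ⊖ (const 3 ⊗ z′)) ⊕ x ^ 2 ⊗ y ⊗ (const 3 ⊕ z′))
U₄-hE1⁵ = ≈-trans (≈₄ (U⁵-⊗ U⁵-h dissect-E1⁵))
  (prove ρ (Parts.p₄ (convolve₅ h-parts (E⁵-parts q̂ â x̂)))
    (â :^ 3 :* â′ :^ 3 :* (con 5 :* (â :^ 5 :* M̂ ẑ)) :* (x̂ :^ 4 :* (con 1 :- con 3 :* ẑ′) :+ x̂ :^ 2 :* ŷ :* (con 3 :+ ẑ′))) ≈-refl)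

U₄-hE2⁵ : U 4 (E1³ ⊗ E2³ ⊗ E2⁵) ≈ a ^ 3 ⊗ a′ ^ 3 ⊗ (const 5 ⊗ (a′ ^ 5 ⊗ M z′))
  ⊗ (⊖ (y ^ 2 ⊗ (const 1 ⊕ ⊖ (const 3 ⊗ z))) ⊕ ⊖ (q ⊗ x ⊗ y ^ 4 ⊗ (const 3 ⊕ z)))
U₄-hE2⁵ = ≈-trans (≈₄ (U⁵-⊗ U⁵-h dissect-E2⁵))
  (prove ρ (Parts.p₄ (convolve₅ h-parts (δ-parts E⁵-parts q̂ â′ ŷ)))
    (â :^ 3 :* â′ :^ 3 :* (con 5 :* (â′ :^ 5 :* M̂ ẑ′)) :*
      (:- (ŷ :^ 2 :* (con 1 :- con 3 :* ẑ)) :- q̂ :* x̂ :* ŷ :^ 4 :* (con 3 :+ ẑ))) ≈-refl)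

-- The inverse 1 + 5L is written linearly in λ₁ so that e λ₁ can be exchanged for E1⁵.
λ₁⁻¹ : λ₁ ⊗ (const 2 ⊕ ⊖ λ₁) ≈ const 1
λ₁⁻¹ = solve 1 (λ l → (con 1 :- con 5 :* l) :* (con 2 :- (con 1 :- con 5 :* l)) := con 1) ≈-refl L

5λ₁ : ∀ f → const 5 ⊗ (f ⊗ λ₁) ≈ const 5 ⊗ f
5λ₁ f = solve 2 (λ f l → con 5 :* (f :* (con 1 :- con 5 :* l)) := con 5 :* f) ≈-refl f L

5λ₂ : ∀ f → const 5 ⊗ (f ⊗ λ₂) ≈ const 5 ⊗ f
5λ₂ f = solve 2 (λ f l → con 5 :* (f :* (con 1 :- con 5 :* l)) := con 5 :* f) ≈-refl f (δ L)

e-0 : e 0 ≋ + 1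
e-0 = ≋-refl

e′-0 : e′ 0 ≋ + 1
e′-0 = ≋-refl

-- Cubing makes `G³` applicable: six factors e supply the needed x⁴ through a x = e, and E2⁶ = e′ E2
-- λ₂ supplies M z′. The resulting M z² is absorbed by E1⁶ = e E1 λ₁, used twice.
g₄-eta : g₄ ⊗ E2² ⊗ e ^ 2 ≈ E1⁴ ⊗ e′ ^ 3
g₄-eta = cube-root left-0 right-0 (begin
  (g₄ ⊗ E2² ⊗ e ^ 2) ^ 3
    ≈⟨ solve 5 (λ a b G f e → (a :^ 2 :* b :* G :* (f :* f) :* e :^ 2) :^ 3
         := a :^ 6 :* b :^ 3 :* G :^ 3 :* (f :* (f :* f :* (f :* f) :* f)) :* e :^ 6) ≈-refl a a′ G E2 e ⟩
  a ^ 6 ⊗ a′ ^ 3 ⊗ G ^ 3 ⊗ (E2 ⊗ E2⁵) ⊗ e ^ 6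
    ≈⟨ ⊗-cong (⊗-cong ≈-refl (≈-trans (⊗-cong ≈-refl E2⁵≈) (swap E2 e′ λ₂))) (e⁶) ⟩
  a ^ 6 ⊗ a′ ^ 3 ⊗ G ^ 3 ⊗ (e′ ⊗ (E2 ⊗ λ₂)) ⊗ ((a ⊗ x) ^ 4 ⊗ e ^ 2)
    ≈⟨ ⊗-cong (⊗-cong ≈-refl (⊗-cong ≈-refl E2λ₂)) ≈-refl ⟩
  a ^ 6 ⊗ a′ ^ 3 ⊗ G ^ 3 ⊗ (e′ ⊗ (a′ ^ 5 ⊗ M z′)) ⊗ ((a ⊗ x) ^ 4 ⊗ e ^ 2)
    ≈⟨ solve 7 (λ a b G f M x e → a :^ 6 :* b :^ 3 :* G :^ 3 :* (f :* (b :^ 5 :* M)) :* ((a :* x) :^ 4 :* e :^ 2)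
         := a :^ 10 :* b :^ 8 :* e :^ 2 :* f :* (x :^ 4 :* G :^ 3 :* M)) ≈-refl a a′ G e′ (M z′) x e ⟩
  a ^ 10 ⊗ a′ ^ 8 ⊗ e ^ 2 ⊗ e′ ⊗ (x ^ 4 ⊗ G ^ 3 ⊗ M z′)
    ≈⟨ ⊗-cong ≈-refl G³ ⟩
  a ^ 10 ⊗ a′ ^ 8 ⊗ e ^ 2 ⊗ e′ ⊗ (y ^ 8 ⊗ M z ^ 2)
    ≈⟨ solve 6 (λ a b e f y M → a :^ 10 :* b :^ 8 :* e :^ 2 :* f :* (y :^ 8 :* M :^ 2)
         := (e :* (a :^ 5 :* M)) :^ 2 :* ((b :* y) :^ 8 :* f)) ≈-refl a a′ e e′ y (M z) ⟩
  (e ⊗ (a ^ 5 ⊗ M z)) ^ 2 ⊗ ((a′ ⊗ y) ^ 8 ⊗ e′)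
    ≈⟨ ⊗-cong (^-congˡ 2 (≈-trans (⊗-cong ≈-refl (≈-sym E1λ₁)) (≈-trans (≈-sym (swap E1 e λ₁)) (⊗-cong ≈-refl (≈-sym E1⁵≈)))))
              (⊗-cong (^-congˡ 8 a′y≈e′) ≈-refl) ⟩
  (E1 ⊗ E1⁵) ^ 2 ⊗ (e′ ^ 8 ⊗ e′)
    ≈⟨ solve 2 (λ f e → (f :* (f :* f :* (f :* f) :* f)) :^ 2 :* (e :^ 8 :* e) := (f :* f :* (f :* f) :* e :^ 3) :^ 3) ≈-refl E1 e′ ⟩
  (E1⁴ ⊗ e′ ^ 3) ^ 3 ∎)
  where
  swap : ∀ f g h → f ⊗ (g ⊗ h) ≈ g ⊗ (f ⊗ h)
  swap = solve 3 (λ f g h → f :* (g :* h) := g :* (f :* h)) ≈-refl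
  e⁶ : e ^ 6 ≈ (a ⊗ x) ^ 4 ⊗ e ^ 2
  e⁶ = ≈-trans (solve 1 (λ e → e :^ 6 := e :^ 4 :* e :^ 2) ≈-refl e) (⊗-cong (^-congˡ 4 (≈-sym ax≈e)) ≈-refl)
  g₄-0 : g₄ 0 ≋ + 1
  -- The constant term of g₄ is the coefficient of q⁴ in E1² E2, evaluated through `_⊛_`.
  g₄-0 = ≋-trans (≋-sym (at U₄-g 0)) (≋-trans (≋-sym (at (≈-trans (⊛≈⊗ _ _) (⊗-cong (⊛≈⊗ E1 E1) ≈-refl)) 4)) (≋-refl {+ 1}))
  left-0 : (g₄ ⊗ E2² ⊗ e ^ 2) 0 ≋ + 1
  left-0 = ⊗-0 (⊗-0 g₄-0 (⊗-0 E2-0 E2-0)) (^-0 2 e-0)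
  right-0 : (E1⁴ ⊗ e′ ^ 3) 0 ≋ + 1
  right-0 = ⊗-0 (⊗-0 (⊗-0 E1-0 E1-0) (⊗-0 E1-0 E1-0)) (^-0 3 e′-0)

U-e⊗-cong : ∀ {i} {i<5 : True (i ℕ.<? 5)} {f u} → U i f ≈ u → U i (e ⊗ f) ≈ E1 ⊗ u
U-e⊗-cong {i} {i<5} {f} p = ≈-trans (U-σ⊗ i {i<5} E1 f) (⊗-cong ≈-refl p)

U-e′⊗-cong : ∀ {i} {i<5 : True (i ℕ.<? 5)} {f u} → U i f ≈ u → U i (e′ ⊗ f) ≈ E2 ⊗ u
U-e′⊗-cong {i} {i<5} {f} p = ≈-trans (U-cong i (⊗-cong (≈-sym σE2≈e′) ≈-refl)) (≈-trans (U-σ⊗ i {i<5} E2 f) (⊗-cong ≈-refl p))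

U-⊕-cong : ∀ {i f g u v} → U i f ≈ u → U i g ≈ v → U i (f ⊕ g) ≈ u ⊕ v
U-⊕-cong {i} p r = ≈-trans (U-⊕ i _ _) (⊕-cong p r)

U-⊖-cong : ∀ {i f u} → U i f ≈ u → U i (⊖ f) ≈ ⊖ u
U-⊖-cong {i} p = ≈-trans (U-⊖ i _) (⊖-cong p)

U-scalar⊗-cong : ∀ {i k f u} → U i f ≈ u → U i (scalar k ⊗ f) ≈ scalar k ⊗ u
U-scalar⊗-cong {i} p = ≈-trans (U-scalar⊗ i _ _) (⊗-cong ≈-refl p)

-- The two extractions of class 4

module Congruence (c : PS) (c⊗E1³ : c ⊗ E1³ ≈ E2) where

  C₁ C₂ : PS
  C₁ = U 4 c
  C₂ = U 4 C₁

  ec : e ⊗ c ≈ const 2 ⊗ g ⊕ ⊖ (g ⊗ λ₁)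
  ec = begin
    e ⊗ c                                  ≈⟨ ≈-trans (⊗-cong ≈-refl λ₁⁻¹) (R.*-identityʳ _) ⟨
    e ⊗ c ⊗ (λ₁ ⊗ (const 2 ⊕ ⊖ λ₁))        ≈⟨ solve 3 (λ e c l → e :* c :* (l :* (con 2 :- l)) := c :* (e :* l) :* (con 2 :- l)) ≈-refl e c λ₁ ⟩
    c ⊗ (e ⊗ λ₁) ⊗ (const 2 ⊕ ⊖ λ₁)        ≈⟨ ⊗-cong (⊗-cong ≈-refl (≈-sym E1⁵≈)) ≈-refl ⟩
    c ⊗ E1⁵ ⊗ (const 2 ⊕ ⊖ λ₁)            ≈⟨ solve 3 (λ c f l → c :* (f :* f :* (f :* f) :* f) :* l := f :* f :* (c :* (f :* f :* f)) :* l)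
                                                 ≈-refl c E1 (const 2 ⊕ ⊖ λ₁) ⟩
    E1² ⊗ (c ⊗ E1³) ⊗ (const 2 ⊕ ⊖ λ₁)     ≈⟨ ⊗-cong (⊗-cong ≈-refl c⊗E1³) ≈-refl ⟩
    g ⊗ (const 2 ⊕ ⊖ λ₁)                   ≈⟨ solve 2 (λ g l → g :* (con 2 :- l) := con 2 :* g :- g :* l) ≈-refl g λ₁ ⟩
    const 2 ⊗ g ⊕ ⊖ (g ⊗ λ₁)               ∎

  -- Multiplication by e replaces λ₁ by the dissected E1⁵ and comes out of `U 4` as E1. The factor M
  -- z found there turns back into λ₁ by `E1λ₁`, and E1 cancels.
  U₄-gλ₁ : U 4 (g ⊗ λ₁) ≈ λ₁ ⊗ (g₄ ⊕ const 10 ⊗ (a ^ 2 ⊗ a′ ⊗ x ^ 2 ⊗ y))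
  U₄-gλ₁ = ⊗-cancelˡ E1 E1-0 (begin
    E1 ⊗ U 4 (g ⊗ λ₁)        ≈⟨ U-e⊗-cong ≈-refl ⟨
    U 4 (e ⊗ (g ⊗ λ₁))       ≈⟨ U-cong 4 (≈-trans (solve 3 (λ e g l → e :* (g :* l) := g :* (e :* l)) ≈-refl e g λ₁) (⊗-cong ≈-refl (≈-sym E1⁵≈))) ⟩
    U 4 (g ⊗ E1⁵)           ≈⟨ U₄-gE1⁵ ⟩
    a ^ 5 ⊗ M z ⊗ t          ≈⟨ ⊗-cong (≈-sym E1λ₁) ≈-refl ⟩
    E1 ⊗ λ₁ ⊗ t              ≈⟨ R.*-assoc E1 λ₁ t ⟩
    E1 ⊗ (λ₁ ⊗ t)            ∎)
    where t = g₄ ⊕ const 10 ⊗ (a ^ 2 ⊗ a′ ⊗ x ^ 2 ⊗ y)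

  E1C₁ : E1 ⊗ C₁ ≈ g₄ ⊗ (const 2 ⊕ ⊖ λ₁) ⊕ ⊖ (const 10 ⊗ (e ^ 2 ⊗ e′))
  E1C₁ = begin
    E1 ⊗ C₁
      ≈⟨ U-e⊗-cong ≈-refl ⟨
    U 4 (e ⊗ c)
      ≈⟨ ≈-trans (U-cong 4 ec) (U-⊕-cong (U-scalar⊗-cong ≈-refl) (U-⊖-cong ≈-refl)) ⟩
    const 2 ⊗ U 4 g ⊕ ⊖ U 4 (g ⊗ λ₁)
      ≈⟨ ⊕-cong (⊗-cong ≈-refl U₄-g) (⊖-cong U₄-gλ₁) ⟩
    const 2 ⊗ g₄ ⊕ ⊖ (λ₁ ⊗ (g₄ ⊕ const 10 ⊗ (a ^ 2 ⊗ a′ ⊗ x ^ 2 ⊗ y)))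
      ≈⟨ solve 6 (λ g l a b x y → con 2 :* g :- (con 1 :- con 5 :* l) :* (g :+ con 10 :* (a :^ 2 :* b :* x :^ 2 :* y))
           := g :* (con 2 :- (con 1 :- con 5 :* l)) :- con 10 :* ((a :* x) :^ 2 :* (b :* y))) ≈-refl g₄ L a a′ x y ⟩
    g₄ ⊗ (const 2 ⊕ ⊖ λ₁) ⊕ ⊖ (const 10 ⊗ ((a ⊗ x) ^ 2 ⊗ (a′ ⊗ y)))
      ≈⟨ ⊕-cong ≈-refl (⊖-cong (⊗-cong ≈-refl (⊗-cong (^-congˡ 2 ax≈e) a′y≈e′))) ⟩
    g₄ ⊗ (const 2 ⊕ ⊖ λ₁) ⊕ ⊖ (const 10 ⊗ (e ^ 2 ⊗ e′)) ∎

  -- That is, Σ c(5n+4) qⁿ = e′³/(e E1² E2²) - 10 e e′ E1⁴.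
  C₁-eta : E1² ⊗ E2² ⊗ e ⊗ C₁ ≈ e′ ^ 3 ⊕ ⊖ (const 10 ⊗ (e ^ 3 ⊗ e′ ⊗ (E1 ⊗ E2²)))
  C₁-eta = ⊗-cancelˡ E1⁴ (⊗-0 (⊗-0 E1-0 E1-0) (⊗-0 E1-0 E1-0)) (begin
    E1⁴ ⊗ (E1² ⊗ E2² ⊗ e ⊗ C₁)
      ≈⟨ solve 4 (λ f h e c → f :* f :* (f :* f) :* (f :* f :* h :* e :* c) := h :* e :* ((f :* f :* (f :* f) :* f) :* (f :* c))) ≈-refl E1 E2² e C₁ ⟩
    E2² ⊗ e ⊗ (E1⁵ ⊗ (E1 ⊗ C₁))
      ≈⟨ ⊗-cong ≈-refl (⊗-cong E1⁵≈ E1C₁) ⟩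
    E2² ⊗ e ⊗ (e ⊗ λ₁ ⊗ (g₄ ⊗ (const 2 ⊕ ⊖ λ₁) ⊕ ⊖ (const 10 ⊗ (e ^ 2 ⊗ e′))))
      ≈⟨ solve 5 (λ h e l g f → h :* e :* (e :* (con 1 :- con 5 :* l) :* (g :* (con 2 :- (con 1 :- con 5 :* l)) :- con 10 :* (e :^ 2 :* f)))
           := g :* h :* e :^ 2 :- con 10 :* (e :^ 3 :* f :* h :* (e :* (con 1 :- con 5 :* l)))) ≈-refl E2² e L g₄ e′ ⟩
    g₄ ⊗ E2² ⊗ e ^ 2 ⊕ ⊖ (const 10 ⊗ (e ^ 3 ⊗ e′ ⊗ E2² ⊗ (e ⊗ λ₁)))
      ≈⟨ ⊕-cong g₄-eta (⊖-cong (⊗-cong ≈-refl (⊗-cong ≈-refl (≈-sym E1⁵≈)))) ⟩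
    E1⁴ ⊗ e′ ^ 3 ⊕ ⊖ (const 10 ⊗ (e ^ 3 ⊗ e′ ⊗ E2² ⊗ E1⁵))
      ≈⟨ solve 4 (λ f e′ e h → f :* f :* (f :* f) :* e′ :^ 3 :- con 10 :* (e :^ 3 :* e′ :* h :* (f :* f :* (f :* f) :* f))
           := f :* f :* (f :* f) :* (e′ :^ 3 :- con 10 :* (e :^ 3 :* e′ :* (f :* h)))) ≈-refl E1 e′ e E2² ⟩
    E1⁴ ⊗ (e′ ^ 3 ⊕ ⊖ (const 10 ⊗ (e ^ 3 ⊗ e′ ⊗ (E1 ⊗ E2²)))) ∎)

  h : PS
  h = E1³ ⊗ E2³

  -- Multiplied up so that U 4 meets only series in q⁵ and the polynomially dissected E1³E2³, E1⁵, E2⁵.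
  C₁-dissectable : e ⊗ (e ⊗ (e ⊗ (e′ ⊗ C₁))) ≈
    e′ ⊗ (e′ ⊗ (const 3 ⊗ (e ⊗ (e′ ⊗ h)) ⊕ ⊖ (e′ ⊗ (h ⊗ E1⁵)) ⊕ ⊖ (e ⊗ (h ⊗ E2⁵))))
    ⊕ ⊖ (const 10 ⊗ (e ⊗ (e ⊗ (e ⊗ (e ⊗ (e′ ⊗ (e′ ⊗ E1⁴)))))))
  C₁-dissectable = ⊗-cancelˡ e′ e′-0 (begin
    e′ ⊗ (e ⊗ (e ⊗ (e ⊗ (e′ ⊗ C₁))))
      ≈⟨ solve 4 (λ e f c m → f :* (e :* (e :* (e :* (f :* c)))) := e :^ 3 :* f :^ 2 :* c :* con 1) ≈-refl e e′ C₁ L ⟩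
    e ^ 3 ⊗ e′ ^ 2 ⊗ C₁ ⊗ const 1
      -- Modulo 25 the inverse of λ₁ λ₂ is s = 1 + 5L + 5 δL; inserting s λ₁ λ₂ brings in E1⁵ E2⁵.
      ≈⟨ solve 5 (λ e f c l m → e :^ 3 :* f :^ 2 :* c :* con 1
           := e :* (con 1 :+ con 5 :* l :+ con 5 :* m) :* ((e :* (con 1 :- con 5 :* l)) :* (f :* (con 1 :- con 5 :* m)) :* (e :* f :* c))) ≈-refl e e′ C₁ L (δ L) ⟩
    e ⊗ s ⊗ ((e ⊗ λ₁) ⊗ (e′ ⊗ λ₂) ⊗ (e ⊗ e′ ⊗ C₁))
      ≈⟨ ⊗-cong ≈-refl (⊗-cong (⊗-cong E1⁵≈ E2⁵≈) ≈-refl) ⟨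
    e ⊗ s ⊗ (E1⁵ ⊗ E2⁵ ⊗ (e ⊗ e′ ⊗ C₁))
      ≈⟨ solve 6 (λ e f c s E F → e :* s :* ((E :* E :* (E :* E) :* E) :* (F :* F :* (F :* F) :* F) :* (e :* f :* c))
           := e :* f :* s :* (E :* E :* E :* (F :* F :* F)) :* (E :* E :* (F :* F) :* e :* c)) ≈-refl e e′ C₁ s E1 E2 ⟩
    e ⊗ e′ ⊗ s ⊗ h ⊗ (E1² ⊗ E2² ⊗ e ⊗ C₁)
      ≈⟨ ⊗-cong ≈-refl C₁-eta ⟩
    e ⊗ e′ ⊗ s ⊗ h ⊗ (e′ ^ 3 ⊕ ⊖ (const 10 ⊗ (e ^ 3 ⊗ e′ ⊗ (E1 ⊗ E2²))))
      ≈⟨ solve 6 (λ e f l m E F → let s = con 1 :+ con 5 :* l :+ con 5 :* m; h = E :* E :* E :* (F :* F :* F) in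
           e :* f :* s :* h :* (f :^ 3 :- con 10 :* (e :^ 3 :* f :* (E :* (F :* F))))
           := e :* f :^ 4 :* s :* h :- con 10 :* (e :^ 4 :* f :^ 2 :* (E :* E :* (E :* E)) :* (F :* F :* (F :* F) :* F)))
           ≈-refl e e′ L (δ L) E1 E2 ⟩
    e ⊗ e′ ^ 4 ⊗ s ⊗ h ⊕ ⊖ (const 10 ⊗ (e ^ 4 ⊗ e′ ^ 2 ⊗ E1⁴ ⊗ E2⁵))
      ≈⟨ ⊕-cong ≈-refl (⊖-cong (⊗-cong ≈-refl (⊗-cong ≈-refl E2⁵≈))) ⟩
    e ⊗ e′ ^ 4 ⊗ s ⊗ h ⊕ ⊖ (const 10 ⊗ (e ^ 4 ⊗ e′ ^ 2 ⊗ E1⁴ ⊗ (e′ ⊗ λ₂)))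
      -- Here s is rewritten as 3 - λ₁ - λ₂, which becomes linear in E1⁵ and E2⁵, and 10 λ₂ = 10.
      ≈⟨ solve 6 (λ e f l m h E → let l₁ = con 1 :- con 5 :* l; l₂ = con 1 :- con 5 :* m in
           e :* f :^ 4 :* (con 1 :+ con 5 :* l :+ con 5 :* m) :* h :- con 10 :* (e :^ 4 :* f :^ 2 :* E :* (f :* l₂))
           := f :* (f :* (f :* (con 3 :* (e :* (f :* h)) :- f :* (h :* (e :* l₁)) :- e :* (h :* (f :* l₂))))
                :- con 10 :* (e :* (e :* (e :* (e :* (f :* (f :* E)))))))) ≈-refl e e′ L (δ L) h E1⁴ ⟩
    e′ ⊗ (e′ ⊗ (e′ ⊗ (const 3 ⊗ (e ⊗ (e′ ⊗ h)) ⊕ ⊖ (e′ ⊗ (h ⊗ (e ⊗ λ₁))) ⊕ ⊖ (e ⊗ (h ⊗ (e′ ⊗ λ₂)))))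
      ⊕ ⊖ (const 10 ⊗ (e ⊗ (e ⊗ (e ⊗ (e ⊗ (e′ ⊗ (e′ ⊗ E1⁴))))))))
      ≈⟨ ⊗-cong ≈-refl (⊕-cong (⊗-cong ≈-refl (⊗-cong ≈-refl (⊕-cong (⊕-cong ≈-refl
           (⊖-cong (⊗-cong ≈-refl (⊗-cong ≈-refl (≈-sym E1⁵≈))))) (⊖-cong (⊗-cong ≈-refl (⊗-cong ≈-refl (≈-sym E2⁵≈))))))) ≈-refl) ⟩
    _ ∎)
    where s = const 1 ⊕ const 5 ⊗ L ⊕ const 5 ⊗ δ L

  -- This disposes of the second summand of C₁: class 4 of E1⁴ contributes another factor 5.
  U₄-E1⁴ : const 10 ⊗ U 4 E1⁴ ≈ const 0
  U₄-E1⁴ = ≈-trans (⊗-cong ≈-refl (≈₄ dissect-E1⁴))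
    (solve 2 (λ a x → con 10 :* (a :^ 4 :* :- (con 5 :* x :^ 4)) := con 0) ≈-refl a x)

  E1²C₂ : E1² ⊗ C₂ ≈ ⊖ (const 5 ⊗ (E2² ⊗ (a ^ 3 ⊗ a′ ^ 3 ⊗ K)))
  E1²C₂ = ⊗-cancelˡ (E1 ⊗ E2) (⊗-0 E1-0 E2-0) (begin
    E1 ⊗ E2 ⊗ (E1² ⊗ C₂)
      ≈⟨ solve 3 (λ E F c → E :* F :* (E :* E :* c) := E :* (E :* (E :* (F :* c)))) ≈-refl E1 E2 C₂ ⟩
    E1 ⊗ (E1 ⊗ (E1 ⊗ (E2 ⊗ C₂)))
      ≈⟨ U-e⊗-cong (U-e⊗-cong (U-e⊗-cong (U-e′⊗-cong ≈-refl))) ⟨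
    U 4 (e ⊗ (e ⊗ (e ⊗ (e′ ⊗ C₁))))
      ≈⟨ U-cong 4 C₁-dissectable ⟩
    U 4 (e′ ⊗ (e′ ⊗ (const 3 ⊗ (e ⊗ (e′ ⊗ h)) ⊕ ⊖ (e′ ⊗ (h ⊗ E1⁵)) ⊕ ⊖ (e ⊗ (h ⊗ E2⁵))))
      ⊕ ⊖ (const 10 ⊗ (e ⊗ (e ⊗ (e ⊗ (e ⊗ (e′ ⊗ (e′ ⊗ E1⁴))))))))
      ≈⟨ U-⊕-cong
           (U-e′⊗-cong (U-e′⊗-cong (U-⊕-cong (U-⊕-cong (U-scalar⊗-cong (U-e⊗-cong (U-e′⊗-cong U₄-h))) (U-⊖-cong (U-e′⊗-cong hE1⁵))) (U-⊖-cong (U-e⊗-cong hE2⁵)))))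
           (U-⊖-cong (U-scalar⊗-cong (U-e⊗-cong (U-e⊗-cong (U-e⊗-cong (U-e⊗-cong (U-e′⊗-cong (U-e′⊗-cong ≈-refl)))))))) ⟩
    E2 ⊗ (E2 ⊗ (const 3 ⊗ (E1 ⊗ (E2 ⊗ const 0))
        ⊕ ⊖ (E2 ⊗ (a ^ 3 ⊗ a′ ^ 3 ⊗ (const 5 ⊗ E1) ⊗ K₁)) ⊕ ⊖ (E1 ⊗ (a ^ 3 ⊗ a′ ^ 3 ⊗ (const 5 ⊗ E2) ⊗ K₂))))
      ⊕ ⊖ (const 10 ⊗ (E1 ⊗ (E1 ⊗ (E1 ⊗ (E1 ⊗ (E2 ⊗ (E2 ⊗ U 4 E1⁴)))))))
      ≈⟨ solve 7 (λ E F a b t s u →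
           F :* (F :* (con 3 :* (E :* (F :* con 0)) :- F :* (a :* b :* (con 5 :* E) :* t) :- E :* (a :* b :* (con 5 :* F) :* s)))
             :- con 10 :* (E :* (E :* (E :* (E :* (F :* (F :* u))))))
           := E :* F :* :- (con 5 :* (F :* F :* (a :* b :* (t :+ s)))) :- E :^ 4 :* F :^ 2 :* (con 10 :* u))
           ≈-refl E1 E2 (a ^ 3) (a′ ^ 3) K₁ K₂ (U 4 E1⁴) ⟩
    E1 ⊗ E2 ⊗ ⊖ (const 5 ⊗ (E2² ⊗ (a ^ 3 ⊗ a′ ^ 3 ⊗ (K₁ ⊕ K₂)))) ⊕ ⊖ (E1 ^ 4 ⊗ E2 ^ 2 ⊗ (const 10 ⊗ U 4 E1⁴))
      ≈⟨ ⊕-cong (⊗-cong ≈-refl (⊖-cong (⊗-cong ≈-refl (⊗-cong ≈-refl (⊗-cong ≈-refl (≈-sym (R.+-assoc _ _ _)))))))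
           (⊖-cong (≈-trans (⊗-cong ≈-refl U₄-E1⁴) (R.zeroʳ _))) ⟩
    E1 ⊗ E2 ⊗ ⊖ (const 5 ⊗ (E2² ⊗ (a ^ 3 ⊗ a′ ^ 3 ⊗ K))) ⊕ ⊖ const 0
      ≈⟨ solve 1 (λ t → t :- con 0 := t) ≈-refl _ ⟩
    E1 ⊗ E2 ⊗ ⊖ (const 5 ⊗ (E2² ⊗ (a ^ 3 ⊗ a′ ^ 3 ⊗ K))) ∎)
    where
    K₁ K₂ : PS
    K₁ = x ^ 4 ⊗ (const 1 ⊕ ⊖ (const 3 ⊗ z′)) ⊕ x ^ 2 ⊗ y ⊗ (const 3 ⊕ z′)
    K₂ = ⊖ (y ^ 2 ⊗ (const 1 ⊕ ⊖ (const 3 ⊗ z))) ⊕ ⊖ (q ⊗ x ⊗ y ^ 4 ⊗ (const 3 ⊕ z))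
    hE1⁵ : U 4 (h ⊗ E1⁵) ≈ a ^ 3 ⊗ a′ ^ 3 ⊗ (const 5 ⊗ E1) ⊗ K₁
    hE1⁵ = ≈-trans U₄-hE1⁵ (⊗-cong (⊗-cong ≈-refl (≈-trans (⊗-cong ≈-refl (≈-sym E1λ₁)) (5λ₁ E1))) ≈-refl)
    hE2⁵ : U 4 (h ⊗ E2⁵) ≈ a ^ 3 ⊗ a′ ^ 3 ⊗ (const 5 ⊗ E2) ⊗ K₂
    hE2⁵ = ≈-trans U₄-hE2⁵ (⊗-cong (⊗-cong ≈-refl (≈-trans (⊗-cong ≈-refl (≈-sym E2λ₂)) (5λ₂ E2))) ≈-refl)

  -- The multiplier E1⁴ e′³ equals g₄ E2² e² and so brings in the G that K lacks. The 10 is -15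
  -- modulo 25, with 15 coming from `5KG`.
  C₂-eta : C₂ ≈ const 10 ⊗ (e ⊗ (e′ ⊗ E2⁴))
  C₂-eta = ⊗-cancelˡ (e ⊗ λ₁) eλ-0 (⊗-cancelˡ (E1 ⊗ e′ ^ 3) (⊗-0 E1-0 (^-0 3 e′-0)) (begin
    E1 ⊗ e′ ^ 3 ⊗ (e ⊗ λ₁ ⊗ C₂)
      ≈⟨ ⊗-cong ≈-refl (⊗-cong (≈-sym E1⁵≈) ≈-refl) ⟩
    E1 ⊗ e′ ^ 3 ⊗ (E1⁵ ⊗ C₂)
      ≈⟨ solve 3 (λ E f c → E :* f :* (E :* E :* (E :* E) :* E :* c) := E :* E :* (E :* E) :* f :* (E :* E :* c)) ≈-refl E1 (e′ ^ 3) C₂ ⟩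
    E1⁴ ⊗ e′ ^ 3 ⊗ (E1² ⊗ C₂)
      ≈⟨ ⊗-cong (≈-sym g₄-eta) E1²C₂ ⟩
    g₄ ⊗ E2² ⊗ e ^ 2 ⊗ ⊖ (const 5 ⊗ (E2² ⊗ (a ^ 3 ⊗ a′ ^ 3 ⊗ K)))
      ≈⟨ solve 6 (λ a b G K F e → a :^ 2 :* b :* G :* (F :* F) :* e :^ 2 :* :- (con 5 :* (F :* F :* (a :^ 3 :* b :^ 3 :* K)))
           := :- (a :^ 5 :* b :^ 4 :* (F :* F :* (F :* F)) :* e :^ 2 :* (con 5 :* (K :* G)))) ≈-refl a a′ G K E2 e ⟩
    ⊖ (a ^ 5 ⊗ a′ ^ 4 ⊗ E2⁴ ⊗ e ^ 2 ⊗ (const 5 ⊗ (K ⊗ G)))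
      ≈⟨ ⊖-cong (⊗-cong ≈-refl 5KG) ⟩
    ⊖ (a ^ 5 ⊗ a′ ^ 4 ⊗ E2⁴ ⊗ e ^ 2 ⊗ (const 15 ⊗ (y ^ 4 ⊗ M z)))
      ≈⟨ solve 6 (λ a b F e y M → :- (a :^ 5 :* b :^ 4 :* F :* e :^ 2 :* (con 15 :* (y :^ 4 :* M)))
           := con 10 :* (a :^ 5 :* M :* ((b :* y) :^ 4 :* F :* e :^ 2))) ≈-refl a a′ E2⁴ e y (M z) ⟩
    const 10 ⊗ (a ^ 5 ⊗ M z ⊗ ((a′ ⊗ y) ^ 4 ⊗ E2⁴ ⊗ e ^ 2))
      ≈⟨ ⊗-cong ≈-refl (⊗-cong (≈-sym E1λ₁) (⊗-cong (⊗-cong (^-congˡ 4 a′y≈e′) ≈-refl) ≈-refl)) ⟩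
    const 10 ⊗ (E1 ⊗ λ₁ ⊗ (e′ ^ 4 ⊗ E2⁴ ⊗ e ^ 2))
      ≈⟨ solve 5 (λ E l f F e → con 10 :* (E :* l :* (f :^ 4 :* F :* e :^ 2)) := E :* f :^ 3 :* (e :* l :* (con 10 :* (e :* (f :* F))))) ≈-refl E1 λ₁ e′ E2⁴ e ⟩
    E1 ⊗ e′ ^ 3 ⊗ (e ⊗ λ₁ ⊗ (const 10 ⊗ (e ⊗ (e′ ⊗ E2⁴)))) ∎))
    where
    eλ-0 : (e ⊗ λ₁) 0 ≋ + 1
    eλ-0 = ≋-trans (≋-sym (at E1⁵≈ 0)) (⊗-0 (⊗-0 (⊗-0 E1-0 E1-0) (⊗-0 E1-0 E1-0)) E1-0)

  -- Class 3 of E2⁴ comes from class 4 of E1⁴ by doubling exponents, so it is a multiple of 5, and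
  -- 10 · 5 vanishes modulo 25.
  U₃-C₂ : U 3 C₂ ≈ const 0
  U₃-C₂ = begin
    U 3 C₂
      ≈⟨ ≈-trans (U-cong 3 C₂-eta) (U-scalar⊗-cong (U-e⊗-cong (U-e′⊗-cong (≈₃ dissect-E2⁴)))) ⟩
    const 10 ⊗ (E1 ⊗ (E2 ⊗ (q ⊗ (a′ ^ 4 ⊗ ⊖ (const 5 ⊗ y ^ 4)))))
      ≈⟨ solve 5 (λ E F q a y → con 10 :* (E :* (F :* (q :* (a :^ 4 :* :- (con 5 :* y :^ 4))))) := con 0) ≈-refl E1 E2 q a′ y ⟩
    const 0 ∎

theorem2 : (c : ℕ → ℤ)
    → (∀ n → (c ⊛ (qPoch 1 ⊛ qPoch 1 ⊛ qPoch 1)) n ≡ qPoch 2 n)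
    → ∀ n → (+ 25) ∣ c (125 * n + 99)
theorem2 c hyp n = ≡.subst (λ m → (+ 25) ∣ c m) (index n) (ℤ∣.∣⇒∣ᵤ (≡.subst (λ t → + 25 ℤ∣.∣ t) (ℤ.+-identityʳ (c (4 + (4 + (3 + n * 5) * 5) * 5))) (_≋_.25∣ vanishes)))
  where
  c⊗E1³ : c ⊗ E1³ ≈ E2
  c⊗E1³ = ≈-trans (≈-trans (⊗-cong ≈-refl (≈-trans (⊗-cong (≈-sym (⊛≈⊗ E1 E1)) ≈-refl) (≈-sym (⊛≈⊗ _ E1)))) (≈-sym (⊛≈⊗ c _)))
    (coeffwise λ m → ≋-reflexive (hyp m))
  vanishes : c (4 + (4 + (3 + n * 5) * 5) * 5) ≋ + 0
  vanishes = ≋-trans (at (Congruence.U₃-C₂ c c⊗E1³) n) (≋-reflexive (scalar0-at n))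
  index : ∀ n → 4 + (4 + (3 + n * 5) * 5) * 5 ≡ 125 * n + 99
  index = ℕ-solver.solve-∀
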